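{- Let $G=(V,E)$ be a simple 2-connected partial 2-tree with non-negative edge weights $w$, let $L$ be the set of long edges of $G$, and let $\tilde G_1,\dots,\tilde G_r$ be the outerplanar graphs obtained from $G\setminus L$ by the iterative decomposition described in the context. Then $\mathrm{ex}(\mathrm{LSC}(\tilde G_1))\uplus\cdots\uplus\mathrm{ex}(\mathrm{LSC}(\tilde G_r))$ is a minimum cycle basis of $G\setminus L$.
   Context: An edge $\{x,y\}$ is long if it is not a shortest path between $x$ and $y$ in $G$; $G\setminus L=(V,E\setminus L)$. Lex shortest paths and lex short cycles: fix a bijection $\sigma:V\to\{1,\dots,n\}$; a path $P$ between $x\ne y$ is lex shortest if for every other $x$–$y$ path $P'$ either $w(P')>w(P)$, or $w(P')=w(P)$ and $|E(P')|>|E(P)|$, or $w(P')=w(P)$, $|E(P')|=|E(P)|$ and $\min_{z\in V(P')\setminus V(P)}\sigma(z)>\min_{z\in V(P)\setminus V(P')}\sigma(z)$; $\mathrm{LSC}(H)$ is the set of cycles $C$ of $H$ that contain, for all $x,y\in V(C)$, the lex shortest $x$–$y$ path of $H$. One decomposition step $\mathrm{de}(H,u,v)$ applies to a graph $H$ and the branch vertices $u,v$ of a $K_{2,3}$-subdivision in $H$ (a subdivision of $K_{2,3}$; branch vertices are its two degree-3 vertices): let $H_1,\dots,H_k$ be the components of $H-\{u,v\}$; if $\{u,v\}\in E(H)$ the parts are $H[V(H_h)\cup\{u,v\}]$; otherwise fix a shortest $u$–$v$ path $\mathrm{short}(u,v)$ in $H$, lying in $H[V(H_j)\cup\{u,v\}]$,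 and the parts are $H[V(H_j)\cup\{u,v\}]$ and, for $h\ne j$, $H[V(H_h)\cup\{u,v\}]$ plus a new marked edge $\mathrm{green}(u,v)$ of weight $w(\mathrm{short}(u,v))$. Starting from $G\setminus L$, such steps are applied repeatedly to parts that still contain a $K_{2,3}$-subdivision, until all parts $\tilde G_1,\dots,\tilde G_r$ are outerplanar. For a cycle $C$ in some $\tilde G_h$, $\mathrm{ex}(C)$ replaces each marked edge $\mathrm{green}(u,v)$ by the shortest path $\mathrm{short}(u,v)$ it stands for (repeating for marked edges appearing on such paths) to give a cycle of $G\setminus L$; $\mathrm{ex}(\mathcal{C})=\{\mathrm{ex}(C)\mid C\in\mathcal{C}\}$. A minimum cycle basis is a maximal $\mathrm{GF}(2)$-independent set of cycles of minimum total weight.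
   Formalization: The non-negative edge weights w are taken to be rational numbers instead of real numbers. -}

module Defs where

open import Level using (Level)
open import Data.Nat as ℕ using (ℕ; zero; suc)
open import Data.Fin using (Fin; zero; suc; toℕ; _≟_)
open import Data.Fin.Permutation using (Permutation′; _⟨$⟩ʳ_)
open import Data.Bool using (Bool; true; false; _∧_; _∨_; _xor_; not; if_then_else_)
open import Data.List using (List; []; _∷_; _++_; take; drop; length; concat; concatMap; map; reverse; foldr; last; zipWith)
open import Data.List.Relation.Unary.All using (All)
open import Data.List.Relation.Unary.Any using (Any)
open import Data.List.Relation.Unary.AllPairs using (AllPairs)
open import Data.List.Relation.Unary.Unique.Propositional using (Unique)
open import Data.List.Membership.Propositional using (_∈_; _∉_)
open import Data.List.Relation.Binary.Pointwise using (Pointwise)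
open import Data.Maybe using (just)
open import Data.Product using (Σ; ∃; ∃-syntax; _×_; _,_; proj₁; proj₂; uncurry)
open import Data.Sum using (_⊎_)
open import Data.Unit using (⊤)
open import Data.Rational using (ℚ; 0ℚ; _+_; _≤_; _<_)
open import Relation.Nullary using (¬_)
open import Relation.Nullary.Decidable using (⌊_⌋)
open import Relation.Binary.PropositionalEquality using (_≡_; _≢_)

-- Basic list/graph notions.  Vertices are Fin n; an (undirected) edge
-- relation is a predicate E : Fin n → Fin n → Set (required symmetric
-- where relevant).  Paths and cycles are vertex sequences.

Rel₀ : ℕ → Set₁
Rel₀ n = Fin n → Fin n → Set

pairs : ∀ {A : Set} → List A → List (A × A)
pairs (x ∷ y ∷ r) = (x , y) ∷ pairs (y ∷ r)
pairs _ = []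

_==_ : ∀ {n} → Fin n → Fin n → Bool
x == y = ⌊ x ≟ y ⌋

sumℚ : List ℚ → ℚ
sumℚ = foldr _+_ 0ℚ

module _ {n : ℕ} where

  IsWalk : Rel₀ n → List (Fin n) → Set
  IsWalk E ps = All (uncurry E) (pairs ps)

  IsPath : (Fin n → Set) → Rel₀ n → Fin n → Fin n → List (Fin n) → Set
  IsPath V E x y ps =
    (Σ (List (Fin n)) λ mid → ps ≡ x ∷ (mid ++ (y ∷ [])))
    × Unique ps × All V ps × IsWalk E ps

  pathWeight : (Fin n → Fin n → ℚ) → List (Fin n) → ℚ
  pathWeight wt ps = sumℚ (map (uncurry wt) (pairs ps))

  IsShortestPath : (Fin n → Set) → Rel₀ n → (Fin n → Fin n → ℚ) →
                   Fin n → Fin n → List (Fin n) → Set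
  IsShortestPath V E wt x y ps =
    IsPath V E x y ps ×
    (∀ ps′ → IsPath V E x y ps′ → pathWeight wt ps ≤ pathWeight wt ps′)

  cycEdges : List (Fin n) → List (Fin n × Fin n)
  cycEdges cs = pairs (cs ++ take 1 cs)

  IsCycle : (Fin n → Set) → Rel₀ n → List (Fin n) → Set
  IsCycle V E cs =
    3 ℕ.≤ length cs × Unique cs × All V cs × All (uncurry E) (cycEdges cs)

  cycleWeight : (Fin n → Fin n → ℚ) → List (Fin n) → ℚ
  cycleWeight wt cs = sumℚ (map (uncurry wt) (cycEdges cs))

  -- GF(2) edge-incidence vectors (indexed by ordered pairs, symmetric)

  EdgeVec : Set
  EdgeVec = Fin n → Fin n → Bool

  incidence : List (Fin n × Fin n) → EdgeVec
  incidence es a b =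
    foldr (λ p acc → (((proj₁ p == a) ∧ (proj₂ p == b)) ∨
                      ((proj₁ p == b) ∧ (proj₂ p == a))) xor acc) false es

  cycleVec : List (Fin n) → EdgeVec
  cycleVec cs = incidence (cycEdges cs)

  SameCycle : List (Fin n) → List (Fin n) → Set
  SameCycle C D = ∀ a b → cycleVec C a b ≡ cycleVec D a b

  lincomb : List Bool → List EdgeVec → EdgeVec
  lincomb (c ∷ cs) (v ∷ vs) a b = (c ∧ v a b) xor lincomb cs vs a b
  lincomb _ _ a b = false

  Independent : List EdgeVec → Set
  Independent vs =
    ∀ (cs : List Bool) → length cs ≡ length vs →
    (∀ a b → lincomb cs vs a b ≡ false) → All (_≡ false) cs

  IsMaximalIndependentCycles : Rel₀ n → List (List (Fin n)) → Set
  IsMaximalIndependentCycles E B =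
    All (IsCycle (λ _ → ⊤) E) B ×
    Independent (map cycleVec B) ×
    (∀ C → IsCycle (λ _ → ⊤) E C → ¬ Independent (map cycleVec (C ∷ B)))

  totalWeight : (Fin n → Fin n → ℚ) → List (List (Fin n)) → ℚ
  totalWeight wt B = sumℚ (map (cycleWeight wt) B)

  IsMinimumCycleBasis : Rel₀ n → (Fin n → Fin n → ℚ) → List (List (Fin n)) → Set
  IsMinimumCycleBasis E wt B =
    IsMaximalIndependentCycles E B ×
    (∀ B′ → IsMaximalIndependentCycles E B′ → totalWeight wt B ≤ totalWeight wt B′)

module _ {n : ℕ} where

  IsSimple : Rel₀ n → Set
  IsSimple E = (∀ x → ¬ E x x) × (∀ x y → E x y → E y x)

  Connected : Rel₀ n → (Fin n → Set) → Set
  Connected E V = ∀ x y → V x → V y → x ≢ y →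
    Σ (List (Fin n)) λ ps → IsPath V E x y ps

  TwoConnected : Rel₀ n → Set
  TwoConnected E = 3 ℕ.≤ n × Connected E (λ _ → ⊤) ×
    (∀ z → Connected E (λ x → x ≢ z))

-- 2-trees, built from K₂ by repeatedly adding a new vertex (here: vertex
-- zero, old vertices shifted by suc) adjacent to both ends of an edge.
K₂ : Fin 2 → Fin 2 → Bool
K₂ x y = not (x == y)

extend : ∀ {m} → (Fin m → Fin m → Bool) → Fin m → Fin m → Fin (suc m) → Fin (suc m) → Bool
extend T a b zero zero = false
extend T a b zero (suc y) = (y == a) ∨ (y == b)
extend T a b (suc x) zero = (x == a) ∨ (x == b)
extend T a b (suc x) (suc y) = T x y

data TwoTree : (m : ℕ) → (Fin m → Fin m → Bool) → Set where
  base : TwoTree 2 K₂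
  add  : ∀ {m T} → TwoTree m T → (a b : Fin m) → T a b ≡ true →
         TwoTree (suc m) (extend T a b)

Partial2Tree : ∀ {n} → Rel₀ n → Set
Partial2Tree {n} E =
  Σ ℕ λ m → Σ (Fin m → Fin m → Bool) λ T → TwoTree m T ×
  Σ (Fin n → Fin m) λ f → (∀ x y → f x ≡ f y → x ≡ y) ×
  (∀ x y → E x y → T (f x) (f y) ≡ true)

module _ {n : ℕ} (E : Rel₀ n) (w : Fin n → Fin n → ℚ) where

  Long : Rel₀ n
  Long x y = E x y × ¬ IsShortestPath (λ _ → ⊤) E w x y (x ∷ y ∷ [])

  WithoutLong : Rel₀ n
  WithoutLong x y = E x y × ¬ Long x y

-- Parts of the decomposition.  A part is a graph on a subset V of the
-- vertices of G, with edges E (original or marked), weights wt, and for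
-- every ordered pair x y the walk exp x y of G ∖ L that the edge stands
-- for (for an original edge: x ∷ y ∷ []; for a marked edge green(u,v):
-- the recursive expansion of short(u,v)).

record Part (n : ℕ) : Set₁ where
  field
    V   : Fin n → Set
    E   : Rel₀ n
    wt  : Fin n → Fin n → ℚ
    exp : Fin n → Fin n → List (Fin n)
open Part public

module _ {n : ℕ} where

  initialPart : Rel₀ n → (Fin n → Fin n → ℚ) → Part n
  initialPart E w = record
    { V = λ _ → ⊤ ; E = WithoutLong E w ; wt = w ; exp = λ x y → x ∷ y ∷ [] }

  expandPath : Part n → List (Fin n) → List (Fin n)
  expandPath H [] = []
  expandPath H (x ∷ r) =
    x ∷ concatMap (λ p → drop 1 (exp H (proj₁ p) (proj₂ p))) (pairs (x ∷ r))

  ex : Part n → List (Fin n) → List (Fin n)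
  ex H C = concatMap (λ p → drop 1 (exp H (proj₁ p) (proj₂ p))) (cycEdges C)

  PathIn : Part n → Fin n → Fin n → List (Fin n) → Set
  PathIn H = IsPath (V H) (E H)

  K23Branch : Part n → Fin n → Fin n → Set
  K23Branch H u v =
    u ≢ v × Σ (List (Fin n)) λ m₁ → Σ (List (Fin n)) λ m₂ → Σ (List (Fin n)) λ m₃ →
    1 ℕ.≤ length m₁ × 1 ℕ.≤ length m₂ × 1 ℕ.≤ length m₃ ×
    PathIn H u v (u ∷ (m₁ ++ (v ∷ []))) ×
    PathIn H u v (u ∷ (m₂ ++ (v ∷ []))) ×
    PathIn H u v (u ∷ (m₃ ++ (v ∷ []))) ×
    All (_∉ m₂) m₁ × All (_∉ m₃) m₁ × All (_∉ m₃) m₂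

  HasK23 : Part n → Set
  HasK23 H = Σ (Fin n) λ u → Σ (Fin n) λ v → K23Branch H u v

  ConnAvoid : Part n → Fin n → Fin n → Fin n → Fin n → Set
  ConnAvoid H u v x y =
    Σ (List (Fin n)) λ mid → last (x ∷ mid) ≡ just y ×
    All (λ z → V H z × z ≢ u × z ≢ v) (x ∷ mid) × IsWalk (E H) (x ∷ mid)

  Representatives : Part n → Fin n → Fin n → List (Fin n) → Set
  Representatives H u v reps =
    All (λ r → V H r × r ≢ u × r ≢ v) reps ×
    AllPairs (λ r s → ¬ ConnAvoid H u v r s) reps ×
    (∀ x → V H x → x ≢ u → x ≢ v → Any (ConnAvoid H u v x) reps)

  compV : Part n → Fin n → Fin n → Fin n → Fin n → Set
  compV H u v r x = ConnAvoid H u v r x ⊎ x ≡ u ⊎ x ≡ v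

  inducedPart : Part n → Fin n → Fin n → Fin n → Part n
  inducedPart H u v r = record
    { V = compV H u v r
    ; E = λ x y → E H x y × compV H u v r x × compV H u v r y
    ; wt = wt H
    ; exp = exp H }

  isUV : Fin n → Fin n → Fin n → Fin n → Bool
  isUV u v x y = ((x == u) ∧ (y == v)) ∨ ((x == v) ∧ (y == u))

  greenPart : Part n → Fin n → Fin n → Fin n → List (Fin n) → Part n
  greenPart H u v r short = record
    { V = compV H u v r
    ; E = λ x y → (E H x y × compV H u v r x × compV H u v r y) ⊎
                  ((x ≡ u × y ≡ v) ⊎ (x ≡ v × y ≡ u))
    ; wt = λ x y → if isUV u v x y then pathWeight (wt H) short else wt H x y
    ; exp = λ x y → if (x == u) ∧ (y == v) then expandPath H short
                    else if (x == v) ∧ (y == u) then reverse (expandPath H short)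
                    else exp H x y }

  data Decomp : Part n → List (Part n) → Set₁ where
    done : ∀ {H} → ¬ HasK23 H → Decomp H (H ∷ [])
    stepEdge : ∀ {H u v reps} {res : List (List (Part n))} →
      K23Branch H u v → E H u v → Representatives H u v reps →
      Pointwise (λ r out → Decomp (inducedPart H u v r) out) reps res →
      Decomp H (concat res)
    stepNoEdge : ∀ {H u v reps short} {res : List (List (Part n))} →
      K23Branch H u v → ¬ E H u v → Representatives H u v reps →
      IsShortestPath (V H) (E H) (wt H) u v short →
      Pointwise (λ r out →
          (All (compV H u v r) short × Decomp (inducedPart H u v r) out) ⊎
          (¬ All (compV H u v r) short × Decomp (greenPart H u v r short) out))
        reps res →
      Decomp H (concat res)

module _ {n : ℕ} (σ : Permutation′ n) where

  σℕ : Fin n → ℕ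
  σℕ z = toℕ (σ ⟨$⟩ʳ z)

  -- min σ over V(P′) ∖ V(P) is larger than min σ over V(P) ∖ V(P′)
  σSmaller : List (Fin n) → List (Fin n) → Set
  σSmaller P P′ = Σ (Fin n) λ z → z ∈ P × z ∉ P′ ×
    (∀ z′ → z′ ∈ P′ → z′ ∉ P → σℕ z ℕ.< σℕ z′)

  IsLexShortest : Part n → Fin n → Fin n → List (Fin n) → Set
  IsLexShortest H x y P = PathIn H x y P ×
    (∀ P′ → PathIn H x y P′ → P′ ≢ P →
      (pathWeight (wt H) P < pathWeight (wt H) P′) ⊎
      (pathWeight (wt H) P′ ≡ pathWeight (wt H) P × length P ℕ.< length P′) ⊎
      (pathWeight (wt H) P′ ≡ pathWeight (wt H) P × length P′ ≡ length P ×
        σSmaller P P′))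

  PathInCycle : List (Fin n) → List (Fin n) → Set
  PathInCycle P C = All (λ e → e ∈ cycEdges C ⊎ (proj₂ e , proj₁ e) ∈ cycEdges C) (pairs P)

  InLSC : Part n → List (Fin n) → Set
  InLSC H C = IsCycle (V H) (E H) C ×
    (∀ x y → x ∈ C → y ∈ C → x ≢ y →
      Σ (List (Fin n)) λ P → IsLexShortest H x y P × PathInCycle P C)

  EnumeratesLSC : Part n → List (List (Fin n)) → Set
  EnumeratesLSC H Cs = All (InLSC H) Cs × AllPairs (λ C D → ¬ SameCycle C D) Cs ×
    (∀ C → InLSC H C → Any (SameCycle C) Cs)

exAll : ∀ {n} → List (Part n) → List (List (List (Fin n))) → List (List (Fin n))
exAll Gs Css = concat (zipWith (λ H Cs → map (ex H) Cs) Gs Css)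

{-# OPTIONS --safe #-}
module Submission where

-- An independent set B of cycles of G ∖ L is a minimum cycle basis as soon as
-- every cycle C is a GF(2)-sum of members of B of weight at most w(C): pivoting
-- on lightest rows then bounds the weight of B by that of any other basis.
--
-- Every edge of every part is a shortest path of the part, and the paths
-- represented by distinct edges of a part are internally disjoint.
--
-- In a part without K₂,₃ the lex short cycles are exactly the induced ones: a
-- path leaving an induced cycle C can return only to a neighbour on C, so the
-- lex shortest path between two vertices of C is one of the two arcs of C.
-- Splitting a cycle along chords, which are shortest paths, writes it as a sum
-- of induced cycles of no larger weight.  Induced cycles are independent: among
-- the cycles of a relation, look at the vertex z eliminated first in the 2-tree;
-- it has only two later neighbours, so any two of the cycles through z share
-- both, and again without K₂,₃ they coincide.
--
-- At a decomposition step let S be the path of G ∖ L standing for uv.  A cycle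
-- through two components of H − {u,v} is the sum of its two arcs closed up by S,
-- and S is no heavier than either arc.  The vectors spanned by different
-- components overlap only inside S, and a path supports no nonzero vector with
-- even degrees, so the union of the bases is independent.  Three disjoint u–v
-- paths force uv to be an edge of the 2-tree, so the 2-tree serves all parts.
--
-- Edges carry no decision procedure; chords are searched for under a double
-- negation, which the inequality between weights and the maximality absorb.

open import Defs
open import Data.Nat as ℕ using (ℕ; zero; suc; z≤n; s≤s)
open import Data.Nat.Properties as ℕP using ()
open import Data.Fin using (Fin; zero; suc; toℕ; _≟_)
open import Data.Fin.Properties using (toℕ-injective)
open import Data.Fin.Permutation using (Permutation′; _⟨$⟩ʳ_; _⟨$⟩ˡ_; inverseˡ)
open import Data.Bool using (Bool; true; false; _∧_; _∨_; _xor_; not)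
open import Data.Bool.Properties using (∨-comm; xor-assoc; xor-comm; xor-identityʳ; xor-same;
  xor-∧-commutativeRing; ∧-distribˡ-xor; ∧-distribʳ-xor; ∧-zeroʳ; ∧-identityʳ)
open import Data.List using (List; []; _∷_; _++_; drop; length; concat; concatMap; map; reverse; foldr; last; [_])
open import Data.List.Properties using (++-assoc; ++-identityʳ; unfold-reverse; map-++; length-++;
  reverse-involutive; length-reverse; length-map; map-∘)
open import Data.List.Relation.Unary.All as All using (All; []; _∷_)
open import Data.List.Relation.Unary.All.Properties as AllP using ()
open import Data.List.Relation.Unary.Any as Any using (Any; here; there)
open import Data.List.Relation.Unary.Any.Properties as AnyP using ()
open import Data.List.Relation.Unary.AllPairs as AllPairs using (AllPairs; []; _∷_)
open import Data.List.Relation.Unary.Unique.Propositional using (Unique)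
open import Data.List.Membership.Propositional using (_∈_; _∉_; find; lose)
open import Data.List.Membership.Propositional.Properties using (∈-++⁺ˡ; ∈-++⁺ʳ; ∈-++⁻; ∈-∃++;
  ∈-map⁺; ∈-map⁻; ∈-concat⁺′; ∈-concat⁻′)
open import Data.List.Relation.Binary.Permutation.Propositional as Perm using (_↭_; prep; ↭-sym; ↭-trans; ↭-reflexive)
open import Data.List.Relation.Binary.Permutation.Propositional.Properties as PermP using (∈-resp-↭; All-resp-↭; ↭-length)
open import Data.Product using (∃; _×_; _,_; proj₁; proj₂; uncurry)
open import Data.Sum as Sum using (_⊎_; inj₁; inj₂; [_,_]′)
open import Data.Maybe using (just)
open import Data.Unit using (⊤; tt)
open import Data.Empty using (⊥; ⊥-elim)
open import Data.Rational using (ℚ; 0ℚ; _+_; _≤_; _<_)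
open import Data.Rational.Properties as ℚP using ()
open import Function using (_∘_; id)
open import Algebra.Bundles using (module CommutativeRing)
import Algebra.Properties.CommutativeMonoid.Sum (CommutativeRing.+-commutativeMonoid xor-∧-commutativeRing) as ⊕-Sum
open import Relation.Nullary using (¬_; Dec; yes; no; contradiction)
open import Relation.Nullary.Decidable using (_×-dec_; _⊎-dec_; ¬?; decidable-stable; ¬¬-excluded-middle)
open import Relation.Binary.Definitions using (tri<; tri≈; tri>)
open import Relation.Binary.PropositionalEquality using (_≡_; _≢_; refl; sym; trans;
  cong; cong₂; subst; subst₂)
open import Data.List.Relation.Binary.Pointwise using (Pointwise; []; _∷_)

-- Edges, edge vectors and walks

-- Induction along the decomposition works only if a part remembers which path of the original graph
-- each of its edges stands for. `Inv` records this, and every claim about a part concerns expanded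
-- vectors, which are indexed by the same pairs of vertices for all parts. Its shortness condition
-- `no-long` compares an edge with all walks, not only with paths, so it survives the replacement of
-- a marked edge by the path behind it without any loop erasure. An arc closed up by S may fail to
-- be a cycle, because S can run through the same component and share vertices with the arc.
-- Spanning is therefore extended to closed walks, where non-negative weights make each piece no
-- heavier than the whole. Final parts enter only through the absence of a K₂,₃-subdivision and
-- through the elimination order; no embedding and no outer cycle occurs. The order is pulled back
-- from the ambient 2-tree, since a subgraph of a 2-tree need not be a 2-tree.

Edge : ℕ → Set
Edge n = Fin n × Fin n

private variable
  X : Set
  n : ℕ
  U : Fin n → Set
  R : Rel₀ n
  x y z a b u v r : Fin n
  xs ys zs C D : List (Fin n)
  e e′ : Edge n
  es fs : List (Edge n)
  v₁ v₂ v₃ : EdgeVec {n}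
  B B′ : List (List (Fin n))
  t t′ : ℚ

false≢true : false ≢ true
false≢true ()

==-refl : (x : Fin n) → (x == x) ≡ true
==-refl x with x ≟ x
... | yes _ = refl
... | no x≢x = contradiction refl x≢x

==-≢ : x ≢ y → (x == y) ≡ false
==-≢ {x = x} {y} x≢y with x ≟ y
... | yes p = contradiction p x≢y
... | no _ = refl

Same : Edge n → Edge n → Set
Same (x , y) (a , b) = (x ≡ a × y ≡ b) ⊎ (x ≡ b × y ≡ a)

same? : (e e′ : Edge n) → Dec (Same e e′)
same? (x , y) (a , b) = ((x ≟ a) ×-dec (y ≟ b)) ⊎-dec ((x ≟ b) ×-dec (y ≟ a))

Same-sym : Same e e′ → Same e′ e
Same-sym (inj₁ (refl , refl)) = inj₁ (refl , refl)
Same-sym (inj₂ (refl , refl)) = inj₂ (refl , refl)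

Same-trans : ∀ {e₁ e₂ e₃ : Edge n} → Same e₁ e₂ → Same e₂ e₃ → Same e₁ e₃
Same-trans (inj₁ (refl , refl)) q = q
Same-trans (inj₂ (refl , refl)) (inj₁ (refl , refl)) = inj₂ (refl , refl)
Same-trans (inj₂ (refl , refl)) (inj₂ (refl , refl)) = inj₁ (refl , refl)

flip : Edge n → Edge n
flip (x , y) = y , x

infix 4 _∈ₛ_
_∈ₛ_ : Edge n → List (Edge n) → Set
e ∈ₛ es = e ∈ es ⊎ flip e ∈ es

Same⇒∈ₛ : Same e′ e → e′ ∈ es → e ∈ₛ es
Same⇒∈ₛ (inj₁ (refl , refl)) p = inj₁ p
Same⇒∈ₛ (inj₂ (refl , refl)) p = inj₂ p

∈ₛ⇒Same : e ∈ₛ es → ∃ λ e′ → e′ ∈ es × Same e′ e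
∈ₛ⇒Same (inj₁ p) = _ , p , inj₁ (refl , refl)
∈ₛ⇒Same (inj₂ p) = _ , p , inj₂ (refl , refl)

∈ₛ-flip : e ∈ₛ es → flip e ∈ₛ es
∈ₛ-flip (inj₁ p) = inj₂ p
∈ₛ-flip (inj₂ p) = inj₁ p

∈ₛ-⊆ : (∀ {e} → e ∈ es → e ∈ fs) → e ∈ₛ es → e ∈ₛ fs
∈ₛ-⊆ f (inj₁ p) = inj₁ (f p)
∈ₛ-⊆ f (inj₂ p) = inj₂ (f p)

-- The summand of `incidence`, written so that `incidence (e ∷ es) a b` unfolds to
-- `hit e a b xor incidence es a b`.
hit : Edge n → EdgeVec
hit p a b = ((proj₁ p == a) ∧ (proj₂ p == b)) ∨ ((proj₁ p == b) ∧ (proj₂ p == a))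

hit-Same : Same e (a , b) → hit e a b ≡ true
hit-Same {a = a} {b} (inj₁ (refl , refl)) rewrite ==-refl a | ==-refl b = refl
hit-Same {a = a} {b} (inj₂ (refl , refl)) rewrite ==-refl a | ==-refl b = ∨-comm _ true

hit-true : hit e a b ≡ true → Same e (a , b)
hit-true {e = x , y} {a} {b} eq with x ≟ a | y ≟ b | x ≟ b | y ≟ a
hit-true eq | yes p | yes q | _ | _ = inj₁ (p , q)
hit-true eq | _ | _ | yes p | yes q = inj₂ (p , q)
hit-true () | yes p | no q | yes _ | no _
hit-true () | yes p | no q | no _ | yes _
hit-true () | yes p | no q | no _ | no _
hit-true () | no p | yes _ | yes _ | no _
hit-true () | no p | yes _ | no _ | yes _
hit-true () | no p | yes _ | no _ | no _
hit-true () | no p | no _ | yes _ | no _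
hit-true () | no p | no _ | no _ | yes _
hit-true () | no p | no _ | no _ | no _

¬true⇒false : ∀ {c} → c ≢ true → c ≡ false
¬true⇒false {false} _ = refl
¬true⇒false {true} p = contradiction refl p

hit-¬Same : ¬ Same e (a , b) → hit e a b ≡ false
hit-¬Same ¬s = ¬true⇒false (¬s ∘ hit-true)

Bool-ext : ∀ {c d} → (c ≡ true → d ≡ true) → (d ≡ true → c ≡ true) → c ≡ d
Bool-ext {false} {false} f g = refl
Bool-ext {false} {true} f g = g refl
Bool-ext {true} {false} f g = sym (f refl)
Bool-ext {true} {true} f g = refl

hit-cong : Same e e′ → ∀ a b → hit e a b ≡ hit e′ a b
hit-cong s a b = Bool-ext (λ p → hit-Same (Same-trans (Same-sym s) (hit-true p)))
                          (λ p → hit-Same (Same-trans s (hit-true p)))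

-- Edge vectors over GF(2)

infix 4 _≈_
_≈_ : EdgeVec {n} → EdgeVec → Set
v ≈ v′ = ∀ a b → v a b ≡ v′ a b

infixl 6 _⊕_
_⊕_ : EdgeVec {n} → EdgeVec → EdgeVec
(v ⊕ v′) a b = v a b xor v′ a b

𝟘 : EdgeVec {n}
𝟘 _ _ = false

xor-swap : ∀ a b c → a xor (b xor c) ≡ b xor (a xor c)
xor-swap a b c = trans (sym (xor-assoc a b c)) (trans (cong (_xor c) (xor-comm a b)) (xor-assoc b a c))

xor-cancel : ∀ {a b} → a xor b ≡ false → a ≡ b
xor-cancel {false} {false} _ = refl
xor-cancel {true} {true} _ = refl

-- Here `c` is the path or chord that closes up both arcs of a cycle: it is used twice and cancels.
xor-insert : ∀ a b c → a xor b ≡ (a xor c) xor (b xor c)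
xor-insert false b false = sym (xor-identityʳ b)
xor-insert false false true = refl
xor-insert false true true = refl
xor-insert true false false = refl
xor-insert true true false = refl
xor-insert true false true = refl
xor-insert true true true = refl

incidence-++ : (es fs : List (Edge n)) → incidence (es ++ fs) ≈ incidence es ⊕ incidence fs
incidence-++ [] fs a b = refl
incidence-++ (e ∷ es) fs a b = trans (cong (hit e a b xor_) (incidence-++ es fs a b)) (sym (xor-assoc (hit e a b) _ _))

incidence-↭ : es ↭ fs → incidence es ≈ incidence fs
incidence-↭ Perm.refl a b = refl
incidence-↭ (prep e p) a b = cong (hit e a b xor_) (incidence-↭ p a b)
incidence-↭ (Perm.swap e e′ p) a b = trans (xor-swap (hit e a b) (hit e′ a b) _)
  (cong (λ c → hit e′ a b xor (hit e a b xor c)) (incidence-↭ p a b))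
incidence-↭ (Perm.trans p q) a b = trans (incidence-↭ p a b) (incidence-↭ q a b)

incidence-map-flip : (es : List (Edge n)) → incidence (map flip es) ≈ incidence es
incidence-map-flip [] a b = refl
incidence-map-flip (e ∷ es) a b = cong₂ _xor_ (hit-cong {e = flip e} {e} (inj₂ (refl , refl)) a b)
    (incidence-map-flip es a b)

incidence-sym : (es : List (Edge n)) → ∀ a b → incidence es a b ≡ incidence es b a
incidence-sym [] a b = refl
incidence-sym (e ∷ es) a b = cong₂ _xor_ (∨-comm ((proj₁ e == a) ∧ (proj₂ e == b)) ((proj₁ e == b) ∧ (proj₂ e == a)))
    (incidence-sym es a b)

incidence-true : (es : List (Edge n)) → incidence es a b ≡ true → (a , b) ∈ₛ es
incidence-true {a = a} {b} (e ∷ es) eq with same? e (a , b)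
... | yes s = Same⇒∈ₛ s (here refl)
... | no ¬s rewrite hit-¬Same ¬s = ∈ₛ-⊆ there (incidence-true es eq)

incidence-false : ¬ ((a , b) ∈ₛ es) → incidence es a b ≡ false
incidence-false {es = es} ¬p = ¬true⇒false (¬p ∘ incidence-true es)

Distinct : List (Edge n) → Set
Distinct = AllPairs (λ e e′ → ¬ Same e e′)

incidence-Distinct : Distinct es → (a , b) ∈ₛ es → incidence es a b ≡ true
incidence-Distinct {es = es} d p = let e , q , s = ∈ₛ⇒Same p in go d q s
  where
  go : ∀ {es : List (Edge n)} {e} → Distinct es → e ∈ es → Same e (a , b) → incidence es a b ≡ true
  go {es = e ∷ es} (ne ∷ d) (here refl) s
    rewrite hit-Same s = cong not (incidence-false λ q → let e′ , q′ , s′ = ∈ₛ⇒Same q in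
      All.lookup ne q′ (Same-trans s (Same-sym s′)))
  go {es = e ∷ es} (ne ∷ d) (there q) s
    rewrite hit-¬Same {e = e} (λ s′ → All.lookup ne q (Same-trans s′ (Same-sym s))) = go d q s

-- Weights of edge lists

weight : (Fin n → Fin n → ℚ) → List (Edge n) → ℚ
weight wt es = sumℚ (map (uncurry wt) es)

sumℚ-++ : ∀ ps qs → sumℚ (ps ++ qs) ≡ sumℚ ps + sumℚ qs
sumℚ-++ [] qs = sym (ℚP.+-identityˡ _)
sumℚ-++ (p ∷ ps) qs = trans (cong (p +_) (sumℚ-++ ps qs)) (sym (ℚP.+-assoc p _ _))

sumℚ-↭ : ∀ {ps qs} → ps ↭ qs → sumℚ ps ≡ sumℚ qs
sumℚ-↭ Perm.refl = refl
sumℚ-↭ (prep p r) = cong (p +_) (sumℚ-↭ r)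
sumℚ-↭ (Perm.swap p q r) = trans (cong (λ s → p + (q + s)) (sumℚ-↭ r))
  (trans (sym (ℚP.+-assoc p q _)) (trans (cong (_+ _) (ℚP.+-comm p q)) (ℚP.+-assoc q p _)))
sumℚ-↭ (Perm.trans r s) = trans (sumℚ-↭ r) (sumℚ-↭ s)

module _ {wt : Fin n → Fin n → ℚ} where
  weight-++ : ∀ es fs → weight wt (es ++ fs) ≡ weight wt es + weight wt fs
  weight-++ es fs = trans (cong sumℚ (map-++ (uncurry wt) es fs)) (sumℚ-++ (map (uncurry wt) es) _)

  weight-↭ : es ↭ fs → weight wt es ≡ weight wt fs
  weight-↭ p = sumℚ-↭ (PermP.map⁺ (uncurry wt) p)

  weight-flip : (∀ x y → R x y → wt x y ≡ wt y x) → ∀ {es} → All (uncurry R) es → weight wt (map flip es) ≡ weight wt es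
  weight-flip ws [] = refl
  weight-flip ws (r ∷ rs) = cong₂ _+_ (sym (ws _ _ r)) (weight-flip ws rs)

  weight-nonneg : All (λ e → 0ℚ ≤ uncurry wt e) es → 0ℚ ≤ weight wt es
  weight-nonneg [] = ℚP.≤-refl
  weight-nonneg {es = _ ∷ es} (p ∷ ps) =
      ℚP.≤-trans (ℚP.≤-reflexive (sym (ℚP.+-identityˡ 0ℚ))) (ℚP.+-mono-≤ p (weight-nonneg ps))

≤-+ʳ : ∀ {p q} → 0ℚ ≤ q → p ≤ p + q
≤-+ʳ {p} q≥0 = ℚP.≤-trans (ℚP.≤-reflexive (sym (ℚP.+-identityʳ p))) (ℚP.+-monoʳ-≤ p q≥0)

≤-+ˡ : ∀ {p q} → 0ℚ ≤ q → p ≤ q + p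
≤-+ˡ {p} q≥0 = ℚP.≤-trans (ℚP.≤-reflexive (sym (ℚP.+-identityˡ p))) (ℚP.+-monoˡ-≤ p q≥0)

-- Walks

infixr 5 _∷_
-- The list omits the start vertex, so that composition of walks is `++` and a closed walk does not
-- list its base point twice.
data Walk (R : Rel₀ n) : Fin n → List (Fin n) → Fin n → Set where
  [] : Walk R x [] x
  _∷_ : R x y → Walk R y ys z → Walk R x (y ∷ ys) z

steps : Fin n → List (Fin n) → List (Edge n)
steps x ys = pairs (x ∷ ys)

walk-++ : Walk R x ys y → Walk R y zs z → Walk R x (ys ++ zs) z
walk-++ [] q = q
walk-++ (r ∷ p) q = r ∷ walk-++ p q

walk-split : ∀ ys → Walk R x (ys ++ zs) z → ∃ λ y → Walk R x ys y × Walk R y zs z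
walk-split [] p = _ , [] , p
walk-split (_ ∷ ys) (r ∷ p) = let y , q , s = walk-split ys p in y , r ∷ q , s

walk-splitAt : ∀ ys → Walk R x (ys ++ y ∷ zs) z → Walk R x (ys ++ y ∷ []) y × Walk R y zs z
walk-splitAt ys p with walk-split ys p
... | _ , q , r ∷ s = walk-++ q (r ∷ []) , s

walk-map : {Q : Rel₀ n} → (∀ {x y} → R x y → Q x y) → Walk R x ys z → Walk Q x ys z
walk-map f [] = []
walk-map f (r ∷ p) = f r ∷ walk-map f p

walk-All : Walk R x ys z → All (uncurry R) (steps x ys)
walk-All [] = []
walk-All (r ∷ p) = r ∷ walk-All p

All-walk : ∀ ys → All (uncurry R) (steps x (ys ++ y ∷ [])) → Walk R x (ys ++ y ∷ []) y
All-walk [] (r ∷ []) = r ∷ []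
All-walk (_ ∷ ys) (r ∷ p) = r ∷ All-walk ys p

-- The relation λ _ _ → ⊤ turns list shapes into walks.
plain : ∀ (x : Fin n) ys y → Walk (λ _ _ → ⊤) x (ys ++ y ∷ []) y
plain x [] y = tt ∷ []
plain x (z ∷ ys) y = tt ∷ plain z ys y

steps-++ : Walk R x ys y → ∀ zs → steps x (ys ++ zs) ≡ steps x ys ++ steps y zs
steps-++ [] zs = refl
steps-++ (r ∷ p) zs = cong (_ ∷_) (steps-++ p zs)

steps-splitAt : (x : Fin n) → ∀ ys y zs → steps x (ys ++ y ∷ zs) ≡ steps x (ys ++ y ∷ []) ++ steps y zs
steps-splitAt x ys y zs = trans (cong (steps x) (sym (++-assoc ys [ y ] zs))) (steps-++ (plain x ys y) zs)

revTail : Fin n → List (Fin n) → List (Fin n)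
revTail x [] = []
revTail x (y ∷ ys) = revTail y ys ++ [ x ]

revTail-walk : {Q : Rel₀ n} → (∀ {x y} → R x y → Q y x) → Walk R x ys z → Walk Q z (revTail x ys) x
revTail-walk s [] = []
revTail-walk s (r ∷ p) = walk-++ (revTail-walk s p) (s r ∷ [])

reverse-walk : Walk R x ys z → reverse (x ∷ ys) ≡ z ∷ revTail x ys
reverse-walk [] = refl
reverse-walk {x = x} {ys = y ∷ ys} (r ∷ p) = trans (unfold-reverse x (y ∷ ys)) (cong (_++ [ x ]) (reverse-walk p))

revTail-steps : Walk R x ys z → steps z (revTail x ys) ↭ map flip (steps x ys)
revTail-steps [] = Perm.refl
revTail-steps {z = z} (_∷_ {x} {y} {ys} r p) = ↭-trans
  (↭-reflexive (steps-++ (revTail-walk {Q = λ _ _ → ⊤} _ p) [ x ]))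
  (↭-trans (PermP.++-comm (steps z (revTail y ys)) _) (prep _ (revTail-steps p)))

revTail-snoc : ∀ ys → revTail x (ys ++ y ∷ []) ≡ reverse ys ++ [ x ]
revTail-snoc {x = x} {y} ys = lemma ys x
  where
  lemma : ∀ ys x → revTail x (ys ++ y ∷ []) ≡ reverse ys ++ [ x ]
  lemma [] x = refl
  lemma (z ∷ ys) x = cong (_++ [ x ]) (trans (lemma ys z) (sym (unfold-reverse z ys)))

weight-revTail : {wt : Fin n → Fin n → ℚ} → (∀ x y → R x y → wt x y ≡ wt y x) →
  Walk R x ys z → weight wt (steps z (revTail x ys)) ≡ weight wt (steps x ys)
weight-revTail ws p = trans (weight-↭ (revTail-steps p)) (weight-flip ws (walk-All p))

Unique-splitAt : ∀ {A : Set} (xs : List A) {y zs} → Unique (xs ++ y ∷ zs) →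
  y ∉ xs × y ∉ zs × Unique (xs ++ zs)
Unique-splitAt [] (ne ∷ u) = (λ ()) , (λ p → All.lookup ne p refl) , u
Unique-splitAt (x ∷ xs) (ne ∷ u) = let p , q , r = Unique-splitAt xs u in
  (λ { (here refl) → All.lookup ne (∈-++⁺ʳ xs (here refl)) refl ; (there s) → p s }) ,
  q , AllP.++⁺ (AllP.++⁻ˡ xs ne) (All.tail (AllP.++⁻ʳ xs ne)) ∷ r

Unique-++⁻ : ∀ {A : Set} (xs : List A) {ys} → Unique (xs ++ ys) → Unique xs × Unique ys × (∀ {z} → z ∈ xs → z ∉ ys)
Unique-++⁻ [] u = [] , u , λ ()
Unique-++⁻ (x ∷ xs) (ne ∷ u) = let p , q , d = Unique-++⁻ xs u in
  AllP.++⁻ˡ xs ne ∷ p , q , λ { (here refl) s → All.lookup (AllP.++⁻ʳ xs ne) s refl ; (there r) → d r }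

Unique-∷ : ∀ {A : Set} {x : A} {xs} → x ∉ xs → Unique xs → Unique (x ∷ xs)
Unique-∷ x∉ u = AllP.¬Any⇒All¬ _ x∉ ∷ u

Unique-++⁺ : ∀ {A : Set} {xs ys : List A} → Unique xs → Unique ys → (∀ {z} → z ∈ xs → z ∉ ys) → Unique (xs ++ ys)
Unique-++⁺ [] v d = v
Unique-++⁺ {xs = x ∷ xs} (ne ∷ u) v d = AllP.++⁺ ne (AllP.¬Any⇒All¬ _ (d (here refl))) ∷ Unique-++⁺ u v (d ∘ there)

Unique-↭ : ∀ {A : Set} {xs ys : List A} → xs ↭ ys → Unique xs → Unique ys
Unique-↭ Perm.refl u = u
Unique-↭ (prep x p) (ne ∷ u) = All-resp-↭ p ne ∷ Unique-↭ p u
Unique-↭ (Perm.swap x y p) ((x≢y ∷ ne) ∷ ne′ ∷ u) = (x≢y ∘ sym ∷ All-resp-↭ p ne′) ∷ All-resp-↭ p ne ∷ Unique-↭ p u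
Unique-↭ (Perm.trans p q) u = Unique-↭ q (Unique-↭ p u)

steps-∈ : ∀ (x : Fin n) ys → (a , b) ∈ steps x ys → a ∈ x ∷ ys × b ∈ ys
steps-∈ x (y ∷ ys) (here refl) = here refl , here refl
steps-∈ x (y ∷ ys) (there p) = let q , r = steps-∈ y ys p in there q , there r

-- Even vectors and cycles

-- The GF(2) boundary: for a symmetric vector, the parity of the degree at `a`.
∂ : EdgeVec {n} → Fin n → Bool
∂ v a = ⊕-Sum.sum (v a)

∂-⊕ : (v v′ : EdgeVec {n}) → ∀ a → ∂ (v ⊕ v′) a ≡ ∂ v a xor ∂ v′ a
∂-⊕ v v′ a = ⊕-Sum.∑-distrib-+ (v a) (v′ a)

∂-cong : {v v′ : EdgeVec {n}} → v ≈ v′ → ∀ a → ∂ v a ≡ ∂ v′ a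
∂-cong eq a = ⊕-Sum.sum-cong-≗ (eq a)

∂-𝟘 : (a : Fin n) → ∂ 𝟘 a ≡ false
∂-𝟘 {n} a = ⊕-Sum.sum-replicate-zero n

sum-point : (f : Fin n → Bool) (y : Fin n) → (∀ b → b ≢ y → f b ≡ false) → ⊕-Sum.sum f ≡ f y
sum-point {suc n} f zero h = trans (cong (f zero xor_)
  (trans (⊕-Sum.sum-cong-≗ (λ b → h (suc b) λ ())) (⊕-Sum.sum-replicate-zero n))) (xor-identityʳ _)
sum-point {suc n} f (suc y) h = trans (cong (_xor ⊕-Sum.sum (f ∘ suc)) (h zero λ ()))
  (sum-point (f ∘ suc) y λ b b≢y → h (suc b) λ { refl → b≢y refl })

∂-hit : x ≢ y → ∀ a → ∂ (hit (x , y)) a ≡ (x == a) xor (y == a)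
∂-hit {x = x} {y} x≢y a with a ≟ x | a ≟ y
... | yes refl | yes refl = contradiction refl x≢y
... | yes refl | no a≢y = trans
  (trans (sum-point (hit (a , y) a) y λ b b≢y →
      hit-¬Same {e = a , y} λ { (inj₁ (_ , p)) → b≢y (sym p) ; (inj₂ (_ , p)) → a≢y (sym p) })
    (hit-Same {e = a , y} (inj₁ (refl , refl))))
  (sym (cong₂ _xor_ (==-refl a) (==-≢ (a≢y ∘ sym))))
... | no a≢x | yes refl = trans
  (trans (sum-point (hit (x , a) a) x λ b b≢x →
      hit-¬Same {e = x , a} λ { (inj₁ (p , _)) → a≢x (sym p) ; (inj₂ (p , _)) → b≢x (sym p) })
    (hit-Same {e = x , a} (inj₂ (refl , refl))))
  (sym (cong₂ _xor_ (==-≢ (a≢x ∘ sym)) (==-refl a)))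
... | no a≢x | no a≢y = trans
  (trans (∂-cong {v = λ _ → hit (x , y) a} {𝟘} (λ _ b →
      hit-¬Same {e = x , y} λ { (inj₁ (p , _)) → a≢x (sym p) ; (inj₂ (_ , p)) → a≢y (sym p) }) a)
    (∂-𝟘 a))
  (sym (cong₂ _xor_ (==-≢ (a≢x ∘ sym)) (==-≢ (a≢y ∘ sym))))

∂-walk : (∀ {x} → ¬ R x x) → Walk R x ys z → ∀ a → ∂ (incidence (steps x ys)) a ≡ (x == a) xor (z == a)
∂-walk irr ([] {x}) a = trans (∂-𝟘 a) (sym (xor-same (x == a)))
∂-walk irr (_∷_ {x} {y} {ys} {z} r p) a = trans (∂-⊕ (hit (x , y)) (incidence (steps y ys)) a)
  (trans (cong₂ _xor_ (∂-hit {x = x} {y} (λ { refl → irr r }) a) (∂-walk irr p a)) (lemma (x == a) (y == a) (z == a)))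
  where
  lemma : ∀ c d e → (c xor d) xor (d xor e) ≡ c xor e
  lemma c d e = trans (cong (_xor (d xor e)) (xor-comm c d)) (trans (cong (_xor _) (xor-comm d c))
    (trans (xor-assoc c d _) (cong (c xor_) (trans (sym (xor-assoc d d e)) (cong (_xor e) (xor-same d))))))

record Even (v : EdgeVec {n}) : Set where
  field
    symmetric : ∀ a b → v a b ≡ v b a
    even : ∀ a → ∂ v a ≡ false
open Even public

even-𝟘 : Even {n} 𝟘
even-𝟘 = record { symmetric = λ _ _ → refl ; even = ∂-𝟘 }

even-⊕ : {v v′ : EdgeVec {n}} → Even v → Even v′ → Even (v ⊕ v′)
even-⊕ {v = v} {v′} p q = record
  { symmetric = λ a b → cong₂ _xor_ (symmetric p a b) (symmetric q a b)
  ; even = λ a → trans (∂-⊕ v v′ a) (cong₂ _xor_ (even p a) (even q a)) }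

-- At the first vertex of the path only one edge is available, so evenness there forces its
-- coefficient to vanish, and the path can be shortened from that end.
even-path-zero : {v : EdgeVec {n}} → Even v → ∀ x ys → Unique (x ∷ ys) →
  (∀ a b → v a b ≡ true → (a , b) ∈ₛ steps x ys) → v ≈ 𝟘
even-path-zero ev x [] u sp a b = ¬true⇒false λ p → [ (λ ()) , (λ ()) ]′ (sp a b p)
even-path-zero {v = v} ev x (y ∷ ys) u@((x≢y ∷ ne) ∷ u′) sp = even-path-zero ev y ys u′ sp′
  where
  x∉ : x ∉ y ∷ ys
  x∉ = Unique-splitAt [] u .proj₂ .proj₁
  only : ∀ b → b ≢ y → v x b ≡ false
  only b b≢y = ¬true⇒false λ p → [ (λ { (here refl) → b≢y refl ; (there q) → x∉ (steps-∈ y ys q .proj₁) }) ,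
    (λ { (here refl) → x≢y refl ; (there q) → x∉ (there (steps-∈ y ys q .proj₂)) }) ]′ (sp x b p)
  vxy : v x y ≡ false
  vxy = trans (sym (sum-point (v x) y only)) (even ev x)
  sp′ : ∀ a b → v a b ≡ true → (a , b) ∈ₛ steps y ys
  sp′ a b p with sp a b p
  ... | inj₁ (here refl) = contradiction (trans (sym vxy) p) false≢true
  ... | inj₂ (here refl) = contradiction (trans (sym vxy) (trans (symmetric ev x y) p)) false≢true
  ... | inj₁ (there q) = inj₁ q
  ... | inj₂ (there q) = inj₂ q

-- Cycles and their edge sets

cycle-walk : ∀ {c r} → IsCycle U R (c ∷ r) → Walk R c (r ++ [ c ]) c
cycle-walk {r = r} (_ , _ , _ , w) = All-walk r w

cycle-even : (∀ {x} → ¬ R x x) → IsCycle U R C → Even (cycleVec C)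
cycle-even {C = c ∷ r} irr cyc = record
  { symmetric = incidence-sym (cycEdges (c ∷ r))
  ; even = λ a → trans (∂-walk irr (cycle-walk cyc) a) (xor-same (c == a)) }

cycEdges-rotate : ∀ (l : List (Fin n)) z r → cycEdges (l ++ z ∷ r) ↭ cycEdges (z ∷ r ++ l)
cycEdges-rotate [] z r = ↭-reflexive (cong (λ r → cycEdges (z ∷ r)) (sym (++-identityʳ r)))
cycEdges-rotate (c ∷ l) z r = ↭-trans (↭-reflexive lhs)
    (↭-trans (PermP.++-comm (steps c (l ++ [ z ])) _) (↭-reflexive (sym rhs)))
  where
  lhs : steps c ((l ++ z ∷ r) ++ [ c ]) ≡ steps c (l ++ [ z ]) ++ steps z (r ++ [ c ])
  lhs = trans (cong (steps c) (++-assoc l (z ∷ r) [ c ])) (steps-splitAt c l z (r ++ [ c ]))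
  rhs : steps z ((r ++ c ∷ l) ++ [ z ]) ≡ steps z (r ++ [ c ]) ++ steps c (l ++ [ z ])
  rhs = trans (cong (steps z) (++-assoc r (c ∷ l) [ z ])) (steps-splitAt z r c (l ++ [ z ]))

cycle-rotate : z ∈ C → ∃ λ r → C ↭ z ∷ r × cycEdges C ↭ cycEdges (z ∷ r)
cycle-rotate {z = z} z∈C with ∈-∃++ z∈C
... | l , r , refl = r ++ l , PermP.++-comm l (z ∷ r) , cycEdges-rotate l z r

IsCycle-↭ : IsCycle U R C → C ↭ D → cycEdges C ↭ cycEdges D → IsCycle U R D
IsCycle-↭ (l , u , v , w) p q = subst (3 ℕ.≤_) (↭-length p) l , Unique-↭ p u , All-resp-↭ p v , All-resp-↭ q w

cycle-at : IsCycle U R C → z ∈ C → ∃ λ r → IsCycle U R (z ∷ r) × C ↭ z ∷ r × cycEdges C ↭ cycEdges (z ∷ r)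
cycle-at cyc z∈C = let r , p , q = cycle-rotate z∈C in r , IsCycle-↭ cyc p q , p , q

map-proj₁-steps : ∀ (x : Fin n) ys y → map proj₁ (steps x (ys ++ [ y ])) ≡ x ∷ ys
map-proj₁-steps x [] y = refl
map-proj₁-steps x (z ∷ ys) y = cong (x ∷_) (map-proj₁-steps z ys y)

map-proj₂-steps : ∀ (x : Fin n) ys → map proj₂ (steps x ys) ≡ ys
map-proj₂-steps x [] = refl
map-proj₂-steps x (y ∷ ys) = cong (y ∷_) (map-proj₂-steps y ys)

firsts-Unique : Unique C → Unique (map proj₁ (cycEdges C))
firsts-Unique {C = []} u = []
firsts-Unique {C = c ∷ r} u = subst Unique (sym (map-proj₁-steps c r c)) u

seconds-Unique : Unique C → Unique (map proj₂ (cycEdges C))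
seconds-Unique {C = []} u = []
seconds-Unique {C = c ∷ r} u = subst Unique (sym (map-proj₂-steps c (r ++ [ c ]))) (Unique-↭ (PermP.++-comm [ c ] r) u)

Unique-map-injective : ∀ {A B : Set} {f : A → B} {xs x y} → Unique (map f xs) → x ∈ xs → y ∈ xs → f x ≡ f y → x ≡ y
Unique-map-injective u (here refl) (here refl) eq = refl
Unique-map-injective {f = f} (ne ∷ u) (here refl) (there q) eq = contradiction eq (All.lookup ne (∈-map⁺ f q))
Unique-map-injective {f = f} (ne ∷ u) (there p) (here refl) eq = contradiction (sym eq) (All.lookup ne (∈-map⁺ f p))
Unique-map-injective (ne ∷ u) (there p) (there q) eq = Unique-map-injective u p q eq

successor-unique : Unique C → (x , y) ∈ cycEdges C → (x , z) ∈ cycEdges C → y ≡ z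
successor-unique u p q = cong proj₂ (Unique-map-injective (firsts-Unique u) p q refl)

predecessor-unique : Unique C → (y , x) ∈ cycEdges C → (z , x) ∈ cycEdges C → y ≡ z
predecessor-unique u p q = cong proj₁ (Unique-map-injective (seconds-Unique u) p q refl)

cycEdges-∈ : (a , b) ∈ cycEdges C → a ∈ C × b ∈ C
cycEdges-∈ {C = c ∷ r} p = subst (_ ∈_) (map-proj₁-steps c r c) (∈-map⁺ proj₁ p) ,
  ∈-resp-↭ (PermP.++-comm r [ c ]) (subst (_ ∈_) (map-proj₂-steps c (r ++ [ c ])) (∈-map⁺ proj₂ p))

-- Otherwise the successor of the successor of `x` would be `x` again, which only a closed walk of
-- length two allows. This makes the edges of a cycle distinct as undirected edges, so that no
-- coefficient cancels.
no-reversal : 3 ℕ.≤ length C → Unique C → (x , y) ∈ cycEdges C → (y , x) ∉ cycEdges C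
no-reversal {C = C} {x} {y} len u p q with cycle-rotate (cycEdges-∈ {C = C} p .proj₁)
... | r , C↭ , E↭ = go r (subst (3 ℕ.≤_) (↭-length C↭) len) (Unique-↭ C↭ u) (∈-resp-↭ E↭ p) (∈-resp-↭ E↭ q)
  where
  go : ∀ r → 3 ℕ.≤ length (x ∷ r) → Unique (x ∷ r) → (x , y) ∈ cycEdges (x ∷ r) → (y , x) ∈ cycEdges (x ∷ r) → ⊥
  go (s ∷ t ∷ r) len u@((_ ∷ x≢t ∷ _) ∷ _) p q with successor-unique {C = x ∷ s ∷ t ∷ r} u p (here refl)
  ... | refl = x≢t (successor-unique {C = x ∷ s ∷ t ∷ r} u q (there (here refl)))
  go [] (s≤s ())
  go (_ ∷ []) (s≤s (s≤s ()))

AllPairs-map∈ : ∀ {A : Set} {P Q : A → A → Set} {xs} → (∀ {x y} → x ∈ xs → y ∈ xs → P x y → Q x y) →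
  AllPairs P xs → AllPairs Q xs
AllPairs-map∈ f [] = []
AllPairs-map∈ f (ps ∷ pss) = All.tabulate (λ q → f (here refl) (there q) (All.lookup ps q)) ∷
  AllPairs-map∈ (λ p q → f (there p) (there q)) pss

Unique-map⁻ : ∀ {A B : Set} {f : A → B} {xs} → Unique (map f xs) → AllPairs (λ x y → f x ≢ f y) xs
Unique-map⁻ {xs = []} [] = []
Unique-map⁻ {xs = x ∷ xs} (ne ∷ u) = AllP.map⁻ ne ∷ Unique-map⁻ u

cycEdges-Distinct : IsCycle U R C → Distinct (cycEdges C)
cycEdges-Distinct {C = C} (len , u , _) = AllPairs-map∈
  (λ p q x≢y → λ { (inj₁ (eq , _)) → x≢y eq ; (inj₂ (refl , refl)) → no-reversal {C = C} len u p q })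
  (Unique-map⁻ (firsts-Unique u))

cycleVec-true : IsCycle U R C → (a , b) ∈ₛ cycEdges C → cycleVec C a b ≡ true
cycleVec-true cyc = incidence-Distinct (cycEdges-Distinct cyc)

SameCycle-∈ₛ : IsCycle U R C → SameCycle C D → e ∈ₛ cycEdges C → e ∈ₛ cycEdges D
SameCycle-∈ₛ {D = D} cyc eq p = incidence-true (cycEdges D) (trans (sym (eq _ _)) (cycleVec-true cyc p))

∈ₛ-SameCycle : IsCycle U R C → IsCycle U R D →
  (∀ {e} → e ∈ₛ cycEdges C → e ∈ₛ cycEdges D) → (∀ {e} → e ∈ₛ cycEdges D → e ∈ₛ cycEdges C) → SameCycle C D
∈ₛ-SameCycle {C = C} {D} cC cD f g a b = Bool-ext
  (λ p → cycleVec-true cD (f (incidence-true (cycEdges C) p)))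
  (λ p → cycleVec-true cC (g (incidence-true (cycEdges D) p)))

-- Needed because `SameCycle` equates only incidence vectors: the enumerated representative of a
-- cycle may be any rotation or reversal of it. Each edge of `es` is matched with one of `fs`, which
-- is then removed; what is left over is non-negative.
weight-⊆ : {wt : Fin n → Fin n → ℚ} → (∀ x y → R x y → wt x y ≡ wt y x) → (∀ x y → R x y → 0ℚ ≤ wt x y) →
  All (uncurry R) fs → Distinct es → (∀ {e} → e ∈ es → e ∈ₛ fs) → weight wt es ≤ weight wt fs
weight-⊆ {es = []} ws nn Rs d h = weight-nonneg (All.map (λ {e} → nn (proj₁ e) (proj₂ e)) Rs)
weight-⊆ {R = R} {fs = fs} {es = e ∷ es} {wt} ws nn Rs (ne ∷ d) h with ∈ₛ⇒Same (h (here refl))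
... | f , f∈fs , s with ∈-∃++ f∈fs
... | l , r , refl = ℚP.≤-trans (ℚP.+-mono-≤ (ℚP.≤-reflexive (we s)) rest)
        (ℚP.≤-reflexive (weight-↭ {es = f ∷ l ++ r} {l ++ f ∷ r} (↭-sym (PermP.shift f l r))))
  where
  Rs′ : All (uncurry R) (f ∷ l ++ r)
  Rs′ = All-resp-↭ (PermP.shift f l r) Rs
  we : Same f e → uncurry wt e ≡ uncurry wt f
  we (inj₁ (refl , refl)) = refl
  we (inj₂ (refl , refl)) = sym (ws _ _ (All.head Rs′))
  rest : weight wt es ≤ weight wt (l ++ r)
  rest = weight-⊆ ws nn (All.tail Rs′) d λ {e′} p → drop-f (h (there p)) λ s′ → All.lookup ne p (Same-trans (Same-sym s) s′)
    where
    drop-f : ∀ {e′} → e′ ∈ₛ l ++ f ∷ r → ¬ Same f e′ → e′ ∈ₛ l ++ r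
    drop-f q ¬s with ∈ₛ⇒Same q
    ... | g , g∈ , s″ with ∈-resp-↭ (PermP.shift f l r) g∈
    ... | here refl = contradiction s″ ¬s
    ... | there g∈′ = Same⇒∈ₛ s″ g∈′

-- Expansion of marked edges

path-Distinct : Unique (x ∷ ys) → Distinct (steps x ys)
path-Distinct {ys = []} u = []
path-Distinct {x = x} {ys = y ∷ ys} u@((x≢y ∷ _) ∷ u′) = All.tabulate apart ∷ path-Distinct u′
  where
  x∉ : x ∉ y ∷ ys
  x∉ = Unique-splitAt [] u .proj₂ .proj₁
  apart : ∀ {e} → e ∈ steps y ys → ¬ Same (x , y) e
  apart p (inj₁ (refl , _)) = x∉ (steps-∈ y ys p .proj₁)
  apart p (inj₂ (refl , _)) = x∉ (there (steps-∈ y ys p .proj₂))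

steps-≢ : Unique (x ∷ ys) → (a , b) ∈ steps x ys → a ≢ b
steps-≢ {ys = y ∷ ys} ((x≢y ∷ _) ∷ u) (here refl) = x≢y
steps-≢ {ys = y ∷ ys} (_ ∷ u) (there p) = steps-≢ u p

-- `ex` drops the first vertex of every expansion, so for a cycle starting at `c` it produces a list
-- that ends with `c` instead of beginning with it. The two readings differ by a rotation.
closed-cycEdges : ∀ {c L} → Walk R c L c → cycEdges L ↭ steps c L
closed-cycEdges {L = []} p = Perm.refl
closed-cycEdges {c = c} {L = l ∷ L} (r ∷ p) = ↭-trans (↭-reflexive (steps-++ p [ l ])) (PermP.++-comm (steps l L) _)

-- The condition under which the tails of two expansions are disjoint: a tail contains the head of
-- its edge but not the origin, so the heads must differ, and the two edges must not be reversals,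
-- whose interiors agree.
Apart : Edge n → Edge n → Set
Apart (x , y) (x′ , y′) = y ≢ y′ × ¬ (x ≡ y′ × y ≡ x′)

path-Apart : Unique (x ∷ ys) → AllPairs Apart (steps x ys)
path-Apart {ys = []} u = []
path-Apart {x = x} {ys = y ∷ ys} u@(_ ∷ u′) = All.tabulate (λ p →
  (λ { refl → Unique-splitAt [] u′ .proj₂ .proj₁ (steps-∈ y ys p .proj₂) }) ,
  (λ { (refl , _) → Unique-splitAt [] u .proj₂ .proj₁ (there (steps-∈ y ys p .proj₂)) })) ∷ path-Apart u′

cycle-Apart : IsCycle U R C → AllPairs Apart (cycEdges C)
cycle-Apart {C = C} (len , u , _) = AllPairs-map∈
  (λ p q y≢y′ → y≢y′ , λ { (refl , refl) → no-reversal {C = C} len u p q })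
  (Unique-map⁻ (seconds-Unique u))

length-steps : ∀ (x : Fin n) ys → length (steps x ys) ≡ length ys
length-steps x [] = refl
length-steps x (y ∷ ys) = cong suc (length-steps y ys)

exps : Part n → List (Edge n) → List (Edge n)
exps H = concatMap (λ e → pairs (exp H (proj₁ e) (proj₂ e)))

expTail : Part n → Fin n → Fin n → List (Fin n)
expTail H x y = drop 1 (exp H x y)

expandTail : Part n → Fin n → List (Fin n) → List (Fin n)
expandTail H x ys = concatMap (λ p → drop 1 (exp H (proj₁ p) (proj₂ p))) (steps x ys)

exps-++ : (H : Part n) → ∀ es fs → exps H (es ++ fs) ≡ exps H es ++ exps H fs
exps-++ H [] fs = refl
exps-++ H (e ∷ es) fs = trans (cong (pairs (exp H (proj₁ e) (proj₂ e)) ++_) (exps-++ H es fs))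
    (sym (++-assoc (pairs (exp H (proj₁ e) (proj₂ e))) _ _))

exps-↭ : (H : Part n) → es ↭ fs → exps H es ↭ exps H fs
exps-↭ H Perm.refl = Perm.refl
exps-↭ H (prep e p) = PermP.++⁺ˡ _ (exps-↭ H p)
exps-↭ H (Perm.swap e e′ p) = ↭-trans
    (PermP.shifts (pairs (exp H (proj₁ e) (proj₂ e))) (pairs (exp H (proj₁ e′) (proj₂ e′))))
  (PermP.++⁺ˡ (pairs (exp H (proj₁ e′) (proj₂ e′))) (PermP.++⁺ˡ (pairs (exp H (proj₁ e) (proj₂ e))) (exps-↭ H p)))
exps-↭ H (Perm.trans p q) = ↭-trans (exps-↭ H p) (exps-↭ H q)

exps-∈⁻ : (H : Part n) → ∀ es → (a , b) ∈ exps H es → ∃ λ e → e ∈ es × (a , b) ∈ pairs (exp H (proj₁ e) (proj₂ e))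
exps-∈⁻ H (e ∷ es) p with ∈-++⁻ (pairs (exp H (proj₁ e) (proj₂ e))) p
... | inj₁ q = e , here refl , q
... | inj₂ q = let e′ , r , s = exps-∈⁻ H es q in e′ , there r , s

Supp : Part n → Fin n → Fin n → Set
Supp H a b = ∃ λ x → ∃ λ y → E H x y × (a , b) ∈ pairs (exp H x y)

module Expansion {n : ℕ} (G : Rel₀ n) (w : Fin n → Fin n → ℚ) (A : Rel₀ n) where

  -- A is the adjacency of the 2-tree; the interior of the path exp H x y
  -- consists of its vertices outside V H.
  record Inv (H : Part n) : Set where
    field
      E-sym : E H x y → E H y x
      E-V : E H x y → V H x
      E-irr : ¬ E H x x
      E-A : E H x y → A x y
      wt-sym : ∀ x y → E H x y → wt H x y ≡ wt H y x
      wt-nonneg : ∀ x y → E H x y → 0ℚ ≤ wt H x y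
      no-long : E H x y → Walk (E H) x ys y → wt H x y ≤ weight (wt H) (steps x ys)
      exp-tail : E H x y → exp H x y ≡ x ∷ expTail H x y
      exp-walk : E H x y → Walk G x (expTail H x y) y
      exp-unique : E H x y → Unique (exp H x y)
      exp-reverse : E H x y → exp H y x ≡ reverse (exp H x y)
      exp-weight : E H x y → weight w (pairs (exp H x y)) ≡ wt H x y
      exp-V : E H x y → a ∈ exp H x y → V H a → a ≡ x ⊎ a ≡ y
      exp-disjoint : ∀ {x y x′ y′} → E H x y → E H x′ y′ → a ∈ exp H x y → a ∈ exp H x′ y′ → ¬ V H a → Same (x , y) (x′ , y′)

  module InvProperties {H : Part n} (I : Inv H) where
    open Inv I

    exp-pairs : E H x y → pairs (exp H x y) ≡ steps x (expTail H x y)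
    exp-pairs p = cong pairs (exp-tail p)

    exp-unique′ : E H x y → Unique (x ∷ expTail H x y)
    exp-unique′ p = subst Unique (exp-tail p) (exp-unique p)

    expand-walk : Walk (E H) x ys z → Walk G x (expandTail H x ys) z
    expand-walk [] = []
    expand-walk (p ∷ q) = walk-++ (exp-walk p) (expand-walk q)

    expand-steps : Walk (E H) x ys z → steps x (expandTail H x ys) ≡ exps H (steps x ys)
    expand-steps [] = refl
    expand-steps (_∷_ {y = y} {ys} p q) = trans (steps-++ (exp-walk p) (expandTail H y ys))
      (cong₂ _++_ (sym (exp-pairs p)) (expand-steps q))

    exps-weight : All (uncurry (E H)) es → weight w (exps H es) ≡ weight (wt H) es
    exps-weight [] = refl
    exps-weight {es = e ∷ es} (p ∷ ps) = trans (weight-++ (pairs (exp H (proj₁ e) (proj₂ e))) (exps H es))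
      (cong₂ _+_ (exp-weight p) (exps-weight ps))

    exp-pairs-flip : E H x y → pairs (exp H y x) ↭ map flip (pairs (exp H x y))
    exp-pairs-flip p = ↭-trans (↭-reflexive
        (cong pairs (trans (exp-reverse p) (trans (cong reverse (exp-tail p)) (reverse-walk (exp-walk p))))))
      (↭-trans (revTail-steps (exp-walk p)) (↭-reflexive (cong (map flip) (sym (exp-pairs p)))))

    exp-∈-flip : E H x y → (a , b) ∈ pairs (exp H x y) → (b , a) ∈ pairs (exp H y x)
    exp-∈-flip p q = ∈-resp-↭ (↭-sym (exp-pairs-flip p)) (∈-map⁺ flip q)

    exps-flip : All (uncurry (E H)) es → incidence (exps H (map flip es)) ≈ incidence (exps H es)
    exps-flip [] a b = refl
    exps-flip {es = (x , y) ∷ es} (p ∷ ps) a b =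
      trans (incidence-++ (pairs (exp H y x)) _ a b)
      (trans (cong₂ _xor_ (trans (incidence-↭ (exp-pairs-flip p) a b) (incidence-map-flip (pairs (exp H x y)) a b))
          (exps-flip ps a b))
      (sym (incidence-++ (pairs (exp H x y)) _ a b)))

    exps-revTail : Walk (E H) x ys z → incidence (exps H (steps z (revTail x ys))) ≈ incidence (exps H (steps x ys))
    exps-revTail p a b = trans (incidence-↭ (exps-↭ H (revTail-steps p)) a b) (exps-flip (walk-All p) a b)

    Supp-sym : Supp H a b → Supp H b a
    Supp-sym (x , y , p , q) = y , x , E-sym p , exp-∈-flip p q

    Supp-ₛ : (a , b) ∈ₛ exps H es → All (uncurry (E H)) es → Supp H a b
    Supp-ₛ {es = es} (inj₁ p) ps = let e , q , r = exps-∈⁻ H es p in _ , _ , All.lookup ps q , r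
    Supp-ₛ {es = es} (inj₂ p) ps = let e , q , r = exps-∈⁻ H es p in Supp-sym (_ , _ , All.lookup ps q , r)

    exp-pairs-∈ : E H x y → (a , b) ∈ pairs (exp H x y) → a ∈ exp H x y × b ∈ exp H x y × a ≢ b
    exp-pairs-∈ {x} {y} p q with subst (_ ∈_) (exp-pairs p) q
    ... | q′ = let r , s = steps-∈ x (expTail H x y) q′ in
      subst (_ ∈_) (sym (exp-tail p)) r , subst (_ ∈_) (sym (exp-tail p)) (there s) , steps-≢ (exp-unique′ p) q′

    exp-pairs-V : E H x y → (a , b) ∈ pairs (exp H x y) → V H a → V H b → Same (a , b) (x , y)
    exp-pairs-V p q va vb with exp-pairs-∈ p q
    ... | a∈ , b∈ , a≢b with exp-V p a∈ va | exp-V p b∈ vb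
    ... | inj₁ refl | inj₁ refl = contradiction refl a≢b
    ... | inj₁ refl | inj₂ refl = inj₁ (refl , refl)
    ... | inj₂ refl | inj₁ refl = inj₂ (refl , refl)
    ... | inj₂ refl | inj₂ refl = contradiction refl a≢b

    -- Were the edges different, neither `a` nor `b` could be interior to the expansions, so both
    -- would be vertices of the part and `(a , b)` would be each of the two edges. `V` is not
    -- decidable, hence the double negations; the decidability of `Same` absorbs them.
    exp-pairs-disjoint : ∀ {x y x′ y′} → E H x y → E H x′ y′ → (a , b) ∈ pairs (exp H x y) → (a , b) ∈ pairs (exp H x′ y′) →
      Same (x , y) (x′ , y′)
    exp-pairs-disjoint {x = x} {y} {x′} {y′} p p′ q q′ with same? (x , y) (x′ , y′)
    ... | yes s = s
    ... | no ¬s = ⊥-elim (¬¬V (exp-pairs-∈ p q .proj₁) (exp-pairs-∈ p′ q′ .proj₁) λ va →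
                          ¬¬V (exp-pairs-∈ p q .proj₂ .proj₁) (exp-pairs-∈ p′ q′ .proj₂ .proj₁) λ vb →
                          ¬s (Same-trans (Same-sym (exp-pairs-V p q va vb)) (exp-pairs-V p′ q′ va vb)))
      where
      ¬¬V : ∀ {a} → a ∈ exp H x y → a ∈ exp H x′ y′ → ¬ ¬ V H a
      ¬¬V r r′ ¬va = ¬s (exp-disjoint p p′ r r′ ¬va)

    exp-pairs-disjointₛ : ∀ {x y x′ y′} → E H x y → E H x′ y′ → (a , b) ∈ pairs (exp H x y) →
        (a , b) ∈ₛ pairs (exp H x′ y′) →
      Same (x , y) (x′ , y′)
    exp-pairs-disjointₛ p p′ q (inj₁ q′) = exp-pairs-disjoint p p′ q q′
    exp-pairs-disjointₛ p p′ q (inj₂ q′) =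
        Same-trans (exp-pairs-disjoint p (E-sym p′) q (exp-∈-flip p′ q′)) (inj₂ (refl , refl))

    incidence-exp : ∀ {p q} → E H p q → E H x y → (a , b) ∈ pairs (exp H x y) →
        incidence (pairs (exp H p q)) a b ≡ hit (p , q) x y
    incidence-exp {x} {y} {p = p} {q} pq xy i with same? (p , q) (x , y)
    ... | no ¬s = trans (incidence-false (λ j → ¬s (Same-sym (exp-pairs-disjointₛ xy pq i j))))
        (sym (hit-¬Same {e = p , q} ¬s))
    ... | yes s = trans (incidence-Distinct (subst Distinct (sym (exp-pairs pq)) (path-Distinct (exp-unique′ pq))) (move s))
                        (sym (hit-Same {e = p , q} s))
      where
      move : Same (p , q) (x , y) → _ ∈ₛ pairs (exp H p q)
      move (inj₁ (refl , refl)) = inj₁ i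
      move (inj₂ (refl , refl)) = inj₂ (exp-∈-flip xy i)

    -- No other expansion meets a pair on the expansion of `xy`, so the coefficient there reads off
    -- the coefficient of `xy`. This carries equations between expanded vectors back to the part.
    incidence-exps : All (uncurry (E H)) es → E H x y → (a , b) ∈ pairs (exp H x y) →
        incidence (exps H es) a b ≡ incidence es x y
    incidence-exps [] xy i = refl
    incidence-exps {es = e ∷ es} {a = a} {b} (p ∷ ps) xy i = trans (incidence-++ (pairs (exp H (proj₁ e) (proj₂ e))) _ a b)
      (cong₂ _xor_ (incidence-exp p xy i) (incidence-exps ps xy i))

    incidence-exps-cong : All (uncurry (E H)) es → All (uncurry (E H)) fs → incidence es ≈ incidence fs →
        incidence (exps H es) ≈ incidence (exps H fs)
    incidence-exps-cong ps qs eq a b = Bool-ext (half ps qs eq) (half qs ps (λ a b → sym (eq a b)))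
      where
      half : ∀ {es fs : List (Edge n)} {a b} → All (uncurry (E H)) es → All (uncurry (E H)) fs →
          incidence es ≈ incidence fs →
        incidence (exps H es) a b ≡ true → incidence (exps H fs) a b ≡ true
      half {es} {fs} ps qs eq t = let x , y , xy , i = Supp-ₛ (incidence-true (exps H es) t) ps in
        trans (incidence-exps qs xy i) (trans (sym (eq x y)) (trans (sym (incidence-exps ps xy i)) t))

    expTail-∈ : E H x y → a ∈ expTail H x y → a ∈ exp H x y × a ≢ x
    expTail-∈ p q = subst (_ ∈_) (sym (exp-tail p)) (there q) ,
        λ { refl → Unique-splitAt [] (exp-unique′ p) .proj₂ .proj₁ q }

    expTail-disjoint : ∀ {x y x′ y′} → E H x y → E H x′ y′ → Apart (x , y) (x′ , y′) → a ∈ expTail H x y →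
        a ∉ expTail H x′ y′
    expTail-disjoint {x = x} {y} {x′} {y′} p p′ (y≢y′ , ¬rev) q q′ = ¬¬V λ va →
        y≢y′ (trans (sym (end p q va)) (end p′ q′ va))
      where
      ¬¬V : ¬ ¬ V H _
      ¬¬V ¬va with exp-disjoint p p′ (expTail-∈ p q .proj₁) (expTail-∈ p′ q′ .proj₁) ¬va
      ... | inj₁ (_ , eq) = y≢y′ eq
      ... | inj₂ rev = ¬rev rev
      end : ∀ {x y a} → E H x y → a ∈ expTail H x y → V H a → a ≡ y
      end p q va with expTail-∈ p q
      ... | a∈ , a≢x with exp-V p a∈ va
      ... | inj₁ eq = contradiction eq a≢x
      ... | inj₂ eq = eq

    concat-unique : All (uncurry (E H)) es → AllPairs Apart es →
        Unique (concatMap (λ p → drop 1 (exp H (proj₁ p) (proj₂ p))) es)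
    concat-unique [] [] = []
    concat-unique {es = e ∷ es} (p ∷ ps) (ap ∷ aps) =
        Unique-++⁺ (AllPairs.tail (exp-unique′ p)) (concat-unique ps aps) (λ q r → disj ps ap q r)
      where
      disj : ∀ {es a} → All (uncurry (E H)) es → All (Apart e) es → a ∈ expTail H (proj₁ e) (proj₂ e) →
        a ∉ concatMap (λ p → drop 1 (exp H (proj₁ p) (proj₂ p))) es
      disj {e′ ∷ es} (p′ ∷ ps) (ap ∷ aps) q r with ∈-++⁻ (expTail H (proj₁ e′) (proj₂ e′)) r
      ... | inj₁ s = expTail-disjoint p p′ ap q s
      ... | inj₂ s = disj ps aps q s

    expandTail-∈ : Walk (E H) x ys z → a ∈ expandTail H x ys → ∃ λ p → ∃ λ q → (p , q) ∈ steps x ys × E H p q ×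
        a ∈ exp H p q × a ≢ p
    expandTail-∈ (_∷_ {x} {y} p ps) i with ∈-++⁻ (expTail H x y) i
    ... | inj₁ j = x , y , here refl , p , expTail-∈ p j
    ... | inj₂ j = let p , q , k , l = expandTail-∈ ps j in p , q , there k , l

    expand-unique : Walk (E H) x ys z → V H x → Unique (x ∷ ys) → Unique (x ∷ expandTail H x ys)
    expand-unique {x} {ys} ws vx u = Unique-∷ x∉ (concat-unique (walk-All ws) (path-Apart u))
      where
      x∉ : x ∉ expandTail H x ys
      x∉ i with expandTail-∈ ws i
      ... | p , q , j , pq , x∈ , x≢p with exp-V pq x∈ vx
      ... | inj₁ eq = x≢p eq
      ... | inj₂ refl = Unique-splitAt [] u .proj₂ .proj₁ (steps-∈ x ys j .proj₂)

    length-expand : All (uncurry (E H)) es → length es ℕ.≤ length (concatMap (λ p → drop 1 (exp H (proj₁ p) (proj₂ p))) es)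
    length-expand [] = z≤n
    length-expand {es = e ∷ es} (p ∷ ps) with expTail H (proj₁ e) (proj₂ e) | exp-walk p
    ... | [] | [] = contradiction p E-irr
    ... | _ ∷ t | _ = s≤s (subst (length es ℕ.≤_) (sym (length-++ t))
        (ℕP.≤-trans (length-expand ps) (ℕP.m≤n+m _ (length t))))

    cycle-Edges : IsCycle (V H) (E H) C → All (uncurry (E H)) (cycEdges C)
    cycle-Edges (_ , _ , _ , p) = p

    ex-cycEdges : IsCycle (V H) (E H) C → cycEdges (ex H C) ↭ exps H (cycEdges C)
    ex-cycEdges {C = c ∷ r} cyc = ↭-trans (closed-cycEdges (expand-walk (cycle-walk cyc)))
        (↭-reflexive (expand-steps (cycle-walk cyc)))

    ex-IsCycle : IsCycle (V H) (E H) C → IsCycle (λ _ → ⊤) G (ex H C)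
    ex-IsCycle {C = c ∷ r} cyc@(len , u , _ , p) =
      ℕP.≤-trans len (ℕP.≤-trans (ℕP.≤-reflexive
          (trans (ℕP.+-comm 1 (length r)) (trans (sym (length-++ r)) (sym (length-steps c (r ++ [ c ]))))))
              (length-expand p)) ,
      concat-unique p (cycle-Apart cyc) ,
      All.tabulate _ ,
      All-resp-↭ (↭-sym (closed-cycEdges (expand-walk (cycle-walk cyc)))) (walk-All (expand-walk (cycle-walk cyc)))

    ex-cycleVec : IsCycle (V H) (E H) C → cycleVec (ex H C) ≈ incidence (exps H (cycEdges C))
    ex-cycleVec cyc = incidence-↭ (ex-cycEdges cyc)

    ex-cycleWeight : IsCycle (V H) (E H) C → cycleWeight w (ex H C) ≡ weight (wt H) (cycEdges C)
    ex-cycleWeight {C = C} cyc = trans (weight-↭ (ex-cycEdges cyc)) (exps-weight (cycle-Edges {C = C} cyc))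

-- Elimination orders of 2-trees

walk-suffix : Walk R y ys z → x ∈ y ∷ ys → ∃ λ l → ∃ λ r → ∃ λ L →
  y ∷ ys ≡ l ++ x ∷ r × Walk R x r z × steps y ys ≡ L ++ steps x r
walk-suffix p (here refl) = [] , _ , [] , refl , p , refl
walk-suffix (_∷_ {y} r p) (there i) = let l , r′ , L , eq , q , eq′ = walk-suffix p i in
  y ∷ l , r′ , _ ∷ L , cong (y ∷_) eq , q , cong (_ ∷_) eq′

walk-unsnoc : Walk R x (y ∷ ys) z → ∃ λ mid → y ∷ ys ≡ mid ++ [ z ]
walk-unsnoc (r ∷ []) = [] , refl
walk-unsnoc {y = y} (r ∷ p@(_ ∷ _)) = let mid , eq = walk-unsnoc p in y ∷ mid , cong (y ∷_) eq

-- Loop erasure: an erased loop has non-negative weight. It turns minimality among paths into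
-- minimality among walks.
walk-to-path : {wt : Fin n → Fin n → ℚ} → (∀ x y → R x y → 0ℚ ≤ wt x y) → Walk R x ys z →
  ∃ λ ys′ → Walk R x ys′ z × Unique (x ∷ ys′) × weight wt (steps x ys′) ≤ weight wt (steps x ys)
walk-to-path nn [] = [] , [] , [] ∷ [] , ℚP.≤-refl
walk-to-path {wt = wt} nn (_∷_ {x} {y} r p) with walk-to-path nn p
... | ys′ , p′ , u , le with Any.any? (x ≟_) (y ∷ ys′)
... | no x∉ = y ∷ ys′ , r ∷ p′ , Unique-∷ x∉ u , ℚP.+-monoʳ-≤ (wt x y) le
... | yes x∈ with walk-suffix p′ x∈
... | l , r′ , L , eq , q , eq′ = r′ , q , Unique-++⁻ l (subst Unique eq u) .proj₂ .proj₁ ,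
  ℚP.≤-trans (ℚP.≤-trans (≤-+ˡ (weight-nonneg nnL))
      (ℚP.≤-reflexive (trans (sym (weight-++ L (steps x r′))) (cong (weight wt) (sym eq′)))))
    (ℚP.≤-trans le (≤-+ˡ (nn _ _ r)))
  where
  nnL : All (λ e → 0ℚ ≤ uncurry wt e) L
  nnL = All.map (λ {e} → nn (proj₁ e) (proj₂ e)) (AllP.++⁻ˡ L (subst (All _) eq′ (walk-All p′)))

-- A perfect elimination order of width two: the later neighbours of a vertex form a clique and
-- number at most two. Unlike being a 2-tree, this passes to subsets of the vertices.
record Elimination (A : Rel₀ n) (ρ : Fin n → ℕ) : Set where
  field
    ρ-injective : ρ x ≡ ρ y → x ≡ y
    A-sym : A x y → A y x
    upper-clique : A z a → A z b → ρ z ℕ.< ρ a → ρ z ℕ.< ρ b → a ≢ b → A a b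
    upper-two : ∀ {c} → A z a → A z b → A z c → ρ z ℕ.< ρ a → ρ z ℕ.< ρ b → ρ z ℕ.< ρ c → a ≡ b ⊎ b ≡ c ⊎ a ≡ c

module EliminationProperties {A : Rel₀ n} {ρ : Fin n → ℕ} (el : Elimination A ρ) where
  open Elimination el

  ρ-connex : x ≢ y → ¬ ρ x ℕ.< ρ y → ρ y ℕ.< ρ x
  ρ-connex x≢y x≮y = ℕP.≤∧≢⇒< (ℕP.≮⇒≥ x≮y) (x≢y ∘ sym ∘ ρ-injective)

  -- If the first step goes to an earlier vertex `y`, the rest of the walk supplies a later
  -- neighbour `c` of `y`. Both `x` and `c` are later neighbours of `y`, hence adjacent. Either `c`
  -- is already later than `x`, or the walk is shortened by stepping from `x` to `c` directly; `k`
  -- bounds its length.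
  upper-neighbour : Walk A x ys z → Unique (x ∷ ys) → ρ x ℕ.< ρ z → ∃ λ c → c ∈ ys × A x c × ρ x ℕ.< ρ c
  upper-neighbour {ys = ys} = go (length ys) ℕP.≤-refl
    where
    go : ∀ k {x ys z} → length ys ℕ.≤ k → Walk A x ys z → Unique (x ∷ ys) → ρ x ℕ.< ρ z → ∃ λ c → c ∈ ys × A x c ×
        ρ x ℕ.< ρ c
    go k le [] u lt = contradiction lt (ℕP.<-irrefl refl)
    go (suc k) {x} {_} {v} (s≤s le) (_∷_ {y = y} {ys} r p) u@((x≢y ∷ x≢) ∷ u′) lt with ρ x ℕP.<? ρ y
    ... | yes x<y = y , here refl , r , x<y
    ... | no x≮y with go k le p u′ (ℕP.<-trans (ρ-connex x≢y x≮y) lt)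
    ... | c , c∈ , y~c , y<c with x≢c ← All.lookup x≢ c∈ | ρ x ℕP.<? ρ c
    ... | yes x<c = c , there c∈ , upper-clique (A-sym r) y~c (ρ-connex x≢y x≮y) y<c x≢c , x<c
    ... | no x≮c with walk-suffix p (there c∈)
    ... | [] , _ , _ , refl , _ = contradiction y<c (ℕP.<-irrefl refl)
    ... | _ ∷ l , s , _ , refl , q , _ =
      let d , d∈ , x~d , x<d = go k (ℕP.≤-trans (ℕP.m≤n+m (suc (length s)) (length l)) (ℕP.≤-trans (ℕP.≤-reflexive (sym (length-++ l))) le))
            (upper-clique (A-sym r) y~c (ρ-connex x≢y x≮y) y<c x≢c ∷ q)
            (AllP.++⁻ʳ l x≢ ∷ Unique-++⁻ l (AllPairs.tail u′) .proj₂ .proj₁) lt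
      in d , there (∈-++⁺ʳ l d∈) , x~d , x<d

  -- Each path contributes a later neighbour of `x`. If none of them is `y`, they lie in disjoint
  -- interiors and are three distinct later neighbours, one too many.
  three-paths-< : ∀ {m₁ m₂ m₃} → ρ x ℕ.< ρ y →
    Walk A x (m₁ ++ [ y ]) y → Unique (x ∷ m₁ ++ [ y ]) →
    Walk A x (m₂ ++ [ y ]) y → Unique (x ∷ m₂ ++ [ y ]) →
    Walk A x (m₃ ++ [ y ]) y → Unique (x ∷ m₃ ++ [ y ]) →
    (∀ {a} → a ∈ m₁ → a ∉ m₂) → (∀ {a} → a ∈ m₂ → a ∉ m₃) → (∀ {a} → a ∈ m₁ → a ∉ m₃) → A x y
  three-paths-< {x = x} {y} {m₁} {m₂} {m₃} lt p₁ u₁ p₂ u₂ p₃ u₃ d₁₂ d₂₃ d₁₃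
    with upper-neighbour p₁ u₁ lt | upper-neighbour p₂ u₂ lt | upper-neighbour p₃ u₃ lt
  ... | a , a∈ , xa , x<a | b , b∈ , xb , x<b | c , c∈ , xc , x<c with ∈-++⁻ m₁ a∈ | ∈-++⁻ m₂ b∈ | ∈-++⁻ m₃ c∈
  ... | inj₂ (here refl) | _ | _ = xa
  ... | _ | inj₂ (here refl) | _ = xb
  ... | _ | _ | inj₂ (here refl) = xc
  ... | inj₁ a∈′ | inj₁ b∈′ | inj₁ c∈′ with upper-two xa xb xc x<a x<b x<c
  ... | inj₁ refl = contradiction b∈′ (d₁₂ a∈′)
  ... | inj₂ (inj₁ refl) = contradiction c∈′ (d₂₃ b∈′)
  ... | inj₂ (inj₂ refl) = contradiction c∈′ (d₁₃ a∈′)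

  three-paths : ∀ {m₁ m₂ m₃} → x ≢ y →
    Walk A x (m₁ ++ [ y ]) y → Unique (x ∷ m₁ ++ [ y ]) →
    Walk A x (m₂ ++ [ y ]) y → Unique (x ∷ m₂ ++ [ y ]) →
    Walk A x (m₃ ++ [ y ]) y → Unique (x ∷ m₃ ++ [ y ]) →
    (∀ {a} → a ∈ m₁ → a ∉ m₂) → (∀ {a} → a ∈ m₂ → a ∉ m₃) → (∀ {a} → a ∈ m₁ → a ∉ m₃) → A x y
  three-paths {x = x} {y} {m₁} {m₂} {m₃} x≢y p₁ u₁ p₂ u₂ p₃ u₃ d₁₂ d₂₃ d₁₃ with ρ x ℕP.<? ρ y
  ... | yes lt = three-paths-< lt p₁ u₁ p₂ u₂ p₃ u₃ d₁₂ d₂₃ d₁₃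
  ... | no ≮ = A-sym (three-paths-< (ρ-connex x≢y ≮) (rw m₁ p₁) (ru m₁ p₁ u₁) (rw m₂ p₂) (ru m₂ p₂ u₂) (rw m₃ p₃)
      (ru m₃ p₃ u₃)
          (λ i j → d₁₂ (AnyP.reverse⁻ i) (AnyP.reverse⁻ j)) (λ i j → d₂₃ (AnyP.reverse⁻ i) (AnyP.reverse⁻ j)) (λ i j →
              d₁₃ (AnyP.reverse⁻ i) (AnyP.reverse⁻ j)))
    where
    rw : ∀ m → Walk A x (m ++ [ y ]) y → Walk A y (reverse m ++ [ x ]) x
    rw m p = subst (λ t → Walk A y t x) (revTail-snoc m) (revTail-walk A-sym p)
    ru : ∀ m → Walk A x (m ++ [ y ]) y → Unique (x ∷ m ++ [ y ]) → Unique (y ∷ reverse m ++ [ x ])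
    ru m p u = Unique-↭ (↭-trans (↭-sym (PermP.↭-reverse (x ∷ m ++ [ y ])))
        (↭-reflexive (trans (reverse-walk p) (cong (y ∷_) (revTail-snoc m))))) u

∨-true : ∀ {c d} → (c ∨ d) ≡ true → c ≡ true ⊎ d ≡ true
∨-true {true} _ = inj₁ refl
∨-true {false} p = inj₂ p

==-true : (x == y) ≡ true → x ≡ y
==-true {x = x} {y} p with x ≟ y
... | yes q = q

-- `add` gives the new vertex the number zero, so the numbering itself removes vertices in the
-- reverse of the order of construction.
TwoTree-elimination : ∀ {m T} → TwoTree m T → Elimination (λ x y → T x y ≡ true) toℕ
TwoTree-elimination tr = record
  { ρ-injective = toℕ-injective
  ; A-sym = λ {x} {y} → T-sym tr x y
  ; upper-clique = λ {z} {a} {b} → clique tr z a b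
  ; upper-two = λ {z} {a} {b} {c} → two tr z a b c }
  where
  T-sym : ∀ {m T} → TwoTree m T → ∀ x y → T x y ≡ true → T y x ≡ true
  T-sym base zero (suc zero) _ = refl
  T-sym base (suc zero) zero _ = refl
  T-sym base (suc zero) (suc zero) ()
  T-sym (add tr a b _) zero (suc y) p = p
  T-sym (add tr a b _) (suc x) zero p = p
  T-sym (add tr a b _) (suc x) (suc y) p = T-sym tr x y p
  clique : ∀ {m T} → TwoTree m T → ∀ z a b → T z a ≡ true → T z b ≡ true → toℕ z ℕ.< toℕ a → toℕ z ℕ.< toℕ b → a ≢ b →
      T a b ≡ true
  clique base zero (suc zero) (suc zero) _ _ _ _ ne = contradiction refl ne
  clique base (suc zero) (suc zero) _ _ _ (s≤s ()) _ _
  clique (add tr c d cd) zero (suc a) (suc b) p q _ _ ne with ∨-true p | ∨-true q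
  ... | inj₁ i | inj₁ j = contradiction (cong suc (trans (==-true i) (sym (==-true j)))) ne
  ... | inj₂ i | inj₂ j = contradiction (cong suc (trans (==-true i) (sym (==-true j)))) ne
  ... | inj₁ i | inj₂ j rewrite ==-true i | ==-true j = cd
  ... | inj₂ i | inj₁ j rewrite ==-true i | ==-true j = T-sym tr c d cd
  clique (add tr c d cd) (suc z) (suc a) (suc b) p q (s≤s lt) (s≤s lt′) ne = clique tr z a b p q lt lt′ (ne ∘ cong suc)
  two : ∀ {m T} → TwoTree m T → ∀ z a b c → T z a ≡ true → T z b ≡ true → T z c ≡ true →
    toℕ z ℕ.< toℕ a → toℕ z ℕ.< toℕ b → toℕ z ℕ.< toℕ c → a ≡ b ⊎ b ≡ c ⊎ a ≡ c
  two base zero (suc zero) (suc zero) _ _ _ _ _ _ _ = inj₁ refl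
  two base (suc zero) (suc zero) _ _ _ _ _ (s≤s ()) _ _
  two (add tr _ _ _) zero (suc a) (suc b) (suc c) p q r _ _ _ with ∨-true p | ∨-true q | ∨-true r
  ... | inj₁ i | inj₁ j | _ = inj₁ (cong suc (trans (==-true i) (sym (==-true j))))
  ... | inj₂ i | inj₂ j | _ = inj₁ (cong suc (trans (==-true i) (sym (==-true j))))
  ... | _ | inj₁ j | inj₁ k = inj₂ (inj₁ (cong suc (trans (==-true j) (sym (==-true k)))))
  ... | _ | inj₂ j | inj₂ k = inj₂ (inj₁ (cong suc (trans (==-true j) (sym (==-true k)))))
  ... | inj₁ i | _ | inj₁ k = inj₂ (inj₂ (cong suc (trans (==-true i) (sym (==-true k)))))
  ... | inj₂ i | _ | inj₂ k = inj₂ (inj₂ (cong suc (trans (==-true i) (sym (==-true k)))))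
  two (add tr _ _ _) (suc z) (suc a) (suc b) (suc c) p q r (s≤s l₁) (s≤s l₂) (s≤s l₃) with two tr z a b c p q r l₁ l₂ l₃
  ... | inj₁ refl = inj₁ refl
  ... | inj₂ (inj₁ refl) = inj₂ (inj₁ refl)
  ... | inj₂ (inj₂ refl) = inj₂ (inj₂ refl)

Elimination-pullback : ∀ {m} {B : Rel₀ m} {ρ} (f : Fin n → Fin m) → (∀ x y → f x ≡ f y → x ≡ y) →
  Elimination B ρ → Elimination (λ x y → B (f x) (f y)) (ρ ∘ f)
Elimination-pullback f inj el = record
  { ρ-injective = λ {x} {y} p → inj x y (ρ-injective p)
  ; A-sym = A-sym
  ; upper-clique = λ p q l l′ ne → upper-clique p q l l′ (ne ∘ inj _ _)
  ; upper-two = λ p q r l l′ l″ → [ inj₁ ∘ inj _ _ , [ inj₂ ∘ inj₁ ∘ inj _ _ ,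
      inj₂ ∘ inj₂ ∘ inj _ _ ]′ ]′ (upper-two p q r l l′ l″) }
  where open Elimination el

-- The parts of one decomposition step

path-walk : {U : Fin n → Set} {ps : List (Fin n)} → IsPath U R x y ps → ∃ λ ys → ps ≡ x ∷ ys × Walk R x ys y ×
    Unique (x ∷ ys) × All U (x ∷ ys)
path-walk ((mid , refl) , u , vs , w) = _ , refl , All-walk mid w , u , vs

walk-last-∈ : Walk R x ys z → z ∈ x ∷ ys
walk-last-∈ [] = here refl
walk-last-∈ (r ∷ p) = there (walk-last-∈ p)

unsnoc-≢ : Walk R x ys z → x ≢ z → ∃ λ mid → ys ≡ mid ++ [ z ]
unsnoc-≢ [] x≢x = contradiction refl x≢x
unsnoc-≢ p@(_ ∷ _) _ = walk-unsnoc p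

last-just : Walk R x ys z → last (x ∷ ys) ≡ just z
last-just [] = refl
last-just (r ∷ p) = last-just p

last-walk : ∀ x ys → last (x ∷ ys) ≡ just y → IsWalk R (x ∷ ys) → Walk R x ys y
last-walk x [] refl w = []
last-walk x (z ∷ ys) eq (r ∷ w) = r ∷ last-walk z ys eq w

∧-false : ∀ {x a y b : Fin n} → ¬ (x ≡ a × y ≡ b) → (x == a) ∧ (y == b) ≡ false
∧-false {x = x} {a} {y} {b} ¬p with x ≟ a | y ≟ b
... | yes p | yes q = contradiction (p , q) ¬p
... | yes _ | no _ = refl
... | no _ | _ = refl

module Children {n : ℕ} (G : Rel₀ n) (G-sym : ∀ {x y} → G x y → G y x) (w : Fin n → Fin n → ℚ)
  (w-sym : ∀ x y → G x y → w x y ≡ w y x) (A : Rel₀ n) (A-sym : ∀ {x y} → A x y → A y x) where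
  open Expansion G w A public

  module Component {H : Part n} (I : Inv H) (u v : Fin n) where
    open Inv I

    Ok : Fin n → Set
    Ok z = V H z × z ≢ u × z ≢ v

    walk-V : Walk (E H) x ys z → All (V H) ys
    walk-V [] = []
    walk-V (p ∷ ps) = E-V (E-sym p) ∷ walk-V ps

    walk-start : Walk (E H) x ys z → x ≢ z → V H x
    walk-start [] x≢x = contradiction refl x≢x
    walk-start (p ∷ _) _ = E-V p

    walk-path : Walk (E H) x ys y → Unique (x ∷ ys) → x ≢ y → PathIn H x y (x ∷ ys)
    walk-path [] uq x≢y = contradiction refl x≢y
    walk-path ws@(p ∷ _) uq x≢y = (let mid , eq = walk-unsnoc ws in mid , cong (_ ∷_) eq) , uq , E-V p ∷ walk-V ws , walk-All ws

    conn : Walk (E H) x ys y → All Ok (x ∷ ys) → ConnAvoid H u v x y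
    conn p ok = _ , last-just p , ok , walk-All p

    conn-walk : ConnAvoid H u v x y → ∃ λ ys → Walk (E H) x ys y × All Ok (x ∷ ys)
    conn-walk (ys , eq , ok , p) = ys , last-walk _ ys eq p , ok

    conn-trans : ConnAvoid H u v x y → ConnAvoid H u v y z → ConnAvoid H u v x z
    conn-trans c d with conn-walk c | conn-walk d
    ... | _ , p , ok | _ , q , ok′ = conn (walk-++ p q) (AllP.++⁺ ok (All.tail ok′))

    conn-sym : ConnAvoid H u v x y → ConnAvoid H u v y x
    conn-sym c with conn-walk c
    ... | ys , p , ok = conn (revTail-walk E-sym p)
      (subst (All Ok) (reverse-walk p) (All-resp-↭ (↭-sym (PermP.↭-reverse _)) ok))

    conn-∈ : Walk (E H) x ys z → All Ok (x ∷ ys) → a ∈ x ∷ ys → ConnAvoid H u v x a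
    conn-∈ p (ok ∷ oks) (here refl) = conn [] (ok ∷ [])
    conn-∈ (p ∷ ps) (ok ∷ oks) (there i) = conn-trans (conn (p ∷ []) (ok ∷ All.head oks ∷ [])) (conn-∈ ps oks i)

    conn-Ok : ConnAvoid H u v x y → Ok y
    conn-Ok c with conn-walk c
    ... | _ , p , ok = All.lookup ok (walk-last-∈ p)

    comp-V : V H u → V H v → compV H u v r x → V H x
    comp-V vu vv (inj₁ c) = conn-Ok c .proj₁
    comp-V vu vv (inj₂ (inj₁ refl)) = vu
    comp-V vu vv (inj₂ (inj₂ refl)) = vv

    comp-step : compV H u v r x → E H x y → x ≢ u → x ≢ v → compV H u v r y
    comp-step {y = y} (inj₂ (inj₁ refl)) p x≢u x≢v = contradiction refl x≢u
    comp-step {y = y} (inj₂ (inj₂ refl)) p x≢u x≢v = contradiction refl x≢v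
    comp-step {y = y} (inj₁ c) p x≢u x≢v with y ≟ u | y ≟ v
    ... | yes y≡u | _ = inj₂ (inj₁ y≡u)
    ... | _ | yes y≡v = inj₂ (inj₂ y≡v)
    ... | no y≢u | no y≢v = inj₁ (conn-trans c (conn (p ∷ []) (conn-Ok c ∷ (E-V (E-sym p) , y≢u , y≢v) ∷ [])))

    -- The interior of a path from `u` to `v` avoids both ends and is connected, so a single
    -- interior vertex `a` determines the component of all the others.
    arc-comp : ∀ m → Walk (E H) u (m ++ [ v ]) v → Unique (u ∷ m ++ [ v ]) → a ∈ u ∷ m ++ [ v ] → b ∈ u ∷ m ++ [ v ] →
      compV H u v r a → a ≢ u → a ≢ v → compV H u v r b
    arc-comp {a = a} {b} {r} m ws uq i j (inj₂ (inj₁ p)) a≢u a≢v = contradiction p a≢u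
    arc-comp {a = a} {b} {r} m ws uq i j (inj₂ (inj₂ p)) a≢u a≢v = contradiction p a≢v
    arc-comp {a = a} {b} {r} m ws uq i j (inj₁ c) a≢u a≢v with inner i a≢u a≢v | b ≟ u | b ≟ v
      where
      inner : ∀ {a} → a ∈ u ∷ m ++ [ v ] → a ≢ u → a ≢ v → a ∈ m
      inner (here p) a≢u a≢v = contradiction p a≢u
      inner (there i) a≢u a≢v with ∈-++⁻ m i
      ... | inj₁ k = k
      ... | inj₂ (here p) = contradiction p a≢v
    ... | k | yes p | _ = inj₂ (inj₁ p)
    ... | k | _ | yes p = inj₂ (inj₂ p)
    ... | k | no b≢u | no b≢v = inj₁ (conn-trans c (joined m ws uq k (inner j b≢u b≢v)))
      where
      inner : ∀ {a} → a ∈ u ∷ m ++ [ v ] → a ≢ u → a ≢ v → a ∈ m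
      inner (here p) a≢u a≢v = contradiction p a≢u
      inner (there i) a≢u a≢v with ∈-++⁻ m i
      ... | inj₁ k = k
      ... | inj₂ (here p) = contradiction p a≢v
      joined : ∀ m → Walk (E H) u (m ++ [ v ]) v → Unique (u ∷ m ++ [ v ]) → a ∈ m → b ∈ m → ConnAvoid H u v a b
      joined (h ∷ m) (p ∷ ws) uq k l with walk-split m ws
      ... | _ , q , _ = conn-trans (conn-sym (conn-∈ q oks k)) (conn-∈ q oks l)
        where
        oks : All Ok (h ∷ m)
        oks = All.tabulate λ i → All.lookup (walk-V (p ∷ ws)) (∈-++⁺ˡ i) ,
          (λ { refl → Unique-splitAt [] uq .proj₂ .proj₁ (∈-++⁺ˡ i) }) ,
          (λ { refl → Unique-splitAt (u ∷ h ∷ m) uq .proj₁ (there i) })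

  -- The branch vertices u and v, the G-path u ∷ p standing for the edge or
  -- for short(u,v), and its weight.
  record Split (H : Part n) (u v : Fin n) (p : List (Fin n)) (ws : ℚ) : Set where
    field
      u≢v : u ≢ v
      Vu : V H u
      Vv : V H v
      p-unique : Unique (u ∷ p)
      p-supp : (a , b) ∈ₛ steps u p → Supp H a b
      p-edge : E H u v → exp H u v ≡ u ∷ p
      ws-min : Walk (E H) u ys v → ws ≤ weight (wt H) (steps u ys)

  -- A common interface for the three kinds of part. `short-walk` is what closes up an arc inside
  -- the part: the edge `uv` if it was present, the chosen shortest path in the part containing it,
  -- and the marked edge elsewhere.
  record Child (H : Part n) (u v r : Fin n) (p : List (Fin n)) (ws : ℚ) (K : Part n) : Set where
    field
      inv : Inv K
      comp⇒V : compV H u v r x → V K x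
      lift : E H x y → compV H u v r x → compV H u v r y → E K x y × exp K x y ≡ exp H x y × wt K x y ≡ wt H x y
      short-walk : ∃ λ s → Walk (E K) u s v × (incidence (exps K (steps u s)) ≈ incidence (steps u p)) ×
          weight (wt K) (steps u s) ≡ ws
      supp : Supp K a b → (a , b) ∈ₛ steps u p ⊎
        (∃ λ x → ∃ λ y → E H x y × compV H u v r x × compV H u v r y × (a , b) ∈ pairs (exp H x y))

  module _ {H : Part n} (I : Inv H) where
    open Inv I
    open InvProperties I

    module _ (u v r : Fin n) (Vu : V H u) (Vv : V H v) where
      open Component I u v

      induced-Inv : Inv (inducedPart H u v r)
      induced-Inv = record
        { E-sym = λ (p , c , d) → E-sym p , d , c
        ; E-V = λ (_ , c , _) → c
        ; E-irr = λ (p , _) → E-irr p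
        ; E-A = λ (p , _) → E-A p
        ; wt-sym = λ x y (p , _) → wt-sym x y p
        ; wt-nonneg = λ x y (p , _) → wt-nonneg x y p
        ; no-long = λ (p , _) ws → no-long p (walk-map proj₁ ws)
        ; exp-tail = exp-tail ∘ proj₁
        ; exp-walk = exp-walk ∘ proj₁
        ; exp-unique = exp-unique ∘ proj₁
        ; exp-reverse = exp-reverse ∘ proj₁
        ; exp-weight = exp-weight ∘ proj₁
        ; exp-V = λ (p , _) i c → exp-V p i (comp-V Vu Vv c)
        -- A vertex outside the smaller part lies outside `H` as well: a vertex of `H` on the
        -- expansion would be `x` or `y`, and these stay.
        ; exp-disjoint = λ (p , cx , cy) (q , _) i j ¬c → exp-disjoint p q i j
            λ va → ¬c ([ (λ { refl → cx }) , (λ { refl → cy }) ]′ (exp-V p i va)) }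

      induced-Child : ∀ {s p ws} → Walk (E (inducedPart H u v r)) u s v →
        incidence (exps H (steps u s)) ≈ incidence (steps u p) → weight (wt H) (steps u s) ≡ ws →
        Child H u v r p ws (inducedPart H u v r)
      induced-Child sw eq weq = record
        { inv = induced-Inv
        ; comp⇒V = id
        ; lift = λ p c d → (p , c , d) , refl , refl
        ; short-walk = _ , sw , eq , weq
        ; supp = λ (x , y , (p , c , d) , i) → inj₂ (x , y , p , c , d , i) }

    module Green (u v r : Fin n) (s : List (Fin n)) (u≢v : u ≢ v) (Auv : A u v) (¬Euv : ¬ E H u v)
      (sw : Walk (E H) u s v) (su : Unique (u ∷ s)) (s-min : ∀ {ys} → Walk (E H) u ys v →
          weight (wt H) (steps u s) ≤ weight (wt H) (steps u ys))
      (outside : ¬ All (compV H u v r) (u ∷ s)) where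
      open Component I u v

      K : Part n
      K = greenPart H u v r (u ∷ s)

      p : List (Fin n)
      p = expandTail H u s

      ws : ℚ
      ws = weight (wt H) (steps u s)

      Vu : V H u
      Vu = walk-start sw u≢v

      Vv : V H v
      Vv with walk-last-∈ sw
      ... | here eq = contradiction (sym eq) u≢v
      ... | there i = All.lookup (walk-V sw) i

      ¬uv : E H x y → ¬ Same (x , y) (u , v)
      ¬uv q (inj₁ (refl , refl)) = ¬Euv q
      ¬uv q (inj₂ (refl , refl)) = ¬Euv (E-sym q)

      exp-old : E H x y → exp K x y ≡ exp H x y
      exp-old {x} {y} q rewrite ∧-false {x = x} {u} {y} {v} (¬uv q ∘ inj₁) | ∧-false {x = x} {v} {y} {u}
          (¬uv q ∘ inj₂) = refl

      wt-old : E H x y → wt K x y ≡ wt H x y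
      -- `isUV u v x y` and `hit (x , y) u v` unfold to the same term.
      wt-old {x} {y} q rewrite hit-¬Same {e = x , y} {u} {v} (¬uv q) = refl

      exp-uv : exp K u v ≡ u ∷ p
      exp-uv rewrite ==-refl u | ==-refl v = refl

      exp-vu : exp K v u ≡ reverse (u ∷ p)
      exp-vu rewrite ==-≢ (u≢v ∘ sym) | ==-refl u | ==-refl v = refl

      wt-uv : wt K u v ≡ ws
      wt-uv rewrite hit-Same {e = u , v} {u} {v} (inj₁ (refl , refl)) = refl

      wt-vu : wt K v u ≡ ws
      wt-vu rewrite hit-Same {e = v , u} {u} {v} (inj₂ (refl , refl)) = refl

      pw : Walk G u p v
      pw = expand-walk sw

      p-unique : Unique (u ∷ p)
      p-unique = expand-unique sw Vu su

      exp-vu′ : exp K v u ≡ v ∷ revTail u p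
      exp-vu′ = trans exp-vu (reverse-walk pw)

      -- By `arc-comp` any other common vertex would draw the whole shortest path into this
      -- component, against `outside`.
      s-ends : a ∈ u ∷ s → compV H u v r a → a ≡ u ⊎ a ≡ v
      s-ends {a} i c with a ≟ u | a ≟ v
      ... | yes eq | _ = inj₁ eq
      ... | _ | yes eq = inj₂ eq
      ... | no a≢u | no a≢v with unsnoc-≢ sw u≢v
      ... | m , eq = ⊥-elim (outside (subst (λ t → All (compV H u v r) (u ∷ t)) (sym eq)
        (All.tabulate λ j → arc-comp m (subst (λ t → Walk (E H) u t v) eq sw) (subst (λ t → Unique (u ∷ t)) eq su)
            (subst (λ t → a ∈ u ∷ t) eq i) j c a≢u a≢v)))

      s-edge : ∀ {p q} → (p , q) ∈ steps u s → E H p q → compV H u v r p → ¬ compV H u v r q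
      s-edge i pq c d with steps-∈ u s i
      ... | j , k with s-ends j c | s-ends (there k) d
      ... | inj₁ refl | inj₁ refl = E-irr pq
      ... | inj₁ refl | inj₂ refl = ¬Euv pq
      ... | inj₂ refl | inj₁ refl = ¬Euv (E-sym pq)
      ... | inj₂ refl | inj₂ refl = E-irr pq

      p-ends : a ∈ u ∷ p → compV H u v r a → a ≡ u ⊎ a ≡ v
      p-ends (here eq) c = inj₁ eq
      p-ends (there i) c with expandTail-∈ sw i
      ... | x , y , j , xy , k , _ with exp-V xy k (comp-V Vu Vv c)
      ... | inj₁ refl = s-ends (steps-∈ u s j .proj₁) c
      ... | inj₂ refl = s-ends (there (steps-∈ u s j .proj₂)) c

      -- A shared interior vertex would, by disjointness in `H`, make `xy` an edge of the shortest
      -- path with both ends in this component. Those ends could only be `u` and `v`, which are not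
      -- adjacent in `H`.
      p-disjoint : E H x y → compV H u v r x → compV H u v r y → a ∈ exp H x y → ¬ compV H u v r a → a ∉ u ∷ p
      p-disjoint q cx cy i ¬c (here refl) = ¬c (inj₂ (inj₁ refl))
      p-disjoint q cx cy i ¬c (there j) with expandTail-∈ sw j
      ... | x′ , y′ , k , q′ , l , _ with exp-disjoint q q′ i l (λ va →
          ¬c ([ (λ { refl → cx }) , (λ { refl → cy }) ]′ (exp-V q i va)))
      ... | inj₁ (refl , refl) = s-edge k q′ cx cy
      ... | inj₂ (refl , refl) = s-edge k q′ cy cx

      ∈-vu : a ∈ exp K v u → a ∈ u ∷ p
      ∈-vu i = ∈-resp-↭ (PermP.↭-reverse (u ∷ p)) (subst (_ ∈_) exp-vu i)

      ∈-uv : a ∈ exp K u v → a ∈ u ∷ p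
      ∈-uv = subst (_ ∈_) exp-uv

      -- Substituting the shortest path for every marked edge, in the direction of travel, preserves
      -- weight; so the new part inherits `no-long` from `H`.
      flatten : Walk (E K) x ys z → ∃ λ zs → Walk (E H) x zs z × weight (wt H) (steps x zs) ≡ weight (wt K) (steps x ys)
      flatten [] = [] , [] , refl
      flatten {x} {y ∷ ys} (q ∷ qs) with flatten qs
      flatten {x} {y ∷ ys} (inj₁ (q , _) ∷ qs) | zs , p′ , eq = y ∷ zs , q ∷ p′ , cong₂ _+_ (sym (wt-old q)) eq
      flatten (inj₂ (inj₁ (refl , refl)) ∷ qs) | zs , p′ , eq = s ++ zs , walk-++ sw p′ ,
        trans (cong (weight (wt H)) (steps-++ sw zs)) (trans (weight-++ (steps u s) (steps v zs)) (cong₂ _+_ (sym wt-uv) eq))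
      flatten (inj₂ (inj₂ (refl , refl)) ∷ qs) | zs , p′ , eq = revTail u s ++ zs , walk-++ rw p′ ,
        trans (cong (weight (wt H)) (steps-++ rw zs)) (trans (weight-++ (steps v (revTail u s)) (steps u zs))
          (cong₂ _+_ (trans (weight-revTail wt-sym sw) (sym wt-vu)) eq))
        where
        rw : Walk (E H) v (revTail u s) u
        rw = revTail-walk E-sym sw

      green-Inv : Inv K
      green-Inv = record
        { E-sym = λ { (inj₁ (q , c , d)) → inj₁ (E-sym q , d , c) ; (inj₂ (inj₁ (eq , eq′))) →
            inj₂ (inj₂ (eq′ , eq)) ; (inj₂ (inj₂ (eq , eq′))) → inj₂ (inj₁ (eq′ , eq)) }
        ; E-V = λ { (inj₁ (_ , c , _)) → c ; (inj₂ (inj₁ (eq , _))) → inj₂ (inj₁ eq) ; (inj₂ (inj₂ (eq , _))) →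
            inj₂ (inj₂ eq) }
        ; E-irr = λ { (inj₁ (q , _)) → E-irr q ; (inj₂ (inj₁ (eq , eq′))) →
            u≢v (trans (sym eq) eq′) ; (inj₂ (inj₂ (eq , eq′))) → u≢v (trans (sym eq′) eq) }
        ; E-A = λ { (inj₁ (q , _)) → E-A q ; (inj₂ (inj₁ (refl , refl))) → Auv ; (inj₂ (inj₂ (refl , refl))) → A-sym Auv }
        ; wt-sym = λ { x y (inj₁ (q , _)) → trans (wt-old q) (trans (wt-sym x y q) (sym (wt-old (E-sym q))))
                     ; x y (inj₂ (inj₁ (refl , refl))) → trans wt-uv (sym wt-vu) ; x y (inj₂ (inj₂ (refl , refl))) →
                         trans wt-vu (sym wt-uv) }
        ; wt-nonneg = λ { x y (inj₁ (q , _)) → subst (0ℚ ≤_) (sym (wt-old q)) (wt-nonneg x y q)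
                     ; x y (inj₂ (inj₁ (refl , refl))) → subst (0ℚ ≤_) (sym wt-uv) ws-nonneg ; x y
                         (inj₂ (inj₂ (refl , refl))) → subst (0ℚ ≤_) (sym wt-vu) ws-nonneg }
        ; no-long = no-long′
        ; exp-tail = λ { (inj₁ (q , _)) → subst (λ l → l ≡ _ ∷ drop 1 l) (sym (exp-old q)) (exp-tail q)
                     ; (inj₂ (inj₁ (refl , refl))) → subst (λ l → l ≡ _ ∷ drop 1 l) (sym exp-uv) refl
                     ; (inj₂ (inj₂ (refl , refl))) → subst (λ l → l ≡ _ ∷ drop 1 l) (sym exp-vu′) refl }
        ; exp-walk = λ { (inj₁ (q , _)) → subst (λ l → Walk G _ (drop 1 l) _) (sym (exp-old q)) (exp-walk q)
                     ; (inj₂ (inj₁ (refl , refl))) → subst (λ l → Walk G _ (drop 1 l) _) (sym exp-uv) pw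
                     ; (inj₂ (inj₂ (refl , refl))) → subst (λ l → Walk G _ (drop 1 l) _) (sym exp-vu′)
                         (revTail-walk G-sym pw) }
        ; exp-unique = λ { (inj₁ (q , _)) → subst Unique (sym (exp-old q)) (exp-unique q)
                     ; (inj₂ (inj₁ (refl , refl))) → subst Unique (sym exp-uv) p-unique
                     ; (inj₂ (inj₂ (refl , refl))) → subst Unique (sym exp-vu)
                         (Unique-↭ (↭-sym (PermP.↭-reverse (u ∷ p))) p-unique) }
        ; exp-reverse = λ { (inj₁ (q , _)) →
            trans (exp-old (E-sym q)) (trans (exp-reverse q) (cong reverse (sym (exp-old q))))
                     ; (inj₂ (inj₁ (refl , refl))) → trans exp-vu (cong reverse (sym exp-uv))
                     ; (inj₂ (inj₂ (refl , refl))) → trans exp-uv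
                         (trans (sym (reverse-involutive (u ∷ p))) (cong reverse (sym exp-vu))) }
        ; exp-weight = λ { (inj₁ (q , _)) → trans (cong (weight w ∘ pairs) (exp-old q))
            (trans (exp-weight q) (sym (wt-old q)))
                     ; (inj₂ (inj₁ (refl , refl))) → trans (cong (weight w ∘ pairs) exp-uv) (trans p-weight (sym wt-uv))
                     ; (inj₂ (inj₂ (refl , refl))) → trans (cong (weight w ∘ pairs) exp-vu′)
                         (trans (weight-revTail w-sym pw) (trans p-weight (sym wt-vu))) }
        ; exp-V = λ { (inj₁ (q , _)) i c → exp-V q (subst (_ ∈_) (exp-old q) i) (comp-V Vu Vv c)
                     ; (inj₂ (inj₁ (refl , refl))) i c → p-ends (∈-uv i) c
                     ; (inj₂ (inj₂ (refl , refl))) i c → Sum.swap (p-ends (∈-vu i) c) }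
        ; exp-disjoint = disjoint }
        where
        ws-nonneg : 0ℚ ≤ ws
        ws-nonneg = weight-nonneg (All.map (λ {e} → wt-nonneg (proj₁ e) (proj₂ e)) (walk-All sw))
        p-weight : weight w (steps u p) ≡ ws
        p-weight = trans (cong (weight w) (expand-steps sw)) (exps-weight (walk-All sw))
        no-long′ : E K x y → Walk (E K) x ys y → wt K x y ≤ weight (wt K) (steps x ys)
        no-long′ q qs with flatten qs
        no-long′ (inj₁ (q , _)) qs | zs , ps , eq =
            ℚP.≤-trans (ℚP.≤-reflexive (wt-old q)) (ℚP.≤-trans (no-long q ps) (ℚP.≤-reflexive eq))
        no-long′ (inj₂ (inj₁ (refl , refl))) qs | zs , ps , eq =
            ℚP.≤-trans (ℚP.≤-reflexive wt-uv) (ℚP.≤-trans (s-min ps) (ℚP.≤-reflexive eq))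
        no-long′ (inj₂ (inj₂ (refl , refl))) qs | zs , ps , eq = ℚP.≤-trans (ℚP.≤-reflexive wt-vu)
          (ℚP.≤-trans (s-min (revTail-walk E-sym ps)) (ℚP.≤-reflexive (trans (weight-revTail wt-sym ps) eq)))
        disjoint : ∀ {x y x′ y′} → E K x y → E K x′ y′ → a ∈ exp K x y → a ∈ exp K x′ y′ → ¬ V K a → Same (x , y) (x′ , y′)
        disjoint (inj₁ (q , cx , cy)) (inj₁ (q′ , _)) i j ¬c =
            exp-disjoint q q′ (subst (_ ∈_) (exp-old q) i) (subst (_ ∈_) (exp-old q′) j)
          λ va → ¬c ([ (λ { refl → cx }) , (λ { refl → cy }) ]′ (exp-V q (subst (_ ∈_) (exp-old q) i) va))
        disjoint (inj₁ (q , cx , cy)) (inj₂ (inj₁ (refl , refl))) i j ¬c =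
            ⊥-elim (p-disjoint q cx cy (subst (_ ∈_) (exp-old q) i) ¬c (∈-uv j))
        disjoint (inj₁ (q , cx , cy)) (inj₂ (inj₂ (refl , refl))) i j ¬c =
            ⊥-elim (p-disjoint q cx cy (subst (_ ∈_) (exp-old q) i) ¬c (∈-vu j))
        disjoint (inj₂ (inj₁ (refl , refl))) (inj₁ (q , cx , cy)) i j ¬c =
            ⊥-elim (p-disjoint q cx cy (subst (_ ∈_) (exp-old q) j) ¬c (∈-uv i))
        disjoint (inj₂ (inj₂ (refl , refl))) (inj₁ (q , cx , cy)) i j ¬c =
            ⊥-elim (p-disjoint q cx cy (subst (_ ∈_) (exp-old q) j) ¬c (∈-vu i))
        disjoint (inj₂ (inj₁ (refl , refl))) (inj₂ (inj₁ (refl , refl))) _ _ _ = inj₁ (refl , refl)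
        disjoint (inj₂ (inj₁ (refl , refl))) (inj₂ (inj₂ (refl , refl))) _ _ _ = inj₂ (refl , refl)
        disjoint (inj₂ (inj₂ (refl , refl))) (inj₂ (inj₁ (refl , refl))) _ _ _ = inj₂ (refl , refl)
        disjoint (inj₂ (inj₂ (refl , refl))) (inj₂ (inj₂ (refl , refl))) _ _ _ = inj₁ (refl , refl)

      green-Child : Child H u v r p ws K
      green-Child = record
        { inv = green-Inv
        ; comp⇒V = id
        ; lift = λ q c d → inj₁ (q , c , d) , exp-old q , wt-old q
        ; short-walk = [ v ] , inj₂ (inj₁ (refl , refl)) ∷ [] ,
            (λ a b → cong (λ l → incidence l a b) (trans (++-identityʳ (pairs (exp K u v))) (cong pairs exp-uv))) ,
            trans (ℚP.+-identityʳ (wt K u v)) wt-uv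
        ; supp = λ { (x , y , inj₁ (q , c , d) , i) → inj₂ (x , y , q , c , d , subst (λ l → _ ∈ pairs l) (exp-old q) i)
                   ; (x , y , inj₂ (inj₁ (refl , refl)) , i) → inj₁ (inj₁ (subst (λ l → _ ∈ pairs l) exp-uv i))
                   ; (x , y , inj₂ (inj₂ (refl , refl)) , i) → inj₁ (inj₂ (back i)) } }
        where
        back : (a , b) ∈ pairs (exp K v u) → (b , a) ∈ steps u p
        back i with ∈-map⁻ flip (∈-resp-↭ (revTail-steps pw) (subst (λ l → _ ∈ pairs l) exp-vu′ i))
        ... | _ , j , refl = j

-- Combining the bases of the parts

lincomb-++ : ∀ cs ds (vs us : List (EdgeVec {n})) → length cs ≡ length vs →
    lincomb (cs ++ ds) (vs ++ us) ≈ lincomb cs vs ⊕ lincomb ds us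
lincomb-++ [] ds [] us eq a b = refl
lincomb-++ (c ∷ cs) ds (v ∷ vs) us eq a b =
    trans (cong ((c ∧ v a b) xor_) (lincomb-++ cs ds vs us (ℕP.suc-injective eq) a b))
  (sym (xor-assoc (c ∧ v a b) _ _))

length-split : ∀ {X Y : Set} (cs : List X) (vs us : List Y) → length cs ≡ length (vs ++ us) →
  ∃ λ c₁ → ∃ λ c₂ → cs ≡ c₁ ++ c₂ × length c₁ ≡ length vs × length c₂ ≡ length us
length-split cs [] us eq = [] , cs , refl , refl , eq
length-split (c ∷ cs) (v ∷ vs) us eq = let c₁ , c₂ , p , q , r = length-split cs vs us (ℕP.suc-injective eq) in
  c ∷ c₁ , c₂ , cong (c ∷_) p , cong suc q , r

lincomb-even : ∀ cs {vs : List (EdgeVec {n})} → All Even vs → Even (lincomb cs vs)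
lincomb-even [] evs = even-𝟘
lincomb-even (c ∷ cs) [] = even-𝟘
lincomb-even (false ∷ cs) (ev ∷ evs) = lincomb-even cs evs
lincomb-even (true ∷ cs) (ev ∷ evs) = even-⊕ ev (lincomb-even cs evs)

lincomb-true : ∀ cs (vs : List (EdgeVec {n})) → lincomb cs vs a b ≡ true → Any (λ v → v a b ≡ true) vs
lincomb-true {a = a} {b} (c ∷ cs) (v ∷ vs) eq with v a b in veq
... | true = here veq
... | false rewrite ∧-zeroʳ c = there (lincomb-true cs vs eq)

-- Over GF(2) a vanishing combination says that its two halves are the same vector, so this vector
-- is supported where both families are.
independent-++ : (vs us : List (EdgeVec {n})) {p : List (Fin n)} → All Even vs → Unique (u ∷ p) →
  (∀ {a b} → Any (λ v → v a b ≡ true) vs → Any (λ v → v a b ≡ true) us → (a , b) ∈ₛ steps u p) →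
  Independent vs → Independent us → Independent (vs ++ us)
independent-++ {u = u} vs us {p} evs up meet iv iu cs len eq with length-split cs vs us len
... | c₁ , c₂ , refl , l₁ , l₂ = AllP.++⁺ (iv c₁ l₁ X≈0) (iu c₂ l₂ (λ a b → trans (sym (X≈Y a b)) (X≈0 a b)))
  where
  X≈Y : lincomb c₁ vs ≈ lincomb c₂ us
  X≈Y a b = xor-cancel (trans (sym (lincomb-++ c₁ c₂ vs us l₁ a b)) (eq a b))
  X≈0 : lincomb c₁ vs ≈ 𝟘
  X≈0 = even-path-zero (lincomb-even c₁ evs) u p up λ a b t →
    meet (lincomb-true c₁ vs t) (lincomb-true c₂ us (trans (sym (X≈Y a b)) t))

-- Spans with a bound on the weight

-- The bound `t` applies to each member used, not to the sum of their weights; this is the form that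
-- the exchange argument compares. The constructors carry `≈` because vectors are functions, equal
-- only pointwise.
data Span {n : ℕ} (w : Fin n → Fin n → ℚ) (B : List (List (Fin n))) (t : ℚ) : EdgeVec {n} → Set where
  zero : v₁ ≈ 𝟘 → Span w B t v₁
  member : C ∈ B → cycleWeight w C ≤ t → v₁ ≈ cycleVec C → Span w B t v₁
  add : Span w B t v₁ → Span w B t v₂ → v₃ ≈ v₁ ⊕ v₂ → Span w B t v₃

Span-cong : ∀ {w : Fin n → Fin n → ℚ} → v₁ ≈ v₂ → Span w B t v₁ → Span w B t v₂
Span-cong eq (zero p) = zero (λ a b → trans (sym (eq a b)) (p a b))
Span-cong eq (member p q r) = member p q (λ a b → trans (sym (eq a b)) (r a b))
Span-cong eq (add p q r) = add p q (λ a b → trans (sym (eq a b)) (r a b))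

Span-mono : ∀ {w : Fin n → Fin n → ℚ} → (∀ {C} → C ∈ B → C ∈ B′) → t ≤ t′ → Span w B t v₁ → Span w B′ t′ v₁
Span-mono f le (zero p) = zero p
Span-mono f le (member p q r) = member (f p) (ℚP.≤-trans q le) r
Span-mono f le (add p q r) = add (Span-mono f le p) (Span-mono f le q) r

unique-or-repeat : (xs : List (Fin n)) → Unique xs ⊎ (∃ λ l → ∃ λ y → ∃ λ m → ∃ λ r → xs ≡ l ++ y ∷ m ++ y ∷ r)
unique-or-repeat [] = inj₁ []
unique-or-repeat (x ∷ xs) with unique-or-repeat xs | Any.any? (x ≟_) xs
... | inj₂ (l , y , m , r , eq) | _ = inj₂ (x ∷ l , y , m , r , cong (x ∷_) eq)
... | inj₁ u | no x∉ = inj₁ (Unique-∷ x∉ u)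
... | inj₁ u | yes x∈ = let m , r , eq = ∈-∃++ x∈ in inj₂ ([] , x , m , r , cong (x ∷_) eq)

module Combine {n : ℕ} (G : Rel₀ n) (G-sym : ∀ {x y} → G x y → G y x) (G-irr : ∀ {x} → ¬ G x x) (w : Fin n → Fin n → ℚ)
  (w-sym : ∀ x y → G x y → w x y ≡ w y x) (A : Rel₀ n) (A-sym : ∀ {x y} → A x y → A y x) where
  open Children G G-sym w w-sym A A-sym public

  Spans : Part n → List (List (Fin n)) → Set
  Spans H B = ∀ C → IsCycle (V H) (E H) C → Span w B (weight (wt H) (cycEdges C)) (incidence (exps H (cycEdges C)))

  Deciders : List (Part n) → Set₁
  Deciders = All (λ K → ∀ x y → Dec (E K x y))

  -- The members of `B` are cycles of `G`, not of `H`, so that the lists obtained for different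
  -- parts can simply be concatenated. Only `spans` waits for deciders, and these concern the final
  -- parts alone.
  record Result (H : Part n) (Gs : List (Part n)) (B : List (List (Fin n))) : Set₁ where
    field
      cycles : All (IsCycle (λ _ → ⊤) G) B
      support : C ∈ B → cycleVec C a b ≡ true → Supp H a b
      independent : Independent (map cycleVec B)
      spans : Deciders Gs → Spans H B

  module _ {H : Part n} (I : Inv H) where
    open Inv I
    open InvProperties I

    exps-nonneg : All (uncurry (E H)) es → 0ℚ ≤ weight (wt H) es
    exps-nonneg ps = weight-nonneg (All.map (λ {e} → wt-nonneg (proj₁ e) (proj₂ e)) ps)

    -- A closed walk is cut at a repeated vertex into two shorter closed walks, none heavier than
    -- the whole, until only cycles and walks of length at most two remain.
    spans-closed-walk : Spans H B → Walk (E H) x ys x →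
        Span w B (weight (wt H) (steps x ys)) (incidence (exps H (steps x ys)))
    spans-closed-walk {B} {ys = ys} sp = go (length ys) ℕP.≤-refl
      where
      go : ∀ k {x ys} → length ys ℕ.≤ k → Walk (E H) x ys x →
          Span w B (weight (wt H) (steps x ys)) (incidence (exps H (steps x ys)))
      go k {ys = []} le p = zero λ _ _ → refl
      go (suc k) {x} {y ∷ ys} (s≤s le) p with unique-or-repeat (y ∷ ys)
      go (suc k) {x} {y ∷ []} (s≤s le) (p ∷ []) | inj₁ uq = contradiction p E-irr
      -- An edge run back and forth: its two expansions cancel.
      go (suc k) {x} {y ∷ _ ∷ []} (s≤s le) (p ∷ q ∷ []) | inj₁ uq = zero λ a b →
        trans (incidence-++ (pairs (exp H x y)) (pairs (exp H y x) ++ []) a b)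
          (trans (cong (incidence (pairs (exp H x y)) a b xor_)
              (trans (cong (λ l → incidence l a b) (++-identityʳ (pairs (exp H y x))))
            (trans (incidence-↭ (exp-pairs-flip p) a b) (incidence-map-flip (pairs (exp H x y)) a b))))
                (xor-same (incidence (pairs (exp H x y)) a b)))
      go (suc k) {x} {y ∷ ys@(_ ∷ _ ∷ _)} (s≤s le) p | inj₁ uq with walk-unsnoc p
      ... | mid , eq = subst (λ t → Span w B (weight (wt H) (steps x t)) (incidence (exps H (steps x t)))) (sym eq)
          (sp (x ∷ mid) cyc)
        where
        rot : mid ++ [ x ] ↭ x ∷ mid
        rot = PermP.++-comm mid [ x ]
        cyc : IsCycle (V H) (E H) (x ∷ mid)
        cyc = subst (3 ℕ.≤_) (trans (cong length eq) (↭-length rot)) (s≤s (s≤s (s≤s z≤n))) ,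
          Unique-↭ rot (subst Unique eq uq) ,
          All-resp-↭ rot (subst (All (V H)) eq (Component.walk-V I x x p)) ,
          walk-All (subst (λ t → Walk (E H) x t x) eq p)
      go (suc k) {x} {y ∷ ys} (s≤s le) p | inj₂ (l , c , m , r , eq) with walk-splitAt l
          (subst (λ t → Walk (E H) x t x) eq p)
      ... | p₁ , q with walk-splitAt m q
      ... | p₂ , p₃ = add (Span-mono id w₁ (go k len₁ (walk-++ p₁ p₃))) (Span-mono id w₂ (go k len₂ p₂)) vec
        where
        len : length (y ∷ ys) ≡ suc (length (m ++ [ c ]) ℕ.+ (length l ℕ.+ length r))
        len = trans (cong length eq) (trans (↭-length (↭-trans (PermP.shift c l (m ++ c ∷ r)) (prep c
          (↭-trans (PermP.++⁺ˡ l (↭-reflexive (sym (++-assoc m [ c ] r)))) (PermP.shifts l (m ++ [ c ]))))))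
          (cong suc (trans (length-++ (m ++ [ c ])) (cong (length (m ++ [ c ]) ℕ.+_) (length-++ l)))))
        len₂ : length (m ++ [ c ]) ℕ.≤ k
        len₂ = ℕP.≤-trans (ℕP.m≤m+n _ _) (ℕP.≤-trans (ℕP.≤-reflexive (sym (ℕP.suc-injective len))) le)
        len₁ : length ((l ++ [ c ]) ++ r) ℕ.≤ k
        len₁ = ℕP.≤-trans (ℕP.≤-reflexive (trans (cong length (++-assoc l [ c ] r))
            (trans (↭-length (PermP.shift c l r)) (cong suc (length-++ l)))))
          (ℕP.≤-trans (ℕP.+-monoˡ-≤ (length l ℕ.+ length r)
              (ℕP.≤-trans (ℕP.m≤n+m 1 (length m)) (ℕP.≤-reflexive (sym (length-++ m)))))
            (ℕP.≤-trans (ℕP.≤-reflexive (sym (ℕP.suc-injective len))) le))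
        e₁ = steps x (l ++ [ c ])
        e₂ = steps c (m ++ [ c ])
        e₃ = steps c r
        whole : steps x (y ∷ ys) ≡ e₁ ++ e₂ ++ e₃
        whole = trans (cong (steps x) eq) (trans (steps-splitAt x l c (m ++ c ∷ r)) (cong (e₁ ++_) (steps-splitAt c m c r)))
        outer : steps x ((l ++ [ c ]) ++ r) ≡ e₁ ++ e₃
        outer = steps-++ p₁ r
        swapped : steps x (y ∷ ys) ↭ steps x ((l ++ [ c ]) ++ r) ++ e₂
        swapped = ↭-trans (↭-reflexive whole) (↭-trans (PermP.++⁺ˡ e₁ (PermP.++-comm e₂ e₃))
          (↭-reflexive (trans (sym (++-assoc e₁ e₃ e₂)) (cong (_++ e₂) (sym outer)))))
        sum : weight (wt H) (steps x (y ∷ ys)) ≡ weight (wt H) (steps x ((l ++ [ c ]) ++ r)) + weight (wt H) e₂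
        sum = trans (weight-↭ swapped) (weight-++ (steps x ((l ++ [ c ]) ++ r)) e₂)
        w₁ : weight (wt H) (steps x ((l ++ [ c ]) ++ r)) ≤ weight (wt H) (steps x (y ∷ ys))
        w₁ = ℚP.≤-trans (≤-+ʳ (exps-nonneg (walk-All p₂))) (ℚP.≤-reflexive (sym sum))
        w₂ : weight (wt H) e₂ ≤ weight (wt H) (steps x (y ∷ ys))
        w₂ = ℚP.≤-trans (≤-+ˡ (exps-nonneg (walk-All (walk-++ p₁ p₃)))) (ℚP.≤-reflexive (sym sum))
        vec : incidence (exps H (steps x (y ∷ ys))) ≈ incidence (exps H (steps x ((l ++ [ c ]) ++ r))) ⊕ incidence
            (exps H e₂)
        vec a b = trans (incidence-↭ (exps-↭ H swapped) a b)
            (trans (cong (λ q → incidence q a b) (exps-++ H (steps x ((l ++ [ c ]) ++ r)) e₂))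
          (incidence-++ (exps H (steps x ((l ++ [ c ]) ++ r))) (exps H e₂) a b))

  infixr 5 _∷_
  data Kids (H : Part n) (u v : Fin n) (p : List (Fin n)) (ws : ℚ) : List (Fin n) → List (Part n) →
      List (List (Fin n)) → Set₁ where
    [] : Kids H u v p ws [] [] []
    _∷_ : ∀ {r rs Gs Gs′ B B′} → (∃ λ K → Child H u v r p ws K × Result K Gs B) → Kids H u v p ws rs Gs′ B′ →
      Kids H u v p ws (r ∷ rs) (Gs ++ Gs′) (B ++ B′)

  module _ {H : Part n} (I : Inv H) {u v : Fin n} {p : List (Fin n)} {ws : ℚ} (S : Split H u v p ws) where
    open Inv I
    open InvProperties I
    open Component I u v
    open Split S

    -- The support of a child described by edges of `H`: only there can edges of different children
    -- be compared.
    PieceSupp : Fin n → Fin n → Fin n → Set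
    PieceSupp r a b = (a , b) ∈ₛ steps u p ⊎
      (∃ λ x → ∃ λ y → E H x y × compV H u v r x × compV H u v r y × (a , b) ∈ pairs (exp H x y))

    piece-Supp : PieceSupp r a b → Supp H a b
    piece-Supp (inj₁ i) = p-supp i
    piece-Supp (inj₂ (x , y , q , _ , _ , i)) = x , y , q , i

    comp-meet : ∀ {r r′} → ¬ ConnAvoid H u v r r′ → compV H u v r x → compV H u v r′ x → x ≡ u ⊎ x ≡ v
    comp-meet ¬c (inj₂ eq) _ = eq
    comp-meet ¬c (inj₁ _) (inj₂ eq) = eq
    comp-meet ¬c (inj₁ c) (inj₁ d) = contradiction (conn-trans c (conn-sym d)) ¬c

    uv-edge : E H x y → x ≡ u ⊎ x ≡ v → y ≡ u ⊎ y ≡ v → (a , b) ∈ pairs (exp H x y) → (a , b) ∈ₛ steps u p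
    uv-edge q (inj₁ refl) (inj₁ refl) i = contradiction q E-irr
    uv-edge q (inj₁ refl) (inj₂ refl) i = inj₁ (subst (λ l → _ ∈ pairs l) (p-edge q) i)
    uv-edge q (inj₂ refl) (inj₁ refl) i = inj₂ (subst (λ l → _ ∈ pairs l) (p-edge (E-sym q)) (exp-∈-flip q i))
    uv-edge q (inj₂ refl) (inj₂ refl) i = contradiction q E-irr

    -- A pair on two expansions comes from one edge of `H`. Its ends belong to both components, so
    -- they are `u` and `v`, and the expansion of the edge `uv` is `p`.
    piece-meet : ∀ {r r′} → ¬ ConnAvoid H u v r r′ → PieceSupp r a b → PieceSupp r′ a b → (a , b) ∈ₛ steps u p
    piece-meet ¬c (inj₁ i) _ = i
    piece-meet ¬c (inj₂ _) (inj₁ i) = i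
    piece-meet ¬c (inj₂ (x , y , q , cx , cy , i)) (inj₂ (x′ , y′ , q′ , cx′ , cy′ , i′)) with exp-pairs-disjoint q q′ i i′
    ... | inj₁ (refl , refl) = uv-edge q (comp-meet ¬c cx cx′) (comp-meet ¬c cy cy′) i
    ... | inj₂ (refl , refl) = uv-edge q (comp-meet ¬c cx cy′) (comp-meet ¬c cy cx′) i

    kids-cycles : ∀ {rs Gs B} → Kids H u v p ws rs Gs B → All (IsCycle (λ _ → ⊤) G) B
    kids-cycles [] = []
    kids-cycles ((_ , _ , res) ∷ ks) = AllP.++⁺ (Result.cycles res) (kids-cycles ks)

    kids-support : ∀ {rs Gs B} → Kids H u v p ws rs Gs B → C ∈ B → cycleVec C a b ≡ true → Any (λ r → PieceSupp r a b) rs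
    kids-support (_∷_ {B = B} (_ , ch , res) ks) i t with ∈-++⁻ B i
    ... | inj₁ j = here (Child.supp ch (Result.support res j t))
    ... | inj₂ j = there (kids-support ks j t)

    kids-independent : ∀ {rs Gs B} → AllPairs (λ r s → ¬ ConnAvoid H u v r s) rs → Kids H u v p ws rs Gs B →
        Independent (map cycleVec B)
    kids-independent [] [] = λ { [] _ _ → [] }
    kids-independent (ne ∷ nes) (_∷_ {r} {rs} {B = B} {B′} (K , ch , res) ks) =
        subst Independent (sym (map-++ cycleVec B B′))
      (independent-++ (map cycleVec B) (map cycleVec B′)
          (AllP.map⁺ (All.map (λ {C} → cycle-even {C = C} G-irr) (Result.cycles res))) p-unique meet
        (Result.independent res) (kids-independent nes ks))
      where
      meet : ∀ {a b} → Any (λ v → v a b ≡ true) (map cycleVec B) → Any (λ v → v a b ≡ true) (map cycleVec B′) →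
          (a , b) ∈ₛ steps u p
      meet {a} {b} i j with find (AnyP.map⁻ i) | find (AnyP.map⁻ j)
      ... | C , k , t | D , l , t′ = apart ne (kids-support ks l t′)
        where
        apart : ∀ {rs} → All (λ s → ¬ ConnAvoid H u v r s) rs → Any (λ s → PieceSupp s a b) rs → (a , b) ∈ₛ steps u p
        apart (ne ∷ _) (here q) = piece-meet ne (Child.supp ch (Result.support res k t)) q
        apart (_ ∷ nes) (there q) = apart nes q

    kid-at : ∀ {rs Gs B} {P : Fin n → Set} → Kids H u v p ws rs Gs B → Deciders Gs → Any P rs →
      ∃ λ r → P r × (∃ λ K → Child H u v r p ws K × (∃ λ B′ → Spans K B′ × (∀ {C} → C ∈ B′ → C ∈ B)))
    kid-at (_∷_ {Gs = Gs} {B = B} (K , ch , res) ks) ds (here q) = _ , q , K , ch , B ,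
        Result.spans res (AllP.++⁻ˡ Gs ds) , ∈-++⁺ˡ
    kid-at (_∷_ {Gs = Gs} {B = B} _ ks) ds (there i) = let r , q , K , ch , B′ , sp , sub = kid-at ks (AllP.++⁻ʳ Gs ds) i in
      r , q , K , ch , B′ , sp , ∈-++⁺ʳ B ∘ sub

    module InChild {r K} (ch : Child H u v r p ws K) where
      open Child ch

      Inside : Edge n → Set
      Inside (x , y) = E H x y × compV H u v r x × compV H u v r y

      exps-lift : All Inside es → exps K es ≡ exps H es
      exps-lift [] = refl
      exps-lift ((q , c , d) ∷ qs) = cong₂ (λ l → pairs l ++_) (lift q c d .proj₂ .proj₁) (exps-lift qs)

      weight-lift : All Inside es → weight (wt K) es ≡ weight (wt H) es
      weight-lift [] = refl
      weight-lift ((q , c , d) ∷ qs) = cong₂ _+_ (lift q c d .proj₂ .proj₂) (weight-lift qs)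

      walk-lift : Walk (E H) x ys z → All (compV H u v r) (x ∷ ys) → Walk (E K) x ys z × All Inside (steps x ys)
      walk-lift [] cs = [] , []
      walk-lift (q ∷ qs) (c ∷ d ∷ cs) = let ps , is = walk-lift qs (d ∷ cs) in lift q c d .proj₁ ∷ ps , (q , c , d) ∷ is

    module _ {reps Gs B} (rp : Representatives H u v reps) (ks : Kids H u v p ws reps Gs B) (ds : Deciders Gs) where

      -- The first interior vertex selects the child; the whole arc lies in it and is closed up by
      -- the reversed `short-walk` of that child.
      arc-span : ∀ l → Walk (E H) u (l ++ [ v ]) v → Unique (u ∷ l ++ [ v ]) →
        Span w B (weight (wt H) (steps u (l ++ [ v ])) + ws)
            (incidence (exps H (steps u (l ++ [ v ]))) ⊕ incidence (steps u p))
      -- An arc without interior vertices is the edge `uv`; its expansion is `p` itself, so the sum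
      -- vanishes and no child has to be selected.
      arc-span [] (q ∷ []) uq = zero λ a b → trans (cong (_xor incidence (steps u p) a b)
        (cong (λ l → incidence l a b) (trans (++-identityʳ (pairs (exp H u v))) (cong pairs (p-edge q)))))
            (xor-same (incidence (steps u p) a b))
      arc-span (h ∷ l) wk@(q ∷ _) uq
        with kid-at ks ds (rp .proj₂ .proj₂ h (E-V (E-sym q)) h≢u h≢v)
        where
        h≢u : h ≢ u
        h≢u refl = Unique-splitAt [] uq .proj₂ .proj₁ (here refl)
        h≢v : h ≢ v
        h≢v refl = Unique-splitAt (u ∷ h ∷ l) uq .proj₁ (there (here refl))
      ... | r , hr , K , ch , B′ , sp , sub =
          Span-cong vec (Span-mono sub (ℚP.≤-reflexive wgt) (spans-closed-walk inv sp closed))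
        where
        open Child ch
        open InChild ch
        L = h ∷ l ++ [ v ]
        h≢u : h ≢ u
        h≢u refl = Unique-splitAt [] uq .proj₂ .proj₁ (here refl)
        h≢v : h ≢ v
        h≢v refl = Unique-splitAt (u ∷ h ∷ l) uq .proj₁ (there (here refl))
        all-in : All (compV H u v r) (u ∷ L)
        all-in = All.tabulate λ j → arc-comp (h ∷ l) wk uq (there (here refl)) j (inj₁ (conn-sym hr)) h≢u h≢v
        wK = walk-lift wk all-in .proj₁
        ins = walk-lift wk all-in .proj₂
        s = short-walk .proj₁
        sw = short-walk .proj₂ .proj₁
        rs = revTail u s
        closed : Walk (E K) u (L ++ rs) u
        closed = walk-++ wK (revTail-walk (Inv.E-sym inv) sw)
        wgt : weight (wt K) (steps u (L ++ rs)) ≡ weight (wt H) (steps u L) + ws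
        wgt = trans (cong (weight (wt K)) (steps-++ wK rs)) (trans (weight-++ {wt = wt K} (steps u L) (steps v rs))
          (cong₂ _+_ (weight-lift ins) (trans (weight-revTail (Inv.wt-sym inv) sw) (short-walk .proj₂ .proj₂ .proj₂))))
        vec : incidence (exps K (steps u (L ++ rs))) ≈ incidence (exps H (steps u L)) ⊕ incidence (steps u p)
        vec a b = trans (cong (λ q → incidence q a b)
            (trans (cong (exps K) (steps-++ wK rs)) (exps-++ K (steps u L) (steps v rs))))
          (trans (incidence-++ (exps K (steps u L)) (exps K (steps v rs)) a b)
            (cong₂ _xor_ (cong (λ q → incidence q a b) (exps-lift ins))
              (trans (InvProperties.exps-revTail inv sw a b) (short-walk .proj₂ .proj₂ .proj₁ a b))))

      span-both : ∀ l r → IsCycle (V H) (E H) (u ∷ l ++ v ∷ r) →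
        Span w B (weight (wt H) (cycEdges (u ∷ l ++ v ∷ r))) (incidence (exps H (cycEdges (u ∷ l ++ v ∷ r))))
      span-both l r cyc@(_ , uq , _) = add (Span-mono id le₁ (arc-span l w₁ u₁))
          (Span-mono id le₂ (arc-span (reverse r) w₂ u₂)) vec
        where
        a₁ = steps u (l ++ [ v ])
        a₂ = steps v (r ++ [ u ])
        whole : cycEdges (u ∷ l ++ v ∷ r) ≡ a₁ ++ a₂
        whole = trans (cong (steps u) (++-assoc l (v ∷ r) [ u ])) (steps-splitAt u l v (r ++ [ u ]))
        ww = walk-splitAt l (subst (λ t → Walk (E H) u t u) (++-assoc l (v ∷ r) [ u ]) (cycle-walk cyc))
        w₁ = ww .proj₁
        w₂′ = ww .proj₂
        rev : revTail v (r ++ [ u ]) ≡ reverse r ++ [ v ]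
        rev = revTail-snoc r
        w₂ : Walk (E H) u (reverse r ++ [ v ]) v
        w₂ = subst (λ t → Walk (E H) u t v) rev (revTail-walk E-sym w₂′)
        b₂ = steps u (reverse r ++ [ v ])
        wb₂ : weight (wt H) b₂ ≡ weight (wt H) a₂
        wb₂ = trans (cong (weight (wt H) ∘ steps u) (sym rev)) (weight-revTail wt-sym w₂′)
        ib₂ : incidence (exps H b₂) ≈ incidence (exps H a₂)
        ib₂ a b = trans (cong (λ t → incidence (exps H (steps u t)) a b) (sym rev)) (exps-revTail w₂′ a b)
        u₁ : Unique (u ∷ l ++ [ v ])
        u₁ = Unique-++⁻ (u ∷ l ++ [ v ]) (subst (λ t → Unique (u ∷ t)) (sym (++-assoc l [ v ] r)) uq) .proj₁
        u₂ : Unique (u ∷ reverse r ++ [ v ])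
        u₂ = Unique-↭ (prep u (↭-trans (prep v (↭-sym (PermP.↭-reverse r))) (PermP.++-comm [ v ] (reverse r))))
          (AllP.++⁻ʳ l (AllPairs.head uq) ∷ Unique-++⁻ (u ∷ l) uq .proj₂ .proj₁)
        sum : weight (wt H) (cycEdges (u ∷ l ++ v ∷ r)) ≡ weight (wt H) a₁ + weight (wt H) a₂
        sum = trans (cong (weight (wt H)) whole) (weight-++ a₁ a₂)
        le₁ : weight (wt H) a₁ + ws ≤ weight (wt H) (cycEdges (u ∷ l ++ v ∷ r))
        le₁ = ℚP.≤-trans (ℚP.+-monoʳ-≤ (weight (wt H) a₁) (ℚP.≤-trans (ws-min w₂) (ℚP.≤-reflexive wb₂)))
            (ℚP.≤-reflexive (sym sum))
        le₂ : weight (wt H) b₂ + ws ≤ weight (wt H) (cycEdges (u ∷ l ++ v ∷ r))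
        le₂ = ℚP.≤-trans (ℚP.+-mono-≤ (ℚP.≤-reflexive wb₂) (ws-min w₁))
            (ℚP.≤-reflexive (trans (ℚP.+-comm (weight (wt H) a₂) _) (sym sum)))
        vec : incidence (exps H (cycEdges (u ∷ l ++ v ∷ r))) ≈
          (incidence (exps H a₁) ⊕ incidence (steps u p)) ⊕ (incidence (exps H b₂) ⊕ incidence (steps u p))
        vec a b = trans (cong (λ q → incidence q a b) (trans (cong (exps H) whole) (exps-++ H a₁ a₂)))
          (trans (incidence-++ (exps H a₁) (exps H a₂) a b) (trans (cong (incidence (exps H a₁) a b xor_) (sym (ib₂ a b)))
            (xor-insert (incidence (exps H a₁) a b) (incidence (exps H b₂) a b) (incidence (steps u p) a b))))

      -- The cycle is rotated so that `c` is the only vertex that may be `u` or `v`. The remaining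
      -- vertices are connected to each other off `u` and `v`, and `c` is adjacent to them, so a
      -- single child contains the cycle.
      span-one : ∀ c l → IsCycle (V H) (E H) (c ∷ l) → All (λ z → z ≢ u × z ≢ v) l →
        Span w B (weight (wt H) (cycEdges (c ∷ l))) (incidence (exps H (cycEdges (c ∷ l))))
      span-one c [] (s≤s () , _) _
      span-one c (h ∷ l) cyc@(len , uq , vc ∷ vs , _) oks@((h≢u , h≢v) ∷ _)
        with kid-at ks ds (rp .proj₂ .proj₂ h (All.head vs) h≢u h≢v)
      ... | r , hr , K , ch , B′ , sp , sub = subst₂ (Span w B) (weight-lift ins) (cong incidence (exps-lift ins))
            (Span-mono sub ℚP.≤-refl (sp (c ∷ h ∷ l) (len , uq , All.map comp⇒V all-in , walk-All wK)))
        where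
        open Child ch
        open InChild ch
        wk = cycle-walk cyc
        wh : ∃ λ e → Walk (E H) h l e × Walk (E H) e [ c ] c
        wh = walk-split l (tail wk)
          where
          tail : Walk (E H) c (h ∷ l ++ [ c ]) c → Walk (E H) h (l ++ [ c ]) c
          tail (_ ∷ q) = q
        ok : All Ok (h ∷ l)
        ok = All.zipWith (λ (q , s) → q , s) (vs , oks)
        rest : All (compV H u v r) (h ∷ l)
        rest = All.tabulate λ i → inj₁ (conn-trans (conn-sym hr) (conn-∈ (wh .proj₂ .proj₁) ok i))
        c-in : compV H u v r c
        c-in = comp-step (All.head rest) (E-sym (first wk)) h≢u h≢v
          where
          first : Walk (E H) c (h ∷ l ++ [ c ]) c → E H c h
          first (q ∷ _) = q
        all-in : All (compV H u v r) (c ∷ h ∷ l)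
        all-in = c-in ∷ rest
        lifted = walk-lift wk (c-in ∷ AllP.++⁺ rest (c-in ∷ []))
        wK = lifted .proj₁
        ins = lifted .proj₂

      span-↭ : cycEdges C ↭ cycEdges D → Span w B (weight (wt H) (cycEdges D)) (incidence (exps H (cycEdges D))) →
        Span w B (weight (wt H) (cycEdges C)) (incidence (exps H (cycEdges C)))
      span-↭ q s = Span-cong (incidence-↭ (exps-↭ H (↭-sym q))) (Span-mono id (ℚP.≤-reflexive (weight-↭ (↭-sym q))) s)

      span-cycle : Spans H B
      span-cycle C cyc with Any.any? (u ≟_) C | Any.any? (v ≟_) C
      ... | yes u∈ | yes v∈ with cycle-at cyc u∈
      ... | r , cyc′ , C↭ , E↭ with ∈-resp-↭ C↭ v∈
      ... | here eq = contradiction (sym eq) u≢v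
      ... | there v∈′ with ∈-∃++ v∈′
      ... | l , r′ , refl = span-↭ {C = C} {D = u ∷ l ++ v ∷ r′} E↭ (span-both l r′ cyc′)
      span-cycle C cyc | yes u∈ | no v∉ with cycle-at cyc u∈
      ... | r , cyc′ , C↭ , E↭ = span-↭ {C = C} {D = u ∷ r} E↭ (span-one u r cyc′ (All.tabulate λ i →
            (λ { refl → Unique-splitAt [] (cyc′ .proj₂ .proj₁) .proj₂ .proj₁ i }) ,
                λ { refl → v∉ (∈-resp-↭ (↭-sym C↭) (there i)) }))
      span-cycle C cyc | no u∉ | yes v∈ with cycle-at cyc v∈
      ... | r , cyc′ , C↭ , E↭ = span-↭ {C = C} {D = v ∷ r} E↭ (span-one v r cyc′ (All.tabulate λ i →
            (λ { refl → u∉ (∈-resp-↭ (↭-sym C↭) (there i)) }) ,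
                λ { refl → Unique-splitAt [] (cyc′ .proj₂ .proj₁) .proj₂ .proj₁ i }))
      span-cycle (c ∷ l) cyc | no u∉ | no v∉ =
          span-one c l cyc (All.tabulate λ i → (λ { refl → u∉ (there i) }) , λ { refl → v∉ (there i) })
      span-cycle [] (() , _) | no _ | no _

    combine : ∀ {reps Gs B} → Representatives H u v reps → Kids H u v p ws reps Gs B → Result H Gs B
    combine rp ks = record
      { cycles = kids-cycles ks
      ; support = λ i t → piece-Supp (Any.satisfied (kids-support ks i t) .proj₂)
      ; independent = kids-independent (rp .proj₂ .proj₁) ks
      ; spans = span-cycle rp ks }

-- Outerplanar parts

minimiser : ∀ {A : Set} (f : A → ℕ) x xs → ∃ λ z → z ∈ x ∷ xs × (∀ {y} → y ∈ x ∷ xs → f z ℕ.≤ f y)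
minimiser f x [] = x , here refl , λ { (here refl) → ℕP.≤-refl }
minimiser f x (y ∷ xs) with minimiser f y xs
... | z , z∈ , le with f x ℕP.≤? f z
... | yes x≤z = x , here refl , λ { (here refl) → ℕP.≤-refl ; (there i) → ℕP.≤-trans x≤z (le i) }
... | no x≰z = z , there z∈ , λ { (here refl) → ℕP.<⇒≤ (ℕP.≰⇒> x≰z) ; (there i) → le i }

first-in : (C : List (Fin n)) → ∀ ys → Any (_∈ C) ys → ∃ λ l → ∃ λ c → ∃ λ r → ys ≡ l ++ c ∷ r × All (_∉ C) l × c ∈ C
first-in C (y ∷ ys) i with Any.any? (y ≟_) C
... | yes y∈ = [] , y , ys , refl , [] , y∈
first-in C (y ∷ ys) (here y∈) | no y∉ = contradiction y∈ y∉
first-in C (y ∷ ys) (there i) | no y∉ = let l , c , r , eq , ∉s , c∈ = first-in C ys i in y ∷ l , c , r , cong (y ∷_) eq , y∉ ∷ ∉s , c∈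

Chordless : Rel₀ n → List (Fin n) → Set
Chordless R (x ∷ y ∷ ys) = All (λ z → ¬ R x z) ys × Chordless R (y ∷ ys)
Chordless R _ = ⊤

steps-⊆ : ∀ (x : Fin n) ys → e ∈ steps x ys → e ∈ steps x (ys ++ zs)
steps-⊆ x (y ∷ ys) (here eq) = here eq
steps-⊆ x (y ∷ ys) (there i) = there (steps-⊆ y ys i)

-- `F` is the successor relation of a cycle, or its converse. Turning back at `x` would lead to its
-- only predecessor `p`, which is not revisited; so the path is forced, and it stops where the arc
-- does.
follow : {F : Rel₀ n} → (∀ {x y z} → F x y → F x z → y ≡ z) → (∀ {x y z} → F x z → F y z → x ≡ y) →
  ∀ {p x ys as y} → F p x → p ∉ ys → Walk (λ a b → F a b ⊎ F b a) x ys y → Unique (x ∷ ys) →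
  Walk F x as y → Unique (x ∷ as) → ys ≡ as
follow succ pred px p∉ [] uq [] uq′ = refl
follow succ pred px p∉ [] uq (q ∷ qs) uq′ = contradiction (walk-last-∈ qs) (Unique-splitAt [] uq′ .proj₂ .proj₁)
follow succ pred px p∉ (q ∷ qs) uq [] uq′ = contradiction (walk-last-∈ qs) (Unique-splitAt [] uq .proj₂ .proj₁)
follow succ pred px p∉ (inj₂ q ∷ qs) uq (f ∷ fs) uq′ = contradiction (here (pred px q)) p∉
follow succ pred px p∉ (inj₁ q ∷ qs) uq (f ∷ fs) uq′ with succ q f
... | refl = cong (_ ∷_) (follow succ pred q (Unique-splitAt [] uq .proj₂ .proj₁ ∘ there) qs (AllPairs.tail uq) fs
    (AllPairs.tail uq′))

follow-start : {F : Rel₀ n} → (∀ {x y z} → F x y → F x z → y ≡ z) → (∀ {x y z} → F x z → F y z → x ≡ y) →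
  ∀ {x c ys as y} → F x c → Walk (λ a b → F a b ⊎ F b a) c ys y → Unique (x ∷ c ∷ ys) → x ≢ y →
  Walk F x as y → Unique (x ∷ as) → c ∷ ys ≡ as
follow-start succ pred q qs uq x≢y [] uq′ = contradiction refl x≢y
follow-start succ pred q qs uq x≢y (f ∷ fs) uq′ with succ q f
... | refl = cong (_ ∷_) (follow succ pred q (Unique-splitAt [] uq .proj₂ .proj₁ ∘ there) qs (AllPairs.tail uq) fs
    (AllPairs.tail uq′))

Induced : Rel₀ n → List (Fin n) → Set
Induced R C = ∀ {x y} → x ∈ C → y ∈ C → R x y → (x , y) ∈ₛ cycEdges C

Induced-↭ : C ↭ D → cycEdges C ↭ cycEdges D → Induced R C → Induced R D
Induced-↭ p q ind i j r = ∈ₛ-⊆ (∈-resp-↭ q) (ind (∈-resp-↭ (↭-sym p) i) (∈-resp-↭ (↭-sym p) j) r)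

-- Linear relations as sublists

selected : ∀ {X : Set} → List Bool → List X → List X
selected (true ∷ cs) (x ∷ xs) = x ∷ selected cs xs
selected (false ∷ cs) (x ∷ xs) = selected cs xs
selected _ _ = []

selected-All : ∀ {X : Set} {P : X → Set} cs {xs} → All P xs → All P (selected cs xs)
selected-All [] ps = []
selected-All (true ∷ cs) [] = []
selected-All (false ∷ cs) [] = []
selected-All (true ∷ cs) (p ∷ ps) = p ∷ selected-All cs ps
selected-All (false ∷ cs) (p ∷ ps) = selected-All cs ps

selected-AllPairs : ∀ {X : Set} {P : X → X → Set} cs {xs} → AllPairs P xs → AllPairs P (selected cs xs)
selected-AllPairs [] ps = []
selected-AllPairs (true ∷ cs) [] = []
selected-AllPairs (false ∷ cs) [] = []
selected-AllPairs (true ∷ cs) (p ∷ ps) = selected-All cs p ∷ selected-AllPairs cs ps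
selected-AllPairs (false ∷ cs) (p ∷ ps) = selected-AllPairs cs ps

selected-[] : ∀ {X : Set} cs (xs : List X) → length cs ≡ length xs → selected cs xs ≡ [] → All (_≡ false) cs
selected-[] [] [] _ _ = []
selected-[] (false ∷ cs) (x ∷ xs) len eq = refl ∷ selected-[] cs xs (ℕP.suc-injective len) eq

xorSum : ∀ {X : Set} → (X → Bool) → List X → Bool
xorSum f = foldr (λ x c → f x xor c) false

lincomb-selected : ∀ {X : Set} (g : X → EdgeVec {n}) cs xs a b →
    lincomb cs (map g xs) a b ≡ xorSum (λ x → g x a b) (selected cs xs)
lincomb-selected g [] [] a b = refl
lincomb-selected g [] (x ∷ xs) a b = refl
lincomb-selected g (true ∷ cs) [] a b = refl
lincomb-selected g (false ∷ cs) [] a b = refl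
lincomb-selected g (true ∷ cs) (x ∷ xs) a b = cong (g x a b xor_) (lincomb-selected g cs xs a b)
lincomb-selected g (false ∷ cs) (x ∷ xs) a b = lincomb-selected g cs xs a b

xorSum-false : ∀ {X : Set} {f : X → Bool} {xs} → All (λ x → f x ≡ false) xs → xorSum f xs ≡ false
xorSum-false [] = refl
xorSum-false (p ∷ ps) = cong₂ _xor_ p (xorSum-false ps)

-- All entries on which `f` is true are related to `c`, and no two entries are related, so exactly
-- one summand is 1. Both directions of `_~_` are requested since `c` may stand before or after the
-- other entry.
xorSum-single : ∀ {X : Set} {_~_ : X → X → Set} (f : X → Bool) {xs c} → AllPairs (λ x y → ¬ x ~ y) xs → c ∈ xs → f c ≡ true →
  (∀ {x} → x ∈ xs → f x ≡ true → c ~ x × x ~ c) → xorSum f xs ≡ true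
xorSum-single f (ne ∷ nes) (here refl) fc h =
    cong₂ _xor_ fc (xorSum-false (All.tabulate λ i → ¬true⇒false λ t → All.lookup ne i (h (there i) t .proj₁)))
xorSum-single f (ne ∷ nes) (there i) fc h =
    cong₂ _xor_ (¬true⇒false λ t → All.lookup ne i (h (here refl) t .proj₂)) (xorSum-single f nes i fc (h ∘ there))

walk-head : Walk R x ys z → x ≢ z → ∃ λ c → ∃ λ zs → ys ≡ c ∷ zs
walk-head [] x≢x = contradiction refl x≢x
walk-head (_ ∷ _) _ = _ , _ , refl

Pointwise-++⁻ : ∀ {a b r} {X : Set a} {Y : Set b} {P : X → Y → Set r} xs {xs′ ys} → Pointwise P (xs ++ xs′) ys →
  ∃ λ ys₁ → ∃ λ ys₂ → ys ≡ ys₁ ++ ys₂ × Pointwise P xs ys₁ × Pointwise P xs′ ys₂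
Pointwise-++⁻ [] ps = [] , _ , refl , [] , ps
Pointwise-++⁻ (x ∷ xs) (p ∷ ps) = let ys₁ , ys₂ , eq , qs , rs = Pointwise-++⁻ xs ps in _ ∷ ys₁ , ys₂ , cong (_ ∷_) eq , p ∷ qs , rs

exAll-++ : ∀ {r} {P : Part n → List (List (Fin n)) → Set r} {Gs Gs′ Css Css′} → Pointwise P Gs Css →
  exAll (Gs ++ Gs′) (Css ++ Css′) ≡ exAll Gs Css ++ exAll Gs′ Css′
exAll-++ [] = refl
exAll-++ {Gs = H ∷ Gs} {Css = Cs ∷ Css} (p ∷ ps) =
    trans (cong (map (ex H) Cs ++_) (exAll-++ ps)) (sym (++-assoc (map (ex H) Cs) _ _))

-- Induced cycles in parts without a K₂,₃-subdivision

module Assembly {n : ℕ} (G : Rel₀ n) (G-sym : ∀ {x y} → G x y → G y x) (G-irr : ∀ {x} → ¬ G x x) (w : Fin n → Fin n → ℚ)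
  (w-sym : ∀ x y → G x y → w x y ≡ w y x) (A : Rel₀ n) {ρ : Fin n → ℕ} (el : Elimination A ρ) (σ : Permutation′ n) where
  open Combine G G-sym G-irr w w-sym A (Elimination.A-sym el) public

  module _ {H : Part n} (I : Inv H) (¬K23 : ¬ HasK23 H) where
    open Inv I
    open InvProperties I

    Cyc : List (Fin n) → Set
    Cyc = IsCycle (V H) (E H)

    record Arcs (x y : Fin n) (l r : List (Fin n)) : Set where
      field
        first-walk : Walk (E H) x (l ++ [ y ]) y
        second-walk : Walk (E H) x (reverse r ++ [ y ]) y
        first-unique : Unique (x ∷ l ++ [ y ])
        second-unique : Unique (x ∷ reverse r ++ [ y ])
        first-edges : Walk (λ a b → (a , b) ∈ cycEdges (x ∷ l ++ y ∷ r)) x (l ++ [ y ]) y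
        second-edges : Walk (λ a b → (b , a) ∈ cycEdges (x ∷ l ++ y ∷ r)) x (reverse r ++ [ y ]) y
        ends : x ≢ y
        apart : a ∈ l → a ∉ r

    cycEdges-arcs : ∀ x l (y : Fin n) r → cycEdges (x ∷ l ++ y ∷ r) ≡ steps x (l ++ [ y ]) ++ steps y (r ++ [ x ])
    cycEdges-arcs x l y r = trans (cong (steps x) (++-assoc l (y ∷ r) [ x ])) (steps-splitAt x l y (r ++ [ x ]))

    arcs : ∀ l r → Cyc (x ∷ l ++ y ∷ r) → Arcs x y l r
    arcs {x} {y} l r cyc@(_ , uq , _ , es) = record
      { first-walk = walk-map (All.lookup es) f₁
      ; second-walk = walk-map (λ i → E-sym (All.lookup es i)) f₂
      ; first-unique = Unique-++⁻ (x ∷ l ++ [ y ]) (subst (λ t → Unique (x ∷ t)) (sym (++-assoc l [ y ] r)) uq) .proj₁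
      ; second-unique = Unique-↭ (prep x (↭-trans (prep y (↭-sym (PermP.↭-reverse r))) (PermP.++-comm [ y ] (reverse r))))
          (AllP.++⁻ʳ l (AllPairs.head uq) ∷ Unique-++⁻ (x ∷ l) uq .proj₂ .proj₁)
      ; first-edges = f₁
      ; second-edges = f₂
      ; ends = λ { refl → Unique-splitAt [] uq .proj₂ .proj₁ (∈-++⁺ʳ l (here refl)) }
      ; apart = λ i j → Unique-++⁻ l (AllPairs.tail uq) .proj₂ .proj₂ i (there j) }
      where
      f₁ : Walk (λ a b → (a , b) ∈ cycEdges (x ∷ l ++ y ∷ r)) x (l ++ [ y ]) y
      f₁ = All-walk l (All.tabulate λ i → subst (_ ∈_) (sym (cycEdges-arcs x l y r)) (∈-++⁺ˡ i))
      f₂ : Walk (λ a b → (b , a) ∈ cycEdges (x ∷ l ++ y ∷ r)) x (reverse r ++ [ y ]) y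
      f₂ = subst (λ t → Walk (λ a b → (b , a) ∈ cycEdges (x ∷ l ++ y ∷ r)) x t y) (revTail-snoc r)
          (revTail-walk {R = λ a b → (a , b) ∈ cycEdges (x ∷ l ++ y ∷ r)} id
        (All-walk r (All.tabulate λ i → subst (_ ∈_) (sym (cycEdges-arcs x l y r)) (∈-++⁺ʳ (steps x (l ++ [ y ])) i))))

    path-in : Walk (E H) x ys y → Unique (x ∷ ys) → x ≢ y → PathIn H x y (x ∷ ys)
    path-in {x = x} = Component.walk-path I x x

    -- A detour leaving the cycle at x and returning at c closes a K₂,₃.
    no-detour : Cyc C → x ∈ C → ∀ y l c → c ∈ C → All (_∉ C) (y ∷ l) → Walk (E H) x (y ∷ l ++ [ c ]) c →
        Unique (x ∷ y ∷ l ++ [ c ]) →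
      ¬ ¬ E H x c
    no-detour {C = C} {x} cyc x∈ y l c c∈ out wk uq ¬xc with cycle-at cyc x∈
    ... | s , cyc′ , C↭ , E↭ with ∈-resp-↭ C↭ c∈
    ... | here refl = Unique-splitAt [] uq .proj₂ .proj₁ (there (∈-++⁺ʳ l (here refl)))
    ... | there c∈′ with ∈-∃++ c∈′
    -- If one of the two arcs between `x` and `c` has no interior vertex, `xc` is an edge of the
    -- cycle. Otherwise the arcs and the detour are three disjoint paths with interior vertices.
    ... | [] , r , refl with cyc′ .proj₂ .proj₂ .proj₂
    ... | xc ∷ _ = ¬xc xc
    no-detour {C = C} {x} cyc x∈ y l c c∈ out wk uq ¬xc | s , cyc′ , C↭ , E↭ | there c∈′ | l′@(_ ∷ _) , [] , refl =
      ¬xc (E-sym (All.lookup (cyc′ .proj₂ .proj₂ .proj₂)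
          (subst ((c , x) ∈_) (sym (cycEdges-arcs x l′ c [])) (∈-++⁺ʳ (steps x (l′ ++ [ c ])) (here refl)))))
    no-detour {C = C} {x} cyc x∈ y l c c∈ out wk uq ¬xc | s , cyc′ , C↭ , E↭ | there c∈′ | l′@(_ ∷ _) , r@(_ ∷ r′) , refl =
      ¬K23 (x , c , ends , l′ , reverse r , y ∷ l , s≤s z≤n , subst (1 ℕ.≤_) (sym (length-reverse r)) (s≤s z≤n) , s≤s z≤n ,
        path-in first-walk first-unique ends , path-in second-walk second-unique ends , path-in wk uq ends ,
        All.tabulate (λ i j → apart i (AnyP.reverse⁻ j)) ,
        All.tabulate (λ i j → All.lookup out j (∈-resp-↭ (↭-sym C↭) (there (∈-++⁺ˡ i)))) ,
        All.tabulate (λ i j → All.lookup out j (∈-resp-↭ (↭-sym C↭) (there (∈-++⁺ʳ l′ (there (AnyP.reverse⁻ i)))))))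
      where open Arcs (arcs l′ r cyc′)

    -- If the path left `C` after `x`, its first return `c` would by `no-detour` be adjacent to `x`,
    -- which is a chord of the path.
    chordless-in-cycle : Cyc C → Walk (E H) x ys z → Unique (x ∷ ys) → x ∈ C → z ∈ C → Chordless (E H) (x ∷ ys) →
        All (_∈ C) (x ∷ ys)
    chordless-in-cycle cyc [] uq x∈ z∈ ch = x∈ ∷ []
    chordless-in-cycle {C = C} cyc wk@(_∷_ {y = y} {ys} q qs) uq x∈ z∈ ch with Any.any? (y ≟_) C
    ... | yes y∈ = x∈ ∷ chordless-in-cycle cyc qs (AllPairs.tail uq) y∈ z∈ (tail ys ch)
      where
      tail : ∀ {x y} ys → Chordless (E H) (x ∷ y ∷ ys) → Chordless (E H) (y ∷ ys)
      tail ys = proj₂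
    chordless-in-cycle {C = C} {x} cyc wk@(_∷_ {y = y} {ys} q qs) uq x∈ z∈ ch | no y∉ with walk-last-∈ qs
    ... | here refl = contradiction z∈ y∉
    ... | there z∈ys with first-in C ys (lose z∈ys z∈)
    ... | l , c , r , refl , ∉s , c∈ = ⊥-elim (no-detour cyc x∈ y l c c∈ (y∉ ∷ ∉s) (walk-splitAt (y ∷ l) wk .proj₁)
          (Unique-++⁻ (x ∷ y ∷ l ++ [ c ]) (subst (λ t → Unique (x ∷ y ∷ t)) (sym (++-assoc l [ c ] r)) uq) .proj₁)
          (All.lookup (ch .proj₁) (∈-++⁺ʳ l (here refl))))

    -- A chord at `x` would be an edge of `C`, so it would lead to the successor of `x` or to its
    -- predecessor `p`, and neither occurs further along. The extra vertex `p` is carried for this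
    -- reason.
    cycle-chordless : Cyc C → Induced (E H) C → ∀ p x ys → (∀ {e} → e ∈ steps p (x ∷ ys) → e ∈ cycEdges C) →
        Unique (p ∷ x ∷ ys) →
      Chordless (E H) (x ∷ ys)
    cycle-chordless cyc ind p x [] sub uq = tt
    cycle-chordless {C = C} cyc@(_ , cu , _) ind p x (y ∷ ys) sub uq =
      All.tabulate no-chord , cycle-chordless cyc ind x y ys (sub ∘ there) (AllPairs.tail uq)
      where
      no-chord : ∀ {q} → q ∈ ys → ¬ E H x q
      no-chord {q} i xq with ind (cycEdges-∈ {C = C} (sub (here refl)) .proj₂)
          (cycEdges-∈ {C = C} (sub (there (there (later i .proj₂)))) .proj₂) xq
        where
        later : ∀ {y ys} → q ∈ ys → ∃ λ o → (o , q) ∈ steps y ys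
        later (here refl) = _ , here refl
        later (there i) = let o , j = later i in o , there j
      ... | inj₁ j with successor-unique {C = C} cu j (sub (there (here refl)))
      ... | refl = Unique-splitAt (p ∷ x ∷ []) uq .proj₂ .proj₁ i
      no-chord {q} i xq | inj₂ j with predecessor-unique {C = C} cu j (sub (here refl))
      ... | refl = Unique-splitAt [] uq .proj₂ .proj₁ (there (there i))

    record Neighbours (z : Fin n) (s : List (Fin n)) : Set where
      field
        next prev : Fin n
        mid : List (Fin n)
        shape : s ≡ next ∷ mid ++ [ prev ]
        E-next : E H z next
        E-prev : E H z prev
        next≢prev : next ≢ prev

    neighbours : Cyc (z ∷ ys) → Neighbours z ys
    neighbours {ys = []} (s≤s () , _)
    neighbours {ys = _ ∷ []} (s≤s (s≤s ()) , _)
    neighbours {z} {ys = y ∷ t ∷ ys} (_ , _ ∷ uq , _ , e ∷ es) with unsnoc t ys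
      where
      unsnoc : ∀ t ys → ∃ λ m → ∃ λ b → t ∷ ys ≡ m ++ [ b ]
      unsnoc t [] = [] , t , refl
      unsnoc t (s ∷ ys) = let m , b , eq = unsnoc s ys in t ∷ m , b , cong (t ∷_) eq
    ... | m , b , eq = record { next = y ; prev = b ; mid = m ; shape = cong (y ∷_) eq ; E-next = e
      ; E-prev = E-sym (All.lookup es (subst (_ ∈_) (sym whole) (∈-++⁺ʳ (steps y (m ++ [ b ])) (here refl))))
      ; next≢prev = λ { refl → Unique-splitAt [] uq .proj₂ .proj₁ (subst (y ∈_) (sym eq) (∈-++⁺ʳ m (here refl))) } }
      where
      whole : steps y ((t ∷ ys) ++ [ z ]) ≡ steps y (m ++ [ b ]) ++ steps b [ z ]
      whole = trans (cong (λ q → steps y (q ++ [ z ])) eq)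
          (trans (cong (steps y) (++-assoc m [ b ] [ z ])) (steps-splitAt y m b [ z ]))

    open Elimination el using (ρ-injective; upper-two)

    upper : Cyc C → z ∈ C → (∀ {y} → y ∈ C → ρ z ℕ.≤ ρ y) → y ∈ C → E H z y → ρ z ℕ.< ρ y
    upper cyc z∈ le y∈ zy = ℕP.≤∧≢⇒< (le y∈) λ eq → E-irr (subst (E H _) (sym (ρ-injective eq)) zy)

    -- The neighbours of `z` on `C` are two distinct later neighbours, hence all that `z` has, and
    -- those on `D` are among them. So `D` without `z` is a chordless path between vertices of `C`
    -- and stays on `C`.
    cycles-at-minimum-⊆ : Cyc C → Cyc D → Induced (E H) D → z ∈ C → z ∈ D →
      (∀ {y} → y ∈ C → ρ z ℕ.≤ ρ y) → (∀ {y} → y ∈ D → ρ z ℕ.≤ ρ y) → ∀ {y} → y ∈ D → y ∈ C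
    cycles-at-minimum-⊆ {C = C} {D} {z} cC cD iD zC zD leC leD {y} yD with cycle-at cC zC | cycle-at cD zD
    ... | s , cC′ , C↭ , _ | t , cD′ , D↭ , E↭ = go (∈-resp-↭ D↭ yD)
      where
      module C = Neighbours (neighbours cC′)
      module D = Neighbours (neighbours cD′)
      next∈ : ∀ {z s} (ns : Neighbours z s) → Neighbours.next ns ∈ z ∷ s
      next∈ ns = there (subst (_ ∈_) (sym (Neighbours.shape ns)) (here refl))
      prev∈ : ∀ {z s} (ns : Neighbours z s) → Neighbours.prev ns ∈ z ∷ s
      prev∈ ns = there (subst (_ ∈_) (sym (Neighbours.shape ns)) (there (∈-++⁺ʳ (Neighbours.mid ns) (here refl))))
      inC : ∀ {a} → a ∈ z ∷ s → a ∈ C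
      inC = ∈-resp-↭ (↭-sym C↭)
      inD : ∀ {a} → a ∈ z ∷ t → a ∈ D
      inD = ∈-resp-↭ (↭-sym D↭)
      shared : ∀ {a} → a ∈ D → E H z a → a ∈ C
      shared {a} aD za with upper-two (E-A C.E-next) (E-A C.E-prev) (E-A za)
        (upper cC zC leC (inC (next∈ (neighbours cC′))) C.E-next)
            (upper cC zC leC (inC (prev∈ (neighbours cC′))) C.E-prev) (upper cD zD leD aD za)
      ... | inj₁ eq = contradiction eq C.next≢prev
      ... | inj₂ (inj₁ refl) = inC (prev∈ (neighbours cC′))
      ... | inj₂ (inj₂ refl) = inC (next∈ (neighbours cC′))
      t-in : All (_∈ C) t
      t-in = subst (All (_∈ C)) (sym D.shape)
          (chordless-in-cycle cC path (subst Unique D.shape (AllPairs.tail (cD′ .proj₂ .proj₁)))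
        (shared (inD (next∈ (neighbours cD′))) D.E-next) (shared (inD (prev∈ (neighbours cD′))) D.E-prev)
        (cycle-chordless {C = z ∷ t} cD′ (Induced-↭ {C = D} {z ∷ t} {E H} D↭ E↭ iD) z D.next (D.mid ++ [ D.prev ])
          (λ i → subst (λ q → _ ∈ steps z (q ++ [ z ])) (sym D.shape) (steps-⊆ z (D.next ∷ D.mid ++ [ D.prev ]) i))
          (subst (λ q → Unique (z ∷ q)) D.shape (cD′ .proj₂ .proj₁))))
        where
        path : Walk (E H) D.next (D.mid ++ [ D.prev ]) D.prev
        path with walk-splitAt (D.next ∷ D.mid)
            (subst (λ q → Walk (E H) z (q ++ [ z ]) z) D.shape (cycle-walk cD′) & ++-assoc (D.next ∷ D.mid) [ D.prev ] [ z ])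
          where
          _&_ : ∀ {l l′} → Walk (E H) z l z → l ≡ l′ → Walk (E H) z l′ z
          p & refl = p
        ... | _ ∷ p , _ = p
      go : y ∈ z ∷ t → y ∈ C
      go (here refl) = zC
      go (there i) = All.lookup t-in i

    Induced-SameCycle : Cyc C → Cyc D → Induced (E H) C → Induced (E H) D → (∀ {y} → y ∈ C → y ∈ D) →
        (∀ {y} → y ∈ D → y ∈ C) → SameCycle C D
    Induced-SameCycle {C = C} {D} cC cD iC iD f g = ∈ₛ-SameCycle {C = C} {D = D} cC cD (half cC iD f) (half cD iC g)
      where
      half : ∀ {C D} → Cyc C → Induced (E H) D → (∀ {y} → y ∈ C → y ∈ D) → ∀ {e} → e ∈ₛ cycEdges C → e ∈ₛ cycEdges D
      half {C} cC iD f (inj₁ i) = let p , q = cycEdges-∈ {C = C} i in iD (f p) (f q) (All.lookup (cC .proj₂ .proj₂ .proj₂) i)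
      half {C} cC iD f (inj₂ i) = let p , q = cycEdges-∈ {C = C} i in ∈ₛ-flip (iD (f p) (f q) (All.lookup (cC .proj₂ .proj₂ .proj₂) i))

    two≢ : ∀ mid (y : Fin n) → 2 ≢ suc (suc (length (mid ++ [ y ])))
    two≢ [] y ()
    two≢ (_ ∷ _) y ()

    -- By `no-long` an edge `xy` is no heavier than any other path between its ends, and it has
    -- fewer edges; so it is the lex shortest path, which `C` contains.
    InLSC-Induced : InLSC σ H C → Induced (E H) C
    InLSC-Induced (cyc , lsc) {x} {y} x∈ y∈ xy with lsc x y x∈ y∈ (λ { refl → E-irr xy })
    ... | P , (((mid , refl) , uq , vs , wk) , best) , inC with mid
    ... | [] = All.head inC
    ... | m ∷ mid′ with best (x ∷ y ∷ [])
        (path-in (xy ∷ []) (((λ { refl → E-irr xy }) ∷ []) ∷ [] ∷ []) (λ { refl → E-irr xy })) (two≢ mid′ y ∘ cong length)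
    ... | inj₁ lt = contradiction (no-long xy (All-walk (m ∷ mid′) wk))
          (λ le → ℚP.<-irrefl refl (ℚP.<-≤-trans lt (ℚP.≤-trans (ℚP.≤-reflexive (ℚP.+-identityʳ (wt H x y))) le)))
    ... | inj₂ (inj₁ (_ , s≤s (s≤s ())))
    ... | inj₂ (inj₂ (_ , len , _)) = contradiction len (two≢ mid′ y)

  σℕ-injective : σℕ σ x ≡ σℕ σ y → x ≡ y
  σℕ-injective eq = trans (sym (inverseˡ σ)) (trans (cong (σ ⟨$⟩ˡ_) (toℕ-injective eq)) (inverseˡ σ))

  -- Lex shortest paths on induced cycles, and spanning

  module _ {H : Part n} (I : Inv H) (¬K23 : ¬ HasK23 H) where
    open Inv I
    open InvProperties I

    len : Fin n → List (Fin n) → ℚ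
    len x ys = weight (wt H) (steps x ys)

    -- Following a chord skips a vertex and, by `no-long`, does not increase the weight.
    shorten : (∀ x y → Dec (E H x y)) → Walk (E H) x ys z → Unique (x ∷ ys) → Chordless (E H) (x ∷ ys) ⊎
      (∃ λ zs → Walk (E H) x zs z × Unique (x ∷ zs) × (∀ {a} → a ∈ zs → a ∈ ys) × length zs ℕ.< length ys ×
          len x zs ≤ len x ys)
    shorten E? [] uq = inj₁ tt
    shorten E? (_∷_ {x} {y} {ys} q qs) uq with Any.any? (E? x) ys
    ... | yes i with find i
    ... | c , c∈ , xc with ∈-∃++ c∈
    ... | l , r , refl = let w₁ , w₂ = walk-splitAt (y ∷ l) (q ∷ qs) in
      inj₂ (c ∷ r , xc ∷ w₂ , All.tail (All.tabulate {xs = y ∷ c ∷ r} λ { (here refl) →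
          All.head (AllPairs.head uq) ; (there j) → All.lookup (AllPairs.head uq) (there (∈-++⁺ʳ l j)) }) ∷
              Unique-++⁻ (x ∷ y ∷ l) uq .proj₂ .proj₁ ,
        there ∘ ∈-++⁺ʳ l ,
        s≤s (ℕP.≤-trans (ℕP.m≤n+m _ (length l)) (ℕP.≤-reflexive (sym (length-++ l)))) ,
        ℚP.≤-trans (ℚP.+-monoˡ-≤ (len c r) (no-long xc w₁))
            (ℚP.≤-reflexive (sym (trans (cong (weight (wt H)) (steps-splitAt x (y ∷ l) c r))
                (weight-++ {wt = wt H} (steps x (y ∷ l ++ [ c ])) (steps c r))))))
    shorten E? (_∷_ {x} {y} {ys} q qs) uq | no ¬i with shorten E? qs (AllPairs.tail uq)
    ... | inj₁ ch = inj₁ (AllP.¬Any⇒All¬ ys ¬i , ch)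
    ... | inj₂ (zs , p , uq′ , sub , lt , le) = inj₂ (y ∷ zs , q ∷ p ,
            AllP.anti-mono (λ { (here refl) → here refl ; (there j) → there (sub j) }) (AllPairs.head uq) ∷ uq′ ,
            (λ { (here refl) → here refl ; (there j) → there (sub j) }) , s≤s lt , ℚP.+-monoʳ-≤ (wt H x y) le)

    len′ : List (Fin n) → ℚ
    len′ C = weight (wt H) (cycEdges C)

    IsArc : Fin n → List (Fin n) → List (Fin n) → List (Fin n) → Set
    IsArc y l r as = as ≡ l ++ [ y ] ⊎ as ≡ reverse r ++ [ y ]

    -- All vertices of the path are on the cycle, and the cycle is induced, so every step runs along
    -- a cycle edge; the first step then fixes the direction.
    chordless-arc : ∀ l r → Cyc I ¬K23 (x ∷ l ++ y ∷ r) → Induced (E H) (x ∷ l ++ y ∷ r) → Walk (E H) x ys y →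
        Unique (x ∷ ys) →
      Chordless (E H) (x ∷ ys) → IsArc y l r ys
    chordless-arc {x} {y} {ys} l r cyc@(_ , cu , _) ind wk uq ch = result wk uq along
      where
      open Arcs (arcs I ¬K23 l r cyc)
      F : Rel₀ n
      F a b = (a , b) ∈ cycEdges (x ∷ l ++ y ∷ r)
      inside : All (_∈ (x ∷ l ++ y ∷ r)) (x ∷ ys)
      inside = chordless-in-cycle I ¬K23 cyc wk uq (here refl) (there (∈-++⁺ʳ l (here refl))) ch
      along : Walk (λ a b → F a b ⊎ F b a) x ys y
      along = go wk inside
        where
        go : ∀ {x ys} → Walk (E H) x ys y → All (_∈ _) (x ∷ ys) → Walk (λ a b → F a b ⊎ F b a) x ys y
        go [] ins = []
        go (q ∷ qs) (i ∷ ins@(j ∷ _)) = ind i j q ∷ go qs ins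
      result : ∀ {ys} → Walk (E H) x ys y → Unique (x ∷ ys) → Walk (λ a b → F a b ⊎ F b a) x ys y → IsArc y l r ys
      result _ uq [] = contradiction refl ends
      result _ uq (inj₁ f ∷ fs) = inj₁ (follow-start {F = F} (successor-unique {C = x ∷ l ++ y ∷ r} cu)
          (predecessor-unique {C = x ∷ l ++ y ∷ r} cu) f fs uq ends first-edges first-unique)
      result _ uq (inj₂ f ∷ fs) = inj₂ (follow-start {F = λ a b → F b a} (predecessor-unique {C = x ∷ l ++ y ∷ r} cu)
          (successor-unique {C = x ∷ l ++ y ∷ r} cu) f
        (walk-map Sum.swap fs) uq ends second-edges second-unique)

    -- Repeated shortening ends with an arc. Any path that is not itself an arc loses to one already
    -- by its number of edges, so the comparison by `σ` has to be made only between the two arcs.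
    arc-dominates : (∀ x y → Dec (E H x y)) → ∀ l r → Cyc I ¬K23 (x ∷ l ++ y ∷ r) → Induced (E H) (x ∷ l ++ y ∷ r) →
        Walk (E H) x ys y → Unique (x ∷ ys) →
      ∃ λ as → IsArc y l r as × (ys ≡ as ⊎ (length as ℕ.< length ys × len x as ≤ len x ys))
    arc-dominates {x} {y} {ys} E? l r cyc ind = go (length ys) ℕP.≤-refl
      where
      go : ∀ k {ys} → length ys ℕ.≤ k → Walk (E H) x ys y → Unique (x ∷ ys) →
        ∃ λ as → IsArc y l r as × (ys ≡ as ⊎ (length as ℕ.< length ys × len x as ≤ len x ys))
      go k le wk uq with shorten E? wk uq
      ... | inj₁ ch = _ , chordless-arc l r cyc ind wk uq ch , inj₁ refl
      go zero le wk uq | inj₂ (zs , _ , _ , _ , lt , _) = contradiction (ℕP.<-≤-trans lt le) λ ()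
      go (suc k) le wk uq | inj₂ (zs , wk′ , uq′ , _ , lt , leq) with go k (ℕP.≤-pred (ℕP.≤-trans lt le)) wk′ uq′
      ... | as , arc , inj₁ refl = as , arc , inj₂ (lt , leq)
      ... | as , arc , inj₂ (lt′ , leq′) = as , arc , inj₂ (ℕP.<-trans lt′ lt , ℚP.≤-trans leq′ leq)

    LexLess : List (Fin n) → List (Fin n) → Set
    LexLess P P′ = (pathWeight (wt H) P < pathWeight (wt H) P′) ⊎
      (pathWeight (wt H) P′ ≡ pathWeight (wt H) P × length P ℕ.< length P′) ⊎
      (pathWeight (wt H) P′ ≡ pathWeight (wt H) P × length P′ ≡ length P × σSmaller σ P P′)

    ∉-arc : ∀ {m m′} → Unique (x ∷ m ++ [ y ]) → z ∈ m → z ∉ m′ → z ∉ x ∷ m′ ++ [ y ]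
    ∉-arc uq i ∉m (here refl) = Unique-splitAt [] uq .proj₂ .proj₁ (∈-++⁺ˡ i)
    ∉-arc {m = m} {m′} uq i ∉m (there j) with ∈-++⁻ m′ j
    ... | inj₁ k = ∉m k
    ... | inj₂ (here refl) = Unique-++⁻ m (AllPairs.tail uq) .proj₂ .proj₂ i (here refl)

    ∈-arc-inner : ∀ {m m′} → z ∈ x ∷ m ++ [ y ] → z ∉ x ∷ m′ ++ [ y ] → z ∈ m
    ∈-arc-inner (here refl) ∉arc = contradiction (here refl) ∉arc
    ∈-arc-inner {m = m} {m′} (there i) ∉arc with ∈-++⁻ m i
    ... | inj₁ k = k
    ... | inj₂ (here refl) = contradiction (there (∈-++⁺ʳ m′ (here refl))) ∉arc

    -- With equal weights and lengths, the interiors have the same size, which is positive because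
    -- the cycle has at least three vertices. They are disjoint, so their minima under the injective
    -- `σ` differ and decide.
    arcs-comparable : ∀ l r → Cyc I ¬K23 (x ∷ l ++ y ∷ r) → LexLess (x ∷ l ++ [ y ]) (x ∷ reverse r ++ [ y ]) ⊎
        LexLess (x ∷ reverse r ++ [ y ]) (x ∷ l ++ [ y ])
    arcs-comparable {x} {y} l r cyc@(three , cu , _) with ℚP.<-cmp (len x (l ++ [ y ])) (len x (reverse r ++ [ y ]))
    ... | tri< lt _ _ = inj₁ (inj₁ lt)
    ... | tri> _ _ gt = inj₂ (inj₁ gt)
    ... | tri≈ _ eq _ with ℕP.<-cmp (length (l ++ [ y ])) (length (reverse r ++ [ y ]))
    ... | tri< lt _ _ = inj₁ (inj₂ (inj₁ (sym eq , s≤s lt)))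
    ... | tri> _ _ gt = inj₂ (inj₂ (inj₁ (eq , s≤s gt)))
    ... | tri≈ _ leq _ = Sum.map (λ s → inj₂ (inj₂ (sym eq , cong suc (sym leq) , s))) (λ s →
        inj₂ (inj₂ (eq , cong suc leq , s)))
        (by-σ l r lengths (λ { refl refl → absurd three }) apart first-unique second-unique)
      where
      open Arcs (arcs I ¬K23 l r cyc)
      absurd : ¬ 3 ℕ.≤ 2
      absurd (s≤s (s≤s ()))
      lengths : length l ≡ length r
      lengths = ℕP.+-cancelʳ-≡ 1 (length l) (length r)
          (trans (sym (length-++ l)) (trans leq (trans (length-++ (reverse r)) (cong (ℕ._+ 1) (length-reverse r)))))
      by-σ : ∀ l r → length l ≡ length r → (l ≡ [] → r ≡ [] → ⊥) → (∀ {a} → a ∈ l → a ∉ r) → Unique (x ∷ l ++ [ y ]) →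
          Unique (x ∷ reverse r ++ [ y ]) →
        σSmaller σ (x ∷ l ++ [ y ]) (x ∷ reverse r ++ [ y ]) ⊎ σSmaller σ (x ∷ reverse r ++ [ y ]) (x ∷ l ++ [ y ])
      by-σ [] [] _ ne _ _ _ = ⊥-elim (ne refl refl)
      by-σ l@(p ∷ l′) r@(q ∷ r′) _ _ disj u₁ u₂ with minimiser (σℕ σ) p l′ | minimiser (σℕ σ) q r′
      ... | z , z∈ , zmin | z′ , z′∈ , z′min with ℕP.<-cmp (σℕ σ z) (σℕ σ z′)
      ... | tri< lt _ _ = inj₁ (z , there (∈-++⁺ˡ z∈) , ∉-arc u₁ z∈ (λ i → disj z∈ (AnyP.reverse⁻ i)) ,
            λ t i j → ℕP.<-≤-trans lt (z′min (AnyP.reverse⁻ (∈-arc-inner {m = reverse r} {m′ = l} i j))))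
      ... | tri≈ _ eq _ with σℕ-injective eq
      ... | refl = contradiction z′∈ (disj z∈)
      by-σ l@(p ∷ l′) r@(q ∷ r′) _ _ disj u₁ u₂ | z , z∈ , zmin | z′ , z′∈ , z′min | tri> _ _ gt =
        inj₂ (z′ , there (∈-++⁺ˡ (AnyP.reverse⁺ z′∈)) , ∉-arc u₂ (AnyP.reverse⁺ z′∈) (λ i → disj i z′∈) ,
            λ t i j → ℕP.<-≤-trans gt (zmin (∈-arc-inner {m = l} {m′ = reverse r} i j)))

    dominated-LexLess : length xs ℕ.< length ys → len x xs ≤ len x ys → LexLess (x ∷ xs) (x ∷ ys)
    dominated-LexLess {xs} {ys} {x} lt le with ℚP.<-cmp (len x xs) (len x ys)
    ... | tri< wlt _ _ = inj₁ wlt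
    ... | tri≈ _ eq _ = inj₂ (inj₁ (sym eq , s≤s lt))
    ... | tri> _ _ gt = contradiction (ℚP.<-≤-trans gt le) (ℚP.<-irrefl refl)

    -- Against a strictly longer list, a tie broken by `σ` is settled already by weight or by
    -- length, so no transitivity of the vertex comparison is called for.
    LexLess-dominated : LexLess (x ∷ xs) (x ∷ zs) → length zs ℕ.< length ys → len x zs ≤ len x ys → LexLess (x ∷ xs) (x ∷ ys)
    LexLess-dominated (inj₁ wlt) lt le = inj₁ (ℚP.<-≤-trans wlt le)
    LexLess-dominated (inj₂ (inj₁ (eq , s≤s lt′))) lt le =
        dominated-LexLess (ℕP.<-trans lt′ lt) (ℚP.≤-trans (ℚP.≤-reflexive (sym eq)) le)
    LexLess-dominated (inj₂ (inj₂ (eq , leq , _))) lt le =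
        dominated-LexLess (ℕP.≤-<-trans (ℕP.≤-reflexive (sym (ℕP.suc-injective leq))) lt)
            (ℚP.≤-trans (ℚP.≤-reflexive (sym eq)) le)

    lex-best : ∀ {as bs} → PathIn H x y (x ∷ as) → LexLess (x ∷ as) (x ∷ bs) →
      (∀ {ys} → Walk (E H) x ys y → Unique (x ∷ ys) → ∃ λ cs → (cs ≡ as ⊎ cs ≡ bs) ×
          (ys ≡ cs ⊎ (length cs ℕ.< length ys × len x cs ≤ len x ys))) →
      IsLexShortest σ H x y (x ∷ as)
    lex-best {x} {y} {as} {bs} path less dom = path , beats
      where
      beats : ∀ P′ → PathIn H x y P′ → P′ ≢ x ∷ as → LexLess (x ∷ as) P′
      beats P′ path′ P′≢ with path-walk path′
      ... | ys , refl , wk , uq , _ with dom wk uq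
      ... | _ , inj₁ refl , inj₁ refl = contradiction refl P′≢
      ... | _ , inj₂ refl , inj₁ refl = less
      ... | _ , inj₁ refl , inj₂ (lt , le) = dominated-LexLess lt le
      ... | _ , inj₂ refl , inj₂ (lt , le) = LexLess-dominated less lt le

    lex-arc : (∀ x y → Dec (E H x y)) → ∀ l r → Cyc I ¬K23 (x ∷ l ++ y ∷ r) → Induced (E H) (x ∷ l ++ y ∷ r) →
      ∃ λ P → IsLexShortest σ H x y P × PathInCycle σ P (x ∷ l ++ y ∷ r)
    lex-arc {x} {y} E? l r cyc ind with arcs-comparable l r cyc
    ... | inj₁ less = _ , lex-best (path-in I ¬K23 first-walk first-unique ends) less (arc-dominates E? l r cyc ind) ,
        All.map inj₁ (walk-All first-edges)
      where open Arcs (arcs I ¬K23 l r cyc)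
    ... | inj₂ less = _ , lex-best (path-in I ¬K23 second-walk second-unique ends) less
            (λ wk uq → let cs , arc , d = arc-dominates E? l r cyc ind wk uq in cs , Sum.swap arc , d) , All.map inj₂ (walk-All second-edges)
      where open Arcs (arcs I ¬K23 l r cyc)

    Induced-InLSC : (∀ x y → Dec (E H x y)) → Cyc I ¬K23 C → Induced (E H) C → InLSC σ H C
    Induced-InLSC {C} E? cyc ind = cyc , lsc
      where
      lsc : ∀ x y → x ∈ C → y ∈ C → x ≢ y → ∃ λ P → IsLexShortest σ H x y P × PathInCycle σ P C
      lsc x y x∈ y∈ x≢y with cycle-at cyc x∈
      ... | s , cyc′ , C↭ , E↭ with ∈-resp-↭ C↭ y∈
      ... | here refl = contradiction refl x≢y
      ... | there y∈′ with ∈-∃++ y∈′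
      ... | l , r , refl with lex-arc E? l r cyc′ (Induced-↭ {C = C} {x ∷ l ++ y ∷ r} {E H} C↭ E↭ ind)
      ... | P , lex , inC = P , lex , All.map (Sum.map (∈-resp-↭ (↭-sym E↭)) (∈-resp-↭ (↭-sym E↭))) inC

    chord-or-Induced : (∀ x y → Dec (E H x y)) → ∀ C →
        (∃ λ x → ∃ λ y → x ∈ C × y ∈ C × E H x y × ¬ (x , y) ∈ₛ cycEdges C) ⊎ Induced (E H) C
    chord-or-Induced E? C with Any.any? (λ x →
        Any.any? (λ y → E? x y ×-dec ¬? (Any.any? (λ e → same? e (x , y)) (cycEdges C))) C) C
    ... | yes i with find i
    ... | x , x∈ , j with find j
    ... | y , y∈ , xy , ∉ = inj₁ (x , y , x∈ , y∈ , xy , λ k → let e , l , s = ∈ₛ⇒Same k in ∉ (lose l s))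
    chord-or-Induced E? C | no ¬i = inj₂ ind
      where
      ind : Induced (E H) C
      ind {x} {y} x∈ y∈ xy with Any.any? (λ e → same? e (x , y)) (cycEdges C)
      ... | yes k = let e , l , s = find k in Same⇒∈ₛ s l
      ... | no ∉ = contradiction (lose x∈ (lose y∈ (xy , ∉))) ¬i

    module _ {Cs : List (List (Fin n))} (enum : EnumeratesLSC σ H Cs) where

      expandedCycles : List (List (Fin n))
      expandedCycles = map (ex H) Cs

      induced-span : (∀ x y → Dec (E H x y)) → Cyc I ¬K23 C → Induced (E H) C →
          Span w expandedCycles (len′ C) (incidence (exps H (cycEdges C)))
      induced-span {C} E? cyc ind with find (enum .proj₂ .proj₂ C (Induced-InLSC E? cyc ind))
      ... | D , D∈ , same = member (∈-map⁺ (ex H) D∈)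
            (ℚP.≤-trans (ℚP.≤-reflexive (ex-cycleWeight {C = D} cycD))
              (weight-⊆ wt-sym wt-nonneg (cyc .proj₂ .proj₂ .proj₂) (cycEdges-Distinct cycD) (λ i →
                  SameCycle-∈ₛ {C = D} {D = C} cycD (λ a b → sym (same a b)) (inj₁ i))))
            (λ a b → trans (incidence-exps-cong (cyc .proj₂ .proj₂ .proj₂) (cycD .proj₂ .proj₂ .proj₂) same a b)
                (sym (ex-cycleVec {C = D} cycD a b)))
        where
        cycD = All.lookup (enum .proj₁) D∈ .proj₁

      span-cycle-leaf : (∀ x y → Dec (E H x y)) → Spans H expandedCycles
      span-cycle-leaf E? C = go (length C) C ℕP.≤-refl
        where
        go : ∀ k C → length C ℕ.≤ k → Cyc I ¬K23 C → Span w expandedCycles (len′ C) (incidence (exps H (cycEdges C)))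
        go k C le cyc with chord-or-Induced E? C
        ... | inj₂ ind = induced-span E? cyc ind
        ... | inj₁ (x , y , x∈ , y∈ , xy , ∉) with cycle-at cyc x∈
        ... | s , cyc′ , C↭ , E↭ with ∈-resp-↭ C↭ y∈
        ... | here refl = contradiction xy E-irr
        ... | there y∈′ with ∈-∃++ y∈′
        ... | l , r , refl = Span-cong (incidence-↭ (exps-↭ H (↭-sym E↭)))
            (Span-mono id (ℚP.≤-reflexive (weight-↭ (↭-sym E↭)))
                (split k l r (subst (ℕ._≤ k) (↭-length C↭) le) cyc′ (∉ ∘ ∈ₛ-⊆ (∈-resp-↭ (↭-sym E↭)))))
          where
          split : ∀ k l r → length (x ∷ l ++ y ∷ r) ℕ.≤ k → Cyc I ¬K23 (x ∷ l ++ y ∷ r) →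
              ¬ (x , y) ∈ₛ cycEdges (x ∷ l ++ y ∷ r) →
            Span w expandedCycles (len′ (x ∷ l ++ y ∷ r)) (incidence (exps H (cycEdges (x ∷ l ++ y ∷ r))))
          -- An empty side would make `xy` an edge of the cycle. With both sides nonempty, the two
          -- pieces are cycles with fewer vertices.
          split k [] r le cyc ∉ = contradiction (inj₁ (here refl)) ∉
          split k l@(_ ∷ _) [] le cyc ∉ = contradiction
              (inj₂ (subst ((y , x) ∈_) (sym (cycEdges-arcs I ¬K23 x l y [])) (∈-++⁺ʳ (steps x (l ++ [ y ])) (here refl)))) ∉
          split (suc k) l@(p ∷ l′) r@(q ∷ r′) (s≤s le) cyc@(_ , uq , vs , es) ∉ =
            add (Span-mono id w₁ (go k (x ∷ l ++ [ y ]) len₁ cyc₁)) (Span-mono id w₂ (go k (y ∷ r ++ [ x ]) len₂ cyc₂)) vec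
            where
            a₁ = steps x (l ++ [ y ])
            a₂ = steps y (r ++ [ x ])
            whole : cycEdges (x ∷ l ++ y ∷ r) ≡ a₁ ++ a₂
            whole = cycEdges-arcs I ¬K23 x l y r
            part₁ : cycEdges (x ∷ l ++ [ y ]) ≡ a₁ ++ [ (y , x) ]
            part₁ = steps-++ (plain x l y) [ x ]
            part₂ : cycEdges (y ∷ r ++ [ x ]) ≡ a₂ ++ [ (x , y) ]
            part₂ = steps-++ (plain y r x) [ y ]
            Ea = subst (All (uncurry (E H))) whole es
            E₁ = AllP.++⁻ˡ a₁ Ea
            E₂ = AllP.++⁻ʳ a₁ Ea
            cyc₁ : Cyc I ¬K23 (x ∷ l ++ [ y ])
            cyc₁ = s≤s (s≤s (ℕP.≤-trans (ℕP.m≤n+m 1 (length l′)) (ℕP.≤-reflexive (sym (length-++ l′))))) ,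
              Unique-++⁻ (x ∷ l ++ [ y ]) (subst (λ t → Unique (x ∷ t)) (sym (++-assoc l [ y ] r)) uq) .proj₁ ,
              AllP.++⁻ˡ (x ∷ l ++ [ y ]) (subst (λ t → All (V H) (x ∷ t)) (sym (++-assoc l [ y ] r)) vs) ,
              subst (All (uncurry (E H))) (sym part₁) (AllP.++⁺ E₁ (E-sym xy ∷ []))
            rot : y ∷ r ++ [ x ] ↭ x ∷ y ∷ r
            rot = PermP.++-comm (y ∷ r) [ x ]
            cyc₂ : Cyc I ¬K23 (y ∷ r ++ [ x ])
            cyc₂ = s≤s (s≤s (ℕP.≤-trans (ℕP.m≤n+m 1 (length r′)) (ℕP.≤-reflexive (sym (length-++ r′))))) ,
              Unique-↭ (↭-sym rot) (AllP.++⁻ʳ l (AllPairs.head uq) ∷ Unique-++⁻ (x ∷ l) uq .proj₂ .proj₁) ,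
              All-resp-↭ (↭-sym rot) (All.head vs ∷ AllP.++⁻ʳ (x ∷ l) vs) ,
              subst (All (uncurry (E H))) (sym part₂) (AllP.++⁺ E₂ (xy ∷ []))
            len₁ : length (x ∷ l ++ [ y ]) ℕ.≤ k
            len₁ = ℕP.≤-trans (ℕP.m≤m+n _ (length r′)) (ℕP.≤-trans (ℕP.≤-reflexive (trans (sym (length-++ (x ∷ l ++ [ y ])))
              (trans (cong length (++-assoc (x ∷ l) [ y ] r′))
                  (trans (length-++ (x ∷ l)) (trans (sym (ℕP.+-suc (length l) _)) (sym (length-++ l))))))) le)
            len₂ : length (y ∷ r ++ [ x ]) ℕ.≤ k
            len₂ = ℕP.≤-trans (ℕP.≤-reflexive (↭-length rot))
                (ℕP.≤-trans (s≤s (ℕP.m≤n+m _ (length l′))) (ℕP.≤-trans (ℕP.≤-reflexive (sym (length-++ l))) le))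
            closing : ∀ {e} es → uncurry (wt H) e ≤ weight (wt H) es → ∀ fs {gs} → gs ≡ fs ++ [ e ] →
              weight (wt H) gs ≤ weight (wt H) fs + weight (wt H) es
            closing {e} es le fs refl = ℚP.≤-trans (ℚP.≤-reflexive (weight-++ fs [ e ]))
                (ℚP.+-monoʳ-≤ (weight (wt H) fs) (ℚP.≤-trans (ℚP.≤-reflexive (ℚP.+-identityʳ (uncurry (wt H) e))) le))
            sum : weight (wt H) (cycEdges (x ∷ l ++ y ∷ r)) ≡ weight (wt H) a₁ + weight (wt H) a₂
            sum = trans (cong (weight (wt H)) whole) (weight-++ {wt = wt H} a₁ a₂)
            w₁ : len′ (x ∷ l ++ [ y ]) ≤ len′ (x ∷ l ++ y ∷ r)
            w₁ = ℚP.≤-trans (closing a₂ (no-long (E-sym xy) (All-walk r E₂)) a₁ part₁) (ℚP.≤-reflexive (sym sum))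
            w₂ : len′ (y ∷ r ++ [ x ]) ≤ len′ (x ∷ l ++ y ∷ r)
            w₂ = ℚP.≤-trans (closing a₁ (no-long xy (All-walk l E₁)) a₂ part₂)
                (ℚP.≤-reflexive (trans (ℚP.+-comm (weight (wt H) a₂) (weight (wt H) a₁)) (sym sum)))
            vec : incidence (exps H (cycEdges (x ∷ l ++ y ∷ r))) ≈ incidence
                (exps H (cycEdges (x ∷ l ++ [ y ]))) ⊕ incidence (exps H (cycEdges (y ∷ r ++ [ x ])))
            -- The chord is traversed once in each direction; the two expansions have the same
            -- vector and cancel.
            vec a b = trans (part a₁ a₂ whole) (trans (xor-insert (i a₁) (i a₂) (i [ (x , y) ]))
              (cong₂ _xor_ (trans (cong (i a₁ xor_) (sym (exps-flip (xy ∷ []) a b)))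
                  (sym (part a₁ [ (y , x) ] part₁))) (sym (part a₂ [ (x , y) ] part₂))))
              where
              i : List (Edge n) → Bool
              i es = incidence (exps H es) a b
              part : ∀ {gs} es fs → gs ≡ es ++ fs → i gs ≡ i es xor i fs
              part es fs refl = trans (cong (λ t → incidence t a b) (exps-++ H es fs))
                  (incidence-++ (exps H es) (exps H fs) a b)

  -- Independence of the lex short cycles of a final part

  module _ {H : Part n} (I : Inv H) (¬K23 : ¬ HasK23 H) where
    open Inv I
    open InvProperties I

    module _ {Cs : List (List (Fin n))} (enum : EnumeratesLSC σ H Cs) where

      leaf-cycle : ∀ {C} → C ∈ Cs → IsCycle (V H) (E H) C
      leaf-cycle i = All.lookup (enum .proj₁) i .proj₁

      -- Among the selected cycles, only one passes through the vertex
      -- eliminated first.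
      no-relation : ∀ Ss → (∀ {C} → C ∈ Ss → C ∈ Cs) → AllPairs (λ C D → ¬ SameCycle C D) Ss → Ss ≢ [] →
        ¬ (∀ a b → xorSum (λ C → cycleVec (ex H C) a b) Ss ≡ false)
      no-relation [] sub ap ne zero-sum = ne refl
      no-relation ([] ∷ Ss) sub ap ne zero-sum with leaf-cycle (sub (here refl))
      ... | () , _
      no-relation Ss@((c ∷ C₀) ∷ Ss′) sub ap ne zero-sum with minimiser ρ c (C₀ ++ concat Ss′)
      ... | z , z∈ , zmin with ∈-concat⁻′ Ss z∈
      ... | C , zC , C∈ with cycle-at (leaf-cycle (sub C∈)) zC
      -- At the first step `(z , g)` of the expansion of `zq`, the coefficient of an expanded cycle
      -- is that of the cycle at `zq`. It is 1 for `C`, and any other cycle with coefficient 1 would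
      -- pass through `z` and be the same as `C`.
      ... | s , cyc , C↭ , E↭ = go (walk-head (exp-walk zq) λ eq → E-irr (subst (E H z) (sym eq) zq))
        where
        q = Neighbours.next (neighbours I ¬K23 cyc)
        zq : E H z q
        zq = Neighbours.E-next (neighbours I ¬K23 cyc)
        zq∈ : (z , q) ∈ cycEdges C
        zq∈ = ∈-resp-↭ (↭-sym E↭) (subst (λ t → (z , q) ∈ cycEdges (z ∷ t))
            (sym (Neighbours.shape (neighbours I ¬K23 cyc))) (here refl))
        minimal : ∀ {D y} → D ∈ Ss → y ∈ D → ρ z ℕ.≤ ρ y
        minimal D∈ y∈ = zmin (∈-concat⁺′ y∈ D∈)
        ind : ∀ {D} → D ∈ Ss → Induced (E H) D
        ind D∈ = InLSC-Induced I ¬K23 (All.lookup (enum .proj₁) (sub D∈))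
        same : ∀ {C D} → C ∈ Ss → D ∈ Ss → z ∈ C → z ∈ D → SameCycle C D
        same {C} {D} C∈ D∈ zC zD = Induced-SameCycle I ¬K23 cC cD (ind C∈) (ind D∈)
          (cycles-at-minimum-⊆ I ¬K23 cD cC (ind C∈) zD zC (minimal D∈) (minimal C∈))
          (cycles-at-minimum-⊆ I ¬K23 cC cD (ind D∈) zC zD (minimal C∈) (minimal D∈))
          where
          cC = leaf-cycle (sub C∈)
          cD = leaf-cycle (sub D∈)
        go : (∃ λ g → ∃ λ t → expTail H z q ≡ g ∷ t) → ⊥
        go (g , _ , eq) = false≢true (trans (sym (zero-sum z g))
            (xorSum-single {_~_ = SameCycle} (λ D → cycleVec (ex H D) z g) ap C∈
            (trans (reading C∈) (cycleVec-true {C = C} (leaf-cycle (sub C∈)) (inj₁ zq∈)))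
            (λ {D} D∈ t → let zD = on-cycle {D} (incidence-true (cycEdges D) (trans (sym (reading D∈)) t)) in same C∈ D∈ zC zD , same D∈ C∈ zD zC)))
          where
          reading : ∀ {D} → D ∈ Ss → cycleVec (ex H D) z g ≡ cycleVec D z q
          reading {D} D∈ = trans (ex-cycleVec {C = D} (leaf-cycle (sub D∈)) z g)
            (incidence-exps (leaf-cycle (sub D∈) .proj₂ .proj₂ .proj₂) zq
                (subst (λ l → (z , g) ∈ pairs l) (sym (trans (exp-tail zq) (cong (z ∷_) eq))) (here refl)))
          on-cycle : ∀ {D} → (z , q) ∈ₛ cycEdges D → z ∈ D
          on-cycle {D} (inj₁ i) = cycEdges-∈ {C = D} i .proj₁
          on-cycle {D} (inj₂ i) = cycEdges-∈ {C = D} i .proj₂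

      leaf-independent : Independent (map cycleVec (map (ex H) Cs))
      leaf-independent cs len zero-sum with selected cs Cs in eq
      ... | [] = selected-[] cs Cs (trans len (trans (length-map cycleVec (map (ex H) Cs)) (length-map (ex H) Cs))) eq
      ... | S ∷ Ss = ⊥-elim (no-relation (S ∷ Ss) (All.lookup (subst (All (_∈ Cs)) eq (selected-All cs (All.tabulate id))))
              (subst (AllPairs _) eq (selected-AllPairs cs (enum .proj₂ .proj₁))) (λ ())
              λ a b → trans (cong (xorSum (λ C → cycleVec (ex H C) a b)) (sym eq))
                (trans (sym (lincomb-selected (cycleVec ∘ ex H) cs Cs a b))
                    (trans (cong (λ vs → lincomb cs vs a b) (map-∘ Cs)) (zero-sum a b))))

      leaf-Result : Result H [ H ] (map (ex H) Cs)
      leaf-Result = record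
        { cycles = AllP.map⁺ (All.tabulate (λ {C} i → ex-IsCycle {C = C} (leaf-cycle i)))
        ; support = supp
        ; independent = leaf-independent
        ; spans = λ { (E? ∷ []) → span-cycle-leaf I ¬K23 enum E? } }
        where
        supp : ∀ {C a b} → C ∈ map (ex H) Cs → cycleVec C a b ≡ true → Supp H a b
        supp {a = a} {b} i t with ∈-map⁻ (ex H) i
        ... | D , D∈ , refl = Supp-ₛ {es = cycEdges D}
            (incidence-true (exps H (cycEdges D)) (trans (sym (ex-cycleVec {C = D} (leaf-cycle D∈) a b)) t))
              (leaf-cycle D∈ .proj₂ .proj₂ .proj₂)

  -- Recursion along the decomposition

  record Branching (H : Part n) (u v : Fin n) : Set where
    field
      u≢v : u ≢ v
      Vu : V H u
      Vv : V H v
      Auv : A u v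

  branching : ∀ {H u v} → Inv H → K23Branch H u v → Branching H u v
  branching {H} {u} {v} I (u≢v , m₁ , m₂ , m₃ , _ , _ , _ , (_ , u₁ , vs , w₁) , (_ , u₂ , _ , w₂) ,
      (_ , u₃ , _ , w₃) , d₁₂ , d₁₃ , d₂₃) = record
    { u≢v = u≢v
    ; Vu = All.head vs
    ; Vv = All.lookup vs (there (∈-++⁺ʳ m₁ (here refl)))
    ; Auv = EliminationProperties.three-paths el u≢v (tree m₁ w₁) u₁ (tree m₂ w₂) u₂ (tree m₃ w₃) u₃ (All.lookup d₁₂)
        (All.lookup d₂₃) (All.lookup d₁₃) }
    where
    tree : ∀ m → IsWalk (E H) (u ∷ m ++ [ v ]) → Walk A u (m ++ [ v ]) v
    tree m wk = walk-map (Inv.E-A I) (All-walk m wk)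

  edge-Split : ∀ {H u v} (I : Inv H) → Branching H u v → E H u v →
      Split H u v (expTail H u v) (weight (wt H) (steps u [ v ]))
  edge-Split {H} {u} {v} I br uv = record
    { u≢v = u≢v ; Vu = Vu ; Vv = Vv
    ; p-unique = exp-unique′ uv
    ; p-supp = λ i → Supp-ₛ {es = [ (u , v) ]}
        (subst (_ ∈ₛ_) (sym (trans (++-identityʳ (pairs (exp H u v))) (exp-pairs uv))) i) (uv ∷ [])
    ; p-edge = exp-tail
    ; ws-min = λ wk → ℚP.≤-trans (ℚP.≤-reflexive (ℚP.+-identityʳ (wt H u v))) (no-long uv wk) }
    where
    open Inv I
    open InvProperties I
    open Branching br

  edge-Child : ∀ {H u v} (I : Inv H) → Branching H u v → E H u v → ∀ r →
      Child H u v r (expTail H u v) (weight (wt H) (steps u [ v ])) (inducedPart H u v r)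
  edge-Child {H} {u} {v} I br uv r = induced-Child I u v r Vu Vv ((uv , inj₂ (inj₁ refl) , inj₂ (inj₂ refl)) ∷ [])
    (λ a b → cong (λ l → incidence l a b) (trans (++-identityʳ (pairs (exp H u v))) (InvProperties.exp-pairs I uv))) refl
    where open Branching br

  module ShortPath {H : Part n} (I : Inv H) {u v : Fin n} (br : Branching H u v) (¬uv : ¬ E H u v) {s : List (Fin n)}
    (sw : Walk (E H) u s v) (su : Unique (u ∷ s)) (s-min : ∀ {ys} → Walk (E H) u ys v →
        weight (wt H) (steps u s) ≤ weight (wt H) (steps u ys)) where
    open Inv I
    open InvProperties I
    open Branching br

    short-Split : Split H u v (expandTail H u s) (weight (wt H) (steps u s))
    short-Split = record
      { u≢v = u≢v ; Vu = Vu ; Vv = Vv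
      ; p-unique = expand-unique sw Vu su
      ; p-supp = λ i → Supp-ₛ {es = steps u s} (subst (_ ∈ₛ_) (expand-steps sw) i) (walk-All sw)
      ; p-edge = λ uv → contradiction uv ¬uv
      ; ws-min = s-min }

    inside-Child : ∀ r → All (compV H u v r) (u ∷ s) →
        Child H u v r (expandTail H u s) (weight (wt H) (steps u s)) (inducedPart H u v r)
    inside-Child r ins = induced-Child I u v r Vu Vv (lift sw ins) (λ a b →
        cong (λ l → incidence l a b) (sym (expand-steps sw))) refl
      where
      lift : Walk (E H) x ys z → All (compV H u v r) (x ∷ ys) → Walk (E (inducedPart H u v r)) x ys z
      lift [] _ = []
      lift (q ∷ qs) (c ∷ cs@(d ∷ _)) = (q , c , d) ∷ lift qs cs

    outside-Child : ∀ r → ¬ All (compV H u v r) (u ∷ s) →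
        Child H u v r (expandTail H u s) (weight (wt H) (steps u s)) (greenPart H u v r (u ∷ s))
    outside-Child r out = Green.green-Child I u v r s u≢v Auv ¬uv sw su s-min out

  short-min : ∀ {H u v s} (I : Inv H) → u ≢ v → IsShortestPath (V H) (E H) (wt H) u v (u ∷ s) →
    ∀ {ys} → Walk (E H) u ys v → weight (wt H) (steps u s) ≤ weight (wt H) (steps u ys)
  short-min {u = u} I u≢v (_ , best) wk with walk-to-path (Inv.wt-nonneg I) wk
  ... | _ , wk′ , uq , le = ℚP.≤-trans (best _ (Component.walk-path I u u wk′ uq u≢v)) le

  decomp-Result : ∀ {H Gs Css} → Inv H → Decomp H Gs → Pointwise (EnumeratesLSC σ) Gs Css → Result H Gs (exAll Gs Css)
  edge-Kids : ∀ {H u v reps res Css} (I : Inv H) → Branching H u v → E H u v →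
    Pointwise (λ r out → Decomp (inducedPart H u v r) out) reps res → Pointwise (EnumeratesLSC σ) (concat res) Css →
    Kids H u v (expTail H u v) (weight (wt H) (steps u [ v ])) reps (concat res) (exAll (concat res) Css)
  short-Kids : ∀ {H u v reps res Css s} (I : Inv H) (br : Branching H u v) (¬uv : ¬ E H u v) (sw : Walk (E H) u s v)
      (su : Unique (u ∷ s))
    (s-min : ∀ {ys} → Walk (E H) u ys v → weight (wt H) (steps u s) ≤ weight (wt H) (steps u ys)) →
    Pointwise (λ r out → (All (compV H u v r) (u ∷ s) × Decomp (inducedPart H u v r) out) ⊎
                         (¬ All (compV H u v r) (u ∷ s) × Decomp (greenPart H u v r (u ∷ s)) out)) reps res →
    Pointwise (EnumeratesLSC σ) (concat res) Css →
    Kids H u v (expandTail H u s) (weight (wt H) (steps u s)) reps (concat res) (exAll (concat res) Css)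

  decomp-Result {H} I (done ¬K23) (_∷_ {y = Cs} enum []) =
      subst (Result H [ H ]) (sym (++-identityʳ (map (ex H) Cs))) (leaf-Result I ¬K23 enum)
  decomp-Result I (stepEdge k23 uv rp pw) enums =
    let br = branching I k23 in combine I (edge-Split I br uv) rp (edge-Kids I br uv pw enums)
  decomp-Result I (stepNoEdge k23 ¬uv rp short pw) enums with path-walk (short .proj₁)
  ... | s , refl , sw , su , _ = let br = branching I k23 ; s-min = short-min I (Branching.u≢v br) short in
    combine I (ShortPath.short-Split I br ¬uv sw su s-min) rp (short-Kids I br ¬uv sw su s-min pw enums)

  edge-Kids I br uv [] [] = []
  edge-Kids {H} {u} {v} I br uv (_∷_ {x = r} {y = out} d ds) enums with Pointwise-++⁻ out enums
  ... | _ , _ , refl , qs , rs = subst (Kids H u v _ _ _ _) (sym (exAll-++ qs))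
    ((_ , ch , decomp-Result (Child.inv ch) d qs) ∷ edge-Kids I br uv ds rs)
    where ch = edge-Child I br uv r

  short-Kids I br ¬uv sw su s-min [] [] = []
  short-Kids {H} {u} {v} I br ¬uv sw su s-min (_∷_ {x = r} {y = out} (inj₁ (ins , d)) ds) enums with Pointwise-++⁻ out enums
  ... | _ , _ , refl , qs , rs = subst (Kids H u v _ _ _ _) (sym (exAll-++ qs))
    ((_ , ch , decomp-Result (Child.inv ch) d qs) ∷ short-Kids I br ¬uv sw su s-min ds rs)
    where ch = ShortPath.inside-Child I br ¬uv sw su s-min r ins
  short-Kids {H} {u} {v} I br ¬uv sw su s-min (_∷_ {x = r} {y = out} (inj₂ (¬ins , d)) ds) enums with Pointwise-++⁻ out enums
  ... | _ , _ , refl , qs , rs = subst (Kids H u v _ _ _ _) (sym (exAll-++ qs))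
    ((_ , ch , decomp-Result (Child.inv ch) d qs) ∷ short-Kids I br ¬uv sw su s-min ds rs)
    where ch = ShortPath.outside-Child I br ¬uv sw su s-min r ¬ins

-- Weighted basis exchange

-- A coefficient vector indexed by the list itself, so that sums and pairings need no side
-- conditions on lengths.
Coefs : List X → Set
Coefs = All (λ _ → Bool)

zeros : (B : List X) → Coefs B
zeros [] = []
zeros (x ∷ B) = false ∷ zeros B

AllFalse : {B : List X} → Coefs B → Set
AllFalse [] = ⊤
AllFalse (c ∷ cs) = c ≡ false × AllFalse cs

infixl 6 _+ᶜ_
_+ᶜ_ : {B : List X} → Coefs B → Coefs B → Coefs B
[] +ᶜ [] = []
(c ∷ cs) +ᶜ (d ∷ ds) = (c xor d) ∷ cs +ᶜ ds

dot : {B : List X} → Coefs B → Coefs B → Bool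
dot [] [] = false
dot (f ∷ fs) (c ∷ cs) = (f ∧ c) xor dot fs cs

xor-interchange : ∀ a b c d → (a xor b) xor (c xor d) ≡ (a xor c) xor (b xor d)
xor-interchange a b c d = trans (xor-assoc a b (c xor d))
    (trans (cong (a xor_) (xor-swap b c d)) (sym (xor-assoc a c (b xor d))))

dot-+ᶜ : {B : List X} (f c d : Coefs B) → dot f (c +ᶜ d) ≡ dot f c xor dot f d
dot-+ᶜ [] [] [] = refl
dot-+ᶜ (f ∷ fs) (c ∷ cs) (d ∷ ds) = trans (cong₂ _xor_ (∧-distribˡ-xor f c d) (dot-+ᶜ fs cs ds))
    (xor-interchange (f ∧ c) (f ∧ d) _ _)

dot-AllFalse : {B : List X} (f c : Coefs B) → AllFalse c → dot f c ≡ false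
dot-AllFalse [] [] _ = refl
dot-AllFalse (f ∷ fs) (c ∷ cs) (refl , z) = cong₂ _xor_ (∧-zeroʳ f) (dot-AllFalse fs cs z)

zeros-AllFalse : (B : List X) → AllFalse (zeros B)
zeros-AllFalse [] = tt
zeros-AllFalse (x ∷ B) = refl , zeros-AllFalse B

dot-zerosˡ : {B : List X} (c : Coefs B) → dot (zeros B) c ≡ false
dot-zerosˡ [] = refl
dot-zerosˡ (c ∷ cs) = dot-zerosˡ cs

dot-nondegenerate : {B : List X} (f : Coefs B) → (∀ c → dot f c ≡ false) → AllFalse f
dot-nondegenerate [] h = tt
dot-nondegenerate {B = x ∷ B} (f ∷ fs) h =
  trans (sym (trans (cong₂ _xor_ (∧-identityʳ f) (dot-AllFalse fs (zeros B) (zeros-AllFalse B))) (xor-identityʳ f)))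
      (h (true ∷ zeros B)) ,
  dot-nondegenerate fs λ c → trans (cong (_xor dot fs c) (sym (∧-zeroʳ f))) (h (false ∷ c))

module Exchange {X : Set} (ω : X → ℚ) where

  Bounded : ℚ → {B : List X} → Coefs B → Set
  Bounded t [] = ⊤
  Bounded t {x ∷ B} (c ∷ cs) = (c ≡ true → ω x ≤ t) × Bounded t cs

  bounded-+ᶜ : ∀ {t t′} {B : List X} (c d : Coefs B) → t′ ≤ t → Bounded t c → Bounded t′ d → Bounded t (c +ᶜ d)
  bounded-+ᶜ [] [] le _ _ = tt
  bounded-+ᶜ (true ∷ cs) (d ∷ ds) le (p , ps) (q , qs) = (λ _ → p refl) , bounded-+ᶜ cs ds le ps qs
  bounded-+ᶜ (false ∷ cs) (d ∷ ds) le (p , ps) (q , qs) = (λ eq → ℚP.≤-trans (q eq) le) , bounded-+ᶜ cs ds le ps qs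

  bounded-zeros : ∀ t (B : List X) → Bounded t (zeros B)
  bounded-zeros t [] = tt
  bounded-zeros t (x ∷ B) = (λ ()) , bounded-zeros t B

  leading : {x : X} {B : List X} → Coefs (x ∷ B) → Bool
  leading (c ∷ _) = c

  pivot : {x : X} {B : List X} (rows : List (Coefs (x ∷ B) × ℚ)) → All (λ row → leading (proj₁ row) ≡ false) rows ⊎
    (∃ λ p → ∃ λ rest → rows ↭ p ∷ rest × leading (proj₁ p) ≡ true ×
        All (λ q → leading (proj₁ q) ≡ true → proj₂ p ≤ proj₂ q) rest)
  pivot [] = inj₁ []
  pivot (row@(false ∷ _ , _) ∷ rows) with pivot rows
  ... | inj₁ ps = inj₁ (refl ∷ ps)
  ... | inj₂ (p , rest , perm , lead , least) =
      inj₂ (p , row ∷ rest , ↭-trans (prep row perm) (Perm.swap row p Perm.refl) , lead , (λ ()) ∷ least)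
  pivot (row@(true ∷ _ , t) ∷ rows) with pivot rows
  ... | inj₁ ps = inj₂ (row , rows , Perm.refl , refl ,
      All.map (λ eq eq′ → contradiction (trans (sym eq) eq′) false≢true) ps)
  ... | inj₂ (p , rest , perm , lead , least) with t ℚP.≤? proj₂ p
  ... | yes le = inj₂ (row , p ∷ rest , prep row perm , refl , (λ _ → le) ∷ All.map (λ f eq → ℚP.≤-trans le (f eq)) least)
  ... | no ≰ = inj₂ (p , row ∷ rest , ↭-trans (prep row perm) (Perm.swap row p Perm.refl) , lead ,
      (λ _ → ℚP.<⇒≤ (ℚP.≰⇒> ≰)) ∷ least)

  reduce : {x : X} {B : List X} → Coefs B → Coefs (x ∷ B) × ℚ → Coefs B × ℚ
  reduce pc (true ∷ c , t) = c +ᶜ pc , t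
  reduce pc (false ∷ c , t) = c , t

  -- Gaussian elimination: pivoting on the lightest row with leading
  -- coefficient 1 keeps every row bounded by its own weight.
  exchange : ∀ (B : List X) (rows : List (Coefs B × ℚ)) →
      All (λ row → Bounded (proj₂ row) (proj₁ row) × 0ℚ ≤ proj₂ row) rows →
    (∀ f → All (λ row → dot f (proj₁ row) ≡ false) rows → AllFalse f) → sumℚ (map ω B) ≤ sumℚ (map proj₂ rows)
  exchange [] rows bd dual = nonneg bd
    where
    nonneg : ∀ {rows : List (Coefs [] × ℚ)} → All (λ row → Bounded (proj₂ row) (proj₁ row) × 0ℚ ≤ proj₂ row) rows →
        0ℚ ≤ sumℚ (map proj₂ rows)
    nonneg [] = ℚP.≤-refl
    nonneg ((_ , p) ∷ ps) = ℚP.≤-trans (nonneg ps) (≤-+ˡ p)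
  exchange (x ∷ B) rows bd dual with pivot rows
  -- `dual` expresses that the rows span: no nonzero functional annihilates all of them. If every
  -- leading coefficient were 0, the first coordinate would be such a functional.
  ... | inj₁ leads = contradiction (dual (true ∷ zeros B) (All.map (λ {row} → kill row) leads) .proj₁) λ ()
    where
    kill : ∀ row → leading (proj₁ row) ≡ false → dot (true ∷ zeros B) (proj₁ row) ≡ false
    kill (c ∷ cs , _) eq = cong₂ _xor_ eq (dot-zerosˡ cs)
  -- The pivot row has coefficient 1 at `x`, so its own bound yields `ω x ≤ tp`; the other rows pay
  -- for `B`.
  ... | inj₂ (((true ∷ pc) , tp) , rest , perm , refl , least) = ℚP.≤-trans
      (ℚP.+-mono-≤ (All.head bd′ .proj₁ .proj₁ refl)
          (exchange B (map (reduce pc) rest) (bounded-rest least (All.tail bd′)) dual′))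
      (ℚP.≤-reflexive (trans (cong (tp +_) (cong sumℚ (weights rest))) (sym (sumℚ-↭ (PermP.map⁺ proj₂ perm)))))
    where
    bd′ = All-resp-↭ perm bd
    weights : ∀ rest → map proj₂ (map (reduce pc) rest) ≡ map proj₂ rest
    weights [] = refl
    weights ((true ∷ _ , _) ∷ rest) = cong (_ ∷_) (weights rest)
    weights ((false ∷ _ , _) ∷ rest) = cong (_ ∷_) (weights rest)
    bounded-rest : ∀ {rest} → All (λ q → leading (proj₁ q) ≡ true → tp ≤ proj₂ q) rest →
        All (λ row → Bounded (proj₂ row) (proj₁ row) × 0ℚ ≤ proj₂ row) rest →
      All (λ row → Bounded (proj₂ row) (proj₁ row) × 0ℚ ≤ proj₂ row) (map (reduce pc) rest)
    bounded-rest [] [] = []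
    bounded-rest {(true ∷ c , t) ∷ rest} (le ∷ les) (((_ , p) , nn) ∷ ps) =
        (bounded-+ᶜ c pc (le refl) p (All.head bd′ .proj₁ .proj₂) , nn) ∷ bounded-rest les ps
    bounded-rest {(false ∷ c , t) ∷ rest} (le ∷ les) (((_ , p) , nn) ∷ ps) = (p , nn) ∷ bounded-rest les ps
    dual′ : ∀ f → All (λ row → dot f (proj₁ row) ≡ false) (map (reduce pc) rest) → AllFalse f
    -- The new first entry `dot f pc` is the one for which the extended functional annihilates the
    -- pivot row. On every other row it takes the value of `f` on the reduced row.
    dual′ f kills = dual (dot f pc ∷ f) (All-resp-↭ (↭-sym perm)
        (trans (cong (_xor dot f pc) (∧-identityʳ (dot f pc))) (xor-same (dot f pc)) ∷ extend′ rest kills)) .proj₂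
      where
      extend′ : ∀ rest → All (λ row → dot f (proj₁ row) ≡ false) (map (reduce pc) rest) →
          All (λ row → dot (dot f pc ∷ f) (proj₁ row) ≡ false) rest
      extend′ [] [] = []
      extend′ ((true ∷ c , t) ∷ rest) (k ∷ ks) =
          trans (cong (_xor dot f c) (∧-identityʳ (dot f pc)))
              (trans (xor-comm (dot f pc) (dot f c)) (trans (sym (dot-+ᶜ f c pc)) k)) ∷ extend′ rest ks
      extend′ ((false ∷ c , t) ∷ rest) (k ∷ ks) = trans (cong (_xor dot f c) (∧-zeroʳ (dot f pc))) k ∷ extend′ rest ks

-- From coefficient vectors to edge vectors

module _ (g : X → EdgeVec {n}) where

  combination : {B : List X} → Coefs B → EdgeVec {n}
  combination [] a b = false
  combination {B = x ∷ B} (c ∷ cs) a b = (c ∧ g x a b) xor combination cs a b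

  combination-+ᶜ : {B : List X} (c d : Coefs B) → combination (c +ᶜ d) ≈ combination c ⊕ combination d
  combination-+ᶜ [] [] a b = refl
  combination-+ᶜ {B = x ∷ B} (c ∷ cs) (d ∷ ds) a b =
      trans (cong₂ _xor_ (∧-distribʳ-xor (g x a b) c d) (combination-+ᶜ cs ds a b))
    (xor-interchange (c ∧ g x a b) (d ∧ g x a b) _ _)

  combination-zeros : ∀ B → combination (zeros B) ≈ 𝟘
  combination-zeros [] a b = refl
  combination-zeros (x ∷ B) a b = combination-zeros B a b

  coefList : {B : List X} → Coefs B → List Bool
  coefList [] = []
  coefList (c ∷ cs) = c ∷ coefList cs

  coefList-length : {B : List X} (c : Coefs B) → length (coefList c) ≡ length (map g B)
  coefList-length [] = refl
  coefList-length (c ∷ cs) = cong suc (coefList-length cs)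

  lincomb-coefList : {B : List X} (c : Coefs B) → lincomb (coefList c) (map g B) ≈ combination c
  lincomb-coefList [] a b = refl
  lincomb-coefList {B = x ∷ B} (c ∷ cs) a b = cong ((c ∧ g x a b) xor_) (lincomb-coefList cs a b)

  coefs-of : (B : List X) (cs : List Bool) → length cs ≡ length (map g B) → ∃ λ (c : Coefs B) → coefList c ≡ cs
  coefs-of [] [] len = [] , refl
  coefs-of (x ∷ B) (c ∷ cs) len = let d , eq = coefs-of B cs (ℕP.suc-injective len) in c ∷ d , cong (c ∷_) eq

  independent-coefs : {B : List X} → Independent (map g B) → (c : Coefs B) → combination c ≈ 𝟘 → AllFalse c
  independent-coefs ind c z = convert c
      (ind (coefList c) (coefList-length c) (λ a b → trans (lincomb-coefList c a b) (z a b)))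
    where
    convert : ∀ {B} (c : Coefs B) → All (_≡ false) (coefList c) → AllFalse c
    convert [] [] = tt
    convert (c ∷ cs) (p ∷ ps) = p , convert cs ps

  closed-combination : {P : EdgeVec {n} → Set} → P 𝟘 → (∀ {v v′ v″} → P v → P v′ → v″ ≈ v ⊕ v′ → P v″) →
    ∀ {B} → All (P ∘ g) B → (c : Coefs B) → P (combination c)
  closed-combination p0 p+ [] [] = p0
  closed-combination p0 p+ (p ∷ ps) (true ∷ cs) = p+ p (closed-combination p0 p+ ps cs) (λ _ _ → refl)
  closed-combination p0 p+ (p ∷ ps) (false ∷ cs) = p+ p0 (closed-combination p0 p+ ps cs) (λ _ _ → refl)

¬¬-All : ∀ {a p} {Y : Set a} {P : Y → Set p} {xs} → All (λ x → ¬ ¬ P x) xs → ¬ ¬ All P xs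
¬¬-All [] k = k []
¬¬-All (p ∷ ps) k = p λ q → ¬¬-All ps λ qs → k (q ∷ qs)

¬¬-Fin : ∀ {m} {P : Fin m → Set} → (∀ i → ¬ ¬ P i) → ¬ ¬ (∀ i → P i)
¬¬-Fin {zero} ps k = k λ ()
¬¬-Fin {suc m} ps k = ps zero λ p → ¬¬-Fin (ps ∘ suc) λ q → k λ { zero → p ; (suc i) → q i }

-- Minimality

module _ {n : ℕ} {G : Rel₀ n} {w : Fin n → Fin n → ℚ} where
  open Exchange (cycleWeight w)

  span-coefs : ∀ {B t v} → Span w B t v → ∃ λ (c : Coefs B) → combination cycleVec c ≈ v × Bounded t c
  span-coefs {B} {t} (zero z) = zeros B , (λ a b → trans (combination-zeros cycleVec B a b) (sym (z a b))) ,
      bounded-zeros t B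
  span-coefs {B} {t} (member i le eq) = let c , p , q = unit i le in c , (λ a b → trans (p a b) (sym (eq a b))) , q
    where
    unit : ∀ {B C} → C ∈ B → cycleWeight w C ≤ t → ∃ λ (c : Coefs B) → combination cycleVec c ≈ cycleVec C × Bounded t c
    unit {C ∷ B} (here refl) le = true ∷ zeros B ,
        (λ a b → trans (cong (cycleVec C a b xor_) (combination-zeros cycleVec B a b)) (xor-identityʳ _)) ,
            (λ _ → le) , bounded-zeros t B
    unit (there i) le = let c , p , q = unit i le in false ∷ c , p , (λ ()) , q
  span-coefs (add s s′ eq) with span-coefs s | span-coefs s′
  ... | c , p , q | c′ , p′ , q′ = c +ᶜ c′ ,
      (λ a b → trans (combination-+ᶜ cycleVec c c′ a b) (trans (cong₂ _xor_ (p a b) (p′ a b)) (sym (eq a b)))) ,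
    bounded-+ᶜ c c′ ℚP.≤-refl q q′

  dependent : {B : List (List (Fin n))} {C : List (Fin n)} → (c : Coefs B) → combination cycleVec c ≈ cycleVec C →
      ¬ Independent (map cycleVec (C ∷ B))
  dependent {B} {C} c eq ind = contradiction
      (independent-coefs cycleVec {B = C ∷ B} ind (true ∷ c) (λ a b →
          trans (cong (cycleVec C a b xor_) (eq a b)) (xor-same (cycleVec C a b))) .proj₁) λ ()

  -- Maximality of a basis only denies the independence of `C ∷ B`, so coefficients for `C` are
  -- obtained under a double negation: without them, every relation would have coefficient 0 at `C`.
  dependent⁻ : {B : List (List (Fin n))} {C : List (Fin n)} → Independent (map cycleVec B) →
      ¬ Independent (map cycleVec (C ∷ B)) → ¬ ¬ (∃ λ (c : Coefs B) → combination cycleVec c ≈ cycleVec C)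
  dependent⁻ {B} {C} ind dep none = dep λ
    { (false ∷ cs) len z → refl ∷ ind cs (ℕP.suc-injective len) z
    ; (true ∷ cs) len z → let c , eq = coefs-of cycleVec B cs (ℕP.suc-injective len) in
        ⊥-elim (none (c , λ a b → trans (sym (lincomb-coefList cycleVec c a b))
            (trans (cong (λ d → lincomb d (map cycleVec B) a b) eq) (sym (xor-cancel (z a b)))))) }

  -- The rows are the members of `B′` written in terms of `B`, each bounded by its own weight. That
  -- these rows span follows from the maximality of `B′`, by which the members of `B` are
  -- combinations of members of `B′`.
  minimum-weight : ∀ {B B′} → (∀ x y → G x y → 0ℚ ≤ w x y) →
      (∀ C → IsCycle (λ _ → ⊤) G C → Span w B (cycleWeight w C) (cycleVec C)) →
    IsMaximalIndependentCycles G B → IsMaximalIndependentCycles G B′ → totalWeight w B ≤ totalWeight w B′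
  minimum-weight {B} {B′} nn span (cycB , indB , _) (cycB′ , indB′ , maxB′) = decidable-stable (_ ℚP.≤? _) λ k →
    ¬¬-All (All.map (λ {C} cyc → dependent⁻ {C = C} indB′ (maxB′ C cyc)) cycB) λ B-in-B′ →
      k (ℚP.≤-trans (exchange B (rows rowsB′) (rows-bounded rowsB′) (dual B-in-B′))
          (ℚP.≤-reflexive (cong sumℚ (rows-weight rowsB′))))
    where
    Row : List (Fin n) → Set
    Row C = 0ℚ ≤ cycleWeight w C × (∃ λ (c : Coefs B) → combination cycleVec c ≈ cycleVec C × Bounded (cycleWeight w C) c)
    rowsB′ : All Row B′
    rowsB′ = All.map (λ {C} cyc → weight-nonneg
        (All.map (λ {e} → nn (proj₁ e) (proj₂ e)) (cyc .proj₂ .proj₂ .proj₂)) , span-coefs (span C cyc)) cycB′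
    rows : ∀ {B″} → All Row B″ → List (Coefs B × ℚ)
    rows [] = []
    rows {C ∷ _} ((_ , c , _) ∷ rs) = (c , cycleWeight w C) ∷ rows rs
    rows-bounded : ∀ {B″} (rs : All Row B″) → All (λ row → Bounded (proj₂ row) (proj₁ row) × 0ℚ ≤ proj₂ row) (rows rs)
    rows-bounded [] = []
    rows-bounded ((p , _ , _ , q) ∷ rs) = (q , p) ∷ rows-bounded rs
    rows-weight : ∀ {B″} (rs : All Row B″) → map proj₂ (rows rs) ≡ map (cycleWeight w) B″
    rows-weight [] = refl
    rows-weight (_ ∷ rs) = cong (_ ∷_) (rows-weight rs)
    dual : All (λ C → ∃ λ (c : Coefs B′) → combination cycleVec c ≈ cycleVec C) B →
      ∀ f → All (λ row → dot f (proj₁ row) ≡ false) (rows rowsB′) → AllFalse f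
    -- `K v` says that `v` has some representation over `B` on which `f` vanishes. It passes from
    -- the rows to `B′`, from there to `B`, and so to every combination; since `B` is independent,
    -- the representation found is `c` itself.
    dual B-in-B′ f kills = dot-nondegenerate f λ c → let d , eq , z = closed-combination cycleVec K-𝟘 K-⊕ K-B c in
      trans (xor-cancel (trans (sym (dot-+ᶜ f c d))
          (dot-AllFalse f (c +ᶜ d) (independent-coefs cycleVec indB (c +ᶜ d) λ a b →
        trans (combination-+ᶜ cycleVec c d a b)
            (trans (cong (combination cycleVec c a b xor_) (eq a b)) (xor-same (combination cycleVec c a b))))))) z
      where
      K : EdgeVec → Set
      K v = ∃ λ (c : Coefs B) → combination cycleVec c ≈ v × dot f c ≡ false
      K-𝟘 : K 𝟘
      K-𝟘 = zeros B , combination-zeros cycleVec B , dot-AllFalse f (zeros B) (zeros-AllFalse B)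
      K-⊕ : ∀ {v v′ v″} → K v → K v′ → v″ ≈ v ⊕ v′ → K v″
      K-⊕ (c , eq , z) (c′ , eq′ , z′) eq″ = c +ᶜ c′ ,
          (λ a b → trans (combination-+ᶜ cycleVec c c′ a b) (trans (cong₂ _xor_ (eq a b) (eq′ a b)) (sym (eq″ a b)))) ,
        trans (dot-+ᶜ f c c′) (cong₂ _xor_ z z′)
      K-rows : ∀ {B″} (rs : All Row B″) → All (λ row → dot f (proj₁ row) ≡ false) (rows rs) → All (K ∘ cycleVec) B″
      K-rows [] [] = []
      K-rows ((_ , c , eq , _) ∷ rs) (k ∷ ks) = (c , eq , k) ∷ K-rows rs ks
      K-B : All (K ∘ cycleVec) B
      K-B = All.map (λ (c , eq) → let d , eq′ , z = closed-combination cycleVec K-𝟘 K-⊕ (K-rows rowsB′ kills) c in d , (λ a b → trans (eq′ a b) (eq a b)) , z) B-in-B′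

-- The whole graph

module Initial {n : ℕ} (E₀ : Rel₀ n) (w : Fin n → Fin n → ℚ) (simple : IsSimple E₀)
  (w-sym : ∀ x y → E₀ x y → w x y ≡ w y x) (w-nonneg : ∀ x y → E₀ x y → 0ℚ ≤ w x y) where

  G : Rel₀ n
  G = WithoutLong E₀ w

  G-irr : ∀ {x} → ¬ G x x
  G-irr (e , _) = simple .proj₁ _ e

  -- Not being long amounts only to not failing to be a shortest path; the inequality itself is
  -- decidable and hence follows. Walks of the whole graph, long edges included, are covered by loop
  -- erasure.
  G-short : ∀ {x y ys} → G x y → Walk E₀ x ys y → w x y ≤ weight w (steps x ys)
  G-short {x} {y} {ys} g@(e , ¬long) wk = decidable-stable (_ ℚP.≤? _) λ ≰ → ¬long (e , λ short →
    let zs , wk′ , uq , le = walk-to-path w-nonneg wk in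
    ≰ (ℚP.≤-trans (ℚP.≤-reflexive (sym (ℚP.+-identityʳ (w x y)))) (ℚP.≤-trans (short .proj₂ (x ∷ zs) (let mid , eq = unsnoc-≢ wk′ x≢y in (mid , cong (x ∷_) eq) , uq , All.tabulate _ , walk-All wk′)) le)))
    where
    x≢y : x ≢ y
    x≢y refl = G-irr g

  G-sym : ∀ {x y} → G x y → G y x
  G-sym {x} {y} g@(e , _) = simple .proj₂ x y e , λ (_ , ¬short) → ¬short
    ( (([] , refl) , (((λ { refl → G-irr g }) ∷ []) ∷ [] ∷ []) , tt ∷ tt ∷ [] , simple .proj₂ x y e ∷ [])
    , λ ps path → let ys , eq , wk , _ = path-walk path in
        ℚP.≤-trans (ℚP.≤-reflexive (trans (ℚP.+-identityʳ (w y x)) (sym (w-sym x y e))))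
          (ℚP.≤-trans (G-short g (revTail-walk (simple .proj₂ _ _) wk))
            (ℚP.≤-reflexive (trans (weight-revTail w-sym wk) (cong (pathWeight w) (sym eq))))))

  exps-initial : ∀ es → exps (initialPart E₀ w) es ≡ es
  exps-initial [] = refl
  exps-initial (e ∷ es) = cong (e ∷_) (exps-initial es)

  initial-Inv : (A : Rel₀ n) → (∀ x y → E₀ x y → A x y) → Expansion.Inv G w A (initialPart E₀ w)
  initial-Inv A E⊆A = record
    { E-sym = G-sym
    ; E-V = λ _ → tt
    ; E-irr = G-irr
    ; E-A = λ (e , _) → E⊆A _ _ e
    ; wt-sym = λ x y (e , _) → w-sym x y e
    ; wt-nonneg = λ x y (e , _) → w-nonneg x y e
    ; no-long = λ g wk → G-short g (walk-map proj₁ wk)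
    ; exp-tail = λ _ → refl
    ; exp-walk = λ g → g ∷ []
    ; exp-unique = λ g → ((λ { refl → G-irr g }) ∷ []) ∷ [] ∷ []
    ; exp-reverse = λ _ → refl
    ; exp-weight = λ {x} {y} _ → ℚP.+-identityʳ (w x y)
    ; exp-V = λ { _ (here eq) _ → inj₁ eq ; _ (there (here eq)) _ → inj₂ eq }
    ; exp-disjoint = λ _ _ _ _ ¬tt → contradiction tt ¬tt }

theorem3 : (n : ℕ) (E : Rel₀ n) (w : Fin n → Fin n → ℚ) →
    IsSimple E → (∀ x y → E x y → w x y ≡ w y x) → (∀ x y → E x y → 0ℚ ≤ w x y) →
    TwoConnected E → Partial2Tree E →
    (σ : Permutation′ n) →
    (Gs : List (Part n)) → Decomp (initialPart E w) Gs →
    (Css : List (List (List (Fin n)))) → Pointwise (EnumeratesLSC σ) Gs Css →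
    IsMinimumCycleBasis (WithoutLong E w) w (exAll Gs Css)
theorem3 n E w simple w-sym w-nonneg _ (m , T , tree , f , f-inj , E⊆T) σ Gs dec Css enums =
  basis , λ B′ basis′ → decidable-stable (_ ℚP.≤? _) λ ≰ → deciders λ ds →
      ≰ (minimum-weight (λ x y (e , _) → w-nonneg x y e) (span ds) basis basis′)
  where
  open Initial E w simple w-sym w-nonneg
  A : Rel₀ n
  A x y = T (f x) (f y) ≡ true
  open Assembly G G-sym G-irr w (λ x y (e , _) → w-sym x y e) A (Elimination-pullback f f-inj (TwoTree-elimination tree)) σ
  Bs : List (List (Fin n))
  Bs = exAll Gs Css
  open Result (decomp-Result (initial-Inv A E⊆T) dec enums)
  deciders : ¬ ¬ Deciders Gs
  deciders = ¬¬-All (All.tabulate λ _ → ¬¬-Fin λ x → ¬¬-Fin λ y → ¬¬-excluded-middle)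
  span : Deciders Gs → ∀ C → IsCycle (λ _ → ⊤) G C → Span w Bs (cycleWeight w C) (cycleVec C)
  span ds C cyc = Span-cong (λ a b → cong (λ es → incidence es a b) (exps-initial (cycEdges C))) (spans ds C cyc)
  basis : IsMaximalIndependentCycles G Bs
  basis = cycles , independent , λ C cyc ind → deciders λ ds →
    let c , eq , _ = span-coefs {G = G} (span ds C cyc) in dependent {G = G} {w = w} {C = C} c eq ind
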